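{- Any polynomial-size data structure for maintaining a longest common substring of two dynamic strings (each subject to letter substitutions), each of length at most $n$, requires $\Omega(\log n/\log\log n)$ time per update operation.
   Context: A longest common substring of two strings is a longest string occurring as a contiguous substring of both; the data structure must report (the length of) a longest common substring after each update. Lower bounds are in the cell-probe/word-RAM model with words of $\Theta(\log n)$ bits. -}

module Defs where

open import Data.Nat using (ℕ; zero; suc; _+_; _*_; _^_; _≤_)
open import Data.Fin using (Fin; _≟_)
open import Data.Bool using (Bool; true; false)
open import Data.Vec using (Vec; toList; _[_]≔_)
open import Data.List using (List; []; _∷_; length)
open import Data.List.Relation.Binary.Infix.Heterogeneous using (Infix)
open import Data.Product using (Σ; _×_; _,_; proj₁; proj₂)
open import Data.Unit using (⊤)
open import Relation.Binary.PropositionalEquality using (_≡_)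
open import Relation.Nullary using (yes; no)

Str : ℕ → ℕ → Set
Str σ n = Vec (Fin σ) n

_⊑_ : ∀ {σ n} → List (Fin σ) → Str σ n → Set
u ⊑ s = Infix _≡_ u (toList s)

CommonSubstring : ∀ {σ n} → Str σ n → Str σ n → List (Fin σ) → Set
CommonSubstring s t u = (u ⊑ s) × (u ⊑ t)

IsLCSLength : ∀ {σ n} → Str σ n → Str σ n → ℕ → Set
IsLCSLength {σ} s t L =
  Σ (List (Fin σ)) (λ u → CommonSubstring s t u × length u ≡ L)
  × (∀ (v : List (Fin σ)) → CommonSubstring s t v → length v ≤ L)

Word : ℕ → Set
Word w = Fin (2 ^ w)

Mem : ℕ → ℕ → Set
Mem S w = Fin S → Word w

-- An operation is a (adaptive) cell-probe decision tree: it reads and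
-- writes cells and finally returns a value of type A.  Computation is free;
-- only probes (reads and writes) are charged.
data Prog (S w : ℕ) (A : Set) : Set where
  ret   : A → Prog S w A
  read  : Fin S → (Word w → Prog S w A) → Prog S w A
  write : Fin S → Word w → Prog S w A → Prog S w A

writeMem : ∀ {S w} → Mem S w → Fin S → Word w → Mem S w
writeMem m i x j with j ≟ i
... | yes _ = x
... | no  _ = m j

run : ∀ {S w A} → Prog S w A → Mem S w → A × Mem S w × ℕ
run (ret a)       m = a , m , 0
run (read i k)    m with run (k (m i)) m
... | a , m' , c = a , m' , suc c
run {S} {w} (write i x p) m with run p (writeMem {S} {w} m i x)
... | a , m' , c = a , m' , suc c

Alph : ℕ → ℕ
Alph n = n

Upd : ℕ → Set
Upd n = Bool × Fin n × Fin (Alph n)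

applyUpd : ∀ {n} → Upd n → Str (Alph n) n × Str (Alph n) n
         → Str (Alph n) n × Str (Alph n) n
applyUpd (false , i , c) (s , t) = (s [ i ]≔ c) , t
applyUpd (true  , i , c) (s , t) = s , (t [ i ]≔ c)

-- A data structure in the cell-probe model with S cells of w bits for
-- the dynamic LCS problem on strings of length n.  Preprocessing of the
-- initial strings is free (init); each update is a cell-probe program
-- that, after performing the update, returns the LCS length.
record DynLCS (n S w : ℕ) : Set where
  field
    init   : Str (Alph n) n → Str (Alph n) n → Mem S w
    update : Upd n → Prog S w ℕ

module _ {n S w : ℕ} (D : DynLCS n S w) where
  open DynLCS D

  Config : Set
  Config = (Str (Alph n) n × Str (Alph n) n) × Mem S w

  step : Config → Upd n → ℕ × ℕ × Config
  step (st , m) u with run (update u) m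
  ... | a , m' , c = a , c , (applyUpd u st , m')

  after : Config → List (Upd n) → Config
  after cfg []       = cfg
  after cfg (u ∷ us) = after (proj₂ (proj₂ (step cfg u))) us

  correctFrom : Config → List (Upd n) → Set
  correctFrom cfg [] = ⊤
  correctFrom cfg (u ∷ us) with step cfg u
  ... | a , c , cfg'@((s , t) , _) = IsLCSLength s t a × correctFrom cfg' us

  initConfig : Str (Alph n) n → Str (Alph n) n → Config
  initConfig s t = (s , t) , init s t

  Correct : Set
  Correct = ∀ (s t : Str (Alph n) n) (us : List (Upd n))
          → correctFrom (initConfig s t) us

  costAfter : Str (Alph n) n → Str (Alph n) n → List (Upd n) → Upd n → ℕ
  costAfter s t us u = proj₁ (proj₂ (step (after (initConfig s t) us) u))

{-# OPTIONS --safe #-}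

-- Queries are the source–target paths of a butterfly network of degree b and depth G, where b is a
-- power of log n and G = Θ(log n / log log n); the data is a set of marked edges.  Each edge and each
-- path owns a block in one of the strings, and a single substitution switches it on.  When the block
-- of one path is on, the longest common substring has length at least G + 3 exactly if a marked edge
-- lies on the path.
--
-- Suppose that all updates make at most t probes, with t much smaller than G, and keep every memory
-- cell with probability 1/b².  A batch of b^G vertex-disjoint unmarked paths is answered from kept
-- cells alone with probability at least about b^(-2 t b^G).  Fix a sample that does well on average
-- over batches and data.  Few kept cells differ from the initial memory, so there are few possible
-- messages (contents of the kept cells), even though the sample contains many cells never written.
-- A message determines which paths it answers, and all edges of these are unmarked.  If at most h
-- vertices have K = √b or more such edges going out, then only a b^(-Ω(G b^G)) fraction of all batches
-- consists of answered paths; otherwise K h edges are known to be unmarked, which holds for a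
-- 2^(-K h) fraction of the data only, and that is negligible even after summing over all messages.

module Submission where

open import Defs
open import Data.Nat using (ℕ; _*_; _^_; _≤_; _≥_)
open import Data.Nat.Logarithm using (⌊log₂_⌋)
open import Data.List using (List)
open import Data.Product using (Σ; ∃; _×_)

open import Data.Bool as Bool using (Bool; true; false; not; _∧_; _∨_; if_then_else_)
open import Data.Bool.Properties using (∨-zeroʳ)
open import Data.Empty using (⊥; ⊥-elim)
open import Data.Fin as Fin using (Fin; zero; suc; toℕ; fromℕ<)
open import Data.Fin.Properties using (toℕ<n; toℕ-fromℕ<; toℕ-injective; any?)
open import Data.List using ([]; _∷_; length; map; concatMap; _++_; upTo; replicate; take; drop; filterᵇ; allFin)
open import Data.List.Properties using (map-applyUpTo; length-++; length-upTo; length-map; length-tabulate; length-filter; length-take; length-drop)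
open import Data.List.Membership.Propositional using (_∈_)
open import Data.List.Membership.Propositional.Properties using (∈-upTo⁻; ∈-upTo⁺; ∈-++⁺ˡ; ∈-++⁺ʳ; ∈-++⁻; ∈-map⁺; ∈-map⁻; ∈-allFin; ∈-concat⁺′; ∈-concat⁻′; ∈-filter⁺; ∈-filter⁻)
open import Data.List.Relation.Unary.All as All using (All; []; _∷_)
open import Data.List.Relation.Unary.All.Properties using () renaming (map⁺ to All-map⁺)
open import Data.List.Relation.Unary.AllPairs using (AllPairs; []; _∷_)
open import Data.List.Relation.Unary.Any using (here; there)
open import Data.List.Relation.Binary.Infix.Heterogeneous using (Infix; here; there)
open import Data.List.Relation.Binary.Prefix.Heterogeneous using (Prefix; []; _∷_)
open import Data.Nat using (zero; suc; _+_; _∸_; _<_; z≤n; s≤s; s≤s⁻¹; _≟_; _≤?_; _<?_; pred; ⌊_/2⌋; ⌈_/2⌉; NonZero; >-nonZero)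
open import Data.Nat.Properties hiding (_≟_; _≤?_; _<?_)
open import Data.Nat.DivMod
open import Data.Nat.Induction using (<-wellFounded)
open import Data.Nat.Logarithm using (⌊log₂⌋-mono-≤; ⌊log₂[2^n]⌋≡n; ⌊log₂⌊n/2⌋⌋≡⌊log₂n⌋∸1)
open import Data.Nat.Solver using (module +-*-Solver)
open import Data.Product using (_,_; proj₁; proj₂)
open import Data.Sum using (_⊎_; inj₁; inj₂; map₂)
open import Data.Unit using (⊤; tt)
open import Data.Vec using (Vec; []; _∷_; toList; _[_]≔_; tabulate)
open import Data.Vec.Properties using (length-toList)
open import Function using (_∘_; id)
open import Induction.WellFounded using (Acc; acc)
open import Relation.Binary.Definitions using (tri<; tri≈; tri>)
open import Relation.Binary.PropositionalEquality
open import Relation.Nullary using (Dec; ¬_; yes; no; ¬?)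
open import Relation.Nullary.Decidable using (⌊_⌋; T?; decidable-stable; toWitness)
open +-*-Solver using (solve; _:=_; _:+_; _:*_; con)

-- Single paths would not be enough: fixing the leading digits of source and target singles out G
-- b^(G-1) vertices, so few that a message is long enough to describe all their edges, yet they
-- carry a b^(-2) fraction of all paths. Vertex-disjoint paths cannot crowd into a small part of the
-- network: h heavy vertices are met at most h times by a whole batch, which has G b^G meetings in
-- all. To make a random batch disjoint often enough, targets have one digit more than sources; a
-- path then runs into the earlier ones with probability at most G / b.
--
-- Answers are used in one direction only. A message speaks for a path when the run simulated on it
-- stays inside the sample and reports an unmarked path. Nothing is claimed about other paths, so
-- nothing has to be said about cells outside the sample.
--
-- Per path of a batch, survival costs b^(2t), while light vertices leave only a fraction of about
-- b^(-3G/8); this is why t has to be of order G. The bits of a message exceed G b^G by a power of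
-- log n, and the power of log n in b is chosen so that K exceeds that factor.

private variable
  A B : Set
  σ : ℕ

-- Finite sums

∑ : List A → (A → ℕ) → ℕ
∑ []       f = 0
∑ (x ∷ xs) f = f x + ∑ xs f

⟦_⟧ : Bool → ℕ
⟦ true ⟧  = 1
⟦ false ⟧ = 0

⟦⟧≤1 : ∀ a → ⟦ a ⟧ ≤ 1
⟦⟧≤1 true  = ≤-refl
⟦⟧≤1 false = z≤n

∑-mono : ∀ (xs : List A) {f g : A → ℕ} → (∀ {x} → x ∈ xs → f x ≤ g x) → ∑ xs f ≤ ∑ xs g
∑-mono []       h = z≤n
∑-mono (x ∷ xs) h = +-mono-≤ (h (here refl)) (∑-mono xs (h ∘ there))

∑-cong : ∀ (xs : List A) {f g : A → ℕ} → (∀ x → f x ≡ g x) → ∑ xs f ≡ ∑ xs g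
∑-cong []       h = refl
∑-cong (x ∷ xs) h = cong₂ _+_ (h x) (∑-cong xs h)

∑-+ : ∀ (xs : List A) (f g : A → ℕ) → ∑ xs (λ x → f x + g x) ≡ ∑ xs f + ∑ xs g
∑-+ []       f g = refl
∑-+ (x ∷ xs) f g rewrite ∑-+ xs f g =
  solve 4 (λ a b c d → (a :+ b) :+ (c :+ d) := (a :+ c) :+ (b :+ d)) refl
    (f x) (g x) (∑ xs f) (∑ xs g)

∑-*ˡ : ∀ (xs : List A) c (f : A → ℕ) → ∑ xs (λ x → c * f x) ≡ c * ∑ xs f
∑-*ˡ []       c f = sym (*-zeroʳ c)
∑-*ˡ (x ∷ xs) c f rewrite ∑-*ˡ xs c f = sym (*-distribˡ-+ c (f x) (∑ xs f))

∑-*ʳ : ∀ (xs : List A) c (f : A → ℕ) → ∑ xs (λ x → f x * c) ≡ ∑ xs f * c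
∑-*ʳ []       c f = refl
∑-*ʳ (x ∷ xs) c f rewrite ∑-*ʳ xs c f = sym (*-distribʳ-+ c (f x) (∑ xs f))

∑-const : ∀ (xs : List A) c → ∑ xs (λ _ → c) ≡ length xs * c
∑-const []       c = refl
∑-const (x ∷ xs) c = cong (c +_) (∑-const xs c)

∑-bound : ∀ (xs : List A) {f : A → ℕ} {c} → (∀ {x} → x ∈ xs → f x ≤ c) → ∑ xs f ≤ length xs * c
∑-bound xs {c = c} h = subst (_ ≤_) (∑-const xs c) (∑-mono xs h)

∑-swap : ∀ (xs : List A) (ys : List B) (f : A → B → ℕ) →
  ∑ xs (λ x → ∑ ys (f x)) ≡ ∑ ys (λ y → ∑ xs (λ x → f x y))
∑-swap [] ys f = sym (trans (∑-const ys 0) (*-zeroʳ (length ys)))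
∑-swap (x ∷ xs) ys f rewrite ∑-swap xs ys f = sym (∑-+ ys (f x) (λ y → ∑ xs (λ x → f x y)))

∑-++ : ∀ (xs ys : List A) (f : A → ℕ) → ∑ (xs ++ ys) f ≡ ∑ xs f + ∑ ys f
∑-++ []       ys f = refl
∑-++ (x ∷ xs) ys f rewrite ∑-++ xs ys f = sym (+-assoc (f x) _ _)

∑-map : ∀ (xs : List A) (h : A → B) (f : B → ℕ) → ∑ (map h xs) f ≡ ∑ xs (f ∘ h)
∑-map []       h f = refl
∑-map (x ∷ xs) h f = cong (f (h x) +_) (∑-map xs h f)

∑-concatMap : ∀ (xs : List A) (h : A → List B) (f : B → ℕ) →
  ∑ (concatMap h xs) f ≡ ∑ xs (λ x → ∑ (h x) f)
∑-concatMap []       h f = refl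
∑-concatMap (x ∷ xs) h f =
  trans (∑-++ (h x) (concatMap h xs) f) (cong (∑ (h x) f +_) (∑-concatMap xs h f))

∑-replicate : ∀ r (x : A) (f : A → ℕ) → ∑ (replicate r x) f ≡ r * f x
∑-replicate zero    x f = refl
∑-replicate (suc r) x f = cong (f x +_) (∑-replicate r x f)

length-∑ : ∀ (xs : List A) → length xs ≡ ∑ xs (λ _ → 1)
length-∑ xs = sym (trans (∑-const xs 1) (*-identityʳ _))

∑-member : ∀ {xs : List A} {x} (f : A → ℕ) → x ∈ xs → f x ≤ ∑ xs f
∑-member f (here refl) = m≤m+n _ _
∑-member f (there p)   = ≤-trans (∑-member f p) (m≤n+m _ _)

∑-average : ∀ (xs : List A) (f : A → ℕ) → 0 < length xs → ∃ λ x → ∑ xs f ≤ length xs * f x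
∑-average (x ∷ []) f _ = x , ≤-refl
∑-average (x ∷ x' ∷ xs) f _ with ∑-average (x' ∷ xs) f (s≤s z≤n)
... | y , h with ≤-total (f x) (f y)
...   | inj₁ x≤y = y , +-mono-≤ x≤y h
...   | inj₂ y≤x = x , +-monoʳ-≤ (f x) (≤-trans h (*-monoʳ-≤ (length (x' ∷ xs)) y≤x))

∑-upTo-suc : ∀ n f → ∑ (upTo (suc n)) f ≡ f 0 + ∑ (upTo n) (f ∘ suc)
∑-upTo-suc n f = cong (f 0 +_)
  (trans (cong (λ l → ∑ l f) (sym (map-applyUpTo id suc n))) (∑-map (upTo n) suc f))

∑-upTo-+ : ∀ m n f → ∑ (upTo (m + n)) f ≡ ∑ (upTo m) f + ∑ (upTo n) (λ i → f (m + i))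
∑-upTo-+ zero    n f = refl
∑-upTo-+ (suc m) n f
  rewrite ∑-upTo-suc (m + n) f | ∑-upTo-suc m f | ∑-upTo-+ m n (f ∘ suc) =
  sym (+-assoc (f 0) _ _)

∑-upTo-* : ∀ m k f → ∑ (upTo (m * k)) f ≡ ∑ (upTo m) (λ q → ∑ (upTo k) (λ r → f (q * k + r)))
∑-upTo-* zero    k f = refl
∑-upTo-* (suc m) k f
  rewrite ∑-upTo-+ k (m * k) f
        | ∑-upTo-suc m (λ q → ∑ (upTo k) (λ r → f (q * k + r)))
        | ∑-upTo-* m k (λ i → f (k + i)) =
  cong (∑ (upTo k) f +_)
    (∑-cong (upTo m) λ q → ∑-cong (upTo k) λ r → cong f (sym (+-assoc k (q * k) r)))

count : ℕ → (ℕ → Bool) → ℕ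
count n C = ∑ (upTo n) (λ i → ⟦ C i ⟧)

count-suc : ∀ n C → count (suc n) C ≡ ⟦ C 0 ⟧ + count n (C ∘ suc)
count-suc n C = ∑-upTo-suc n _

-- Random subsets

cons : Bool → (ℕ → Bool) → ℕ → Bool
cons a f zero    = a
cons a f (suc i) = f i

-- Subsets of {0,…,n-1}, where false is listed r times for each true: a uniform entry of the
-- list is a random subset containing each point independently with probability 1/(1+r).
subsets : ℕ → ℕ → List (ℕ → Bool)
subsets r zero    = (λ _ → false) ∷ []
subsets r (suc n) = concatMap (λ f → cons true f ∷ replicate r (cons false f)) (subsets r n)

∑-subsets-suc : ∀ r n F →
  ∑ (subsets r (suc n)) F ≡ ∑ (subsets r n) (λ f → F (cons true f) + r * F (cons false f))
∑-subsets-suc r n F = trans (∑-concatMap (subsets r n) _ F)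
  (∑-cong (subsets r n) λ f → cong (F (cons true f) +_) (∑-replicate r (cons false f) F))

length-subsets : ∀ r n → length (subsets r n) ≡ suc r ^ n
length-subsets r zero    = refl
length-subsets r (suc n) = begin
  length (subsets r (suc n))                 ≡⟨ length-∑ (subsets r (suc n)) ⟩
  ∑ (subsets r (suc n)) (λ _ → 1)            ≡⟨ ∑-subsets-suc r n (λ _ → 1) ⟩
  ∑ (subsets r n) (λ _ → 1 + r * 1)          ≡⟨ ∑-const (subsets r n) (1 + r * 1) ⟩
  length (subsets r n) * (1 + r * 1)         ≡⟨ cong₂ _*_ (length-subsets r n) (cong suc (*-identityʳ r)) ⟩
  suc r ^ n * suc r                          ≡⟨ *-comm (suc r ^ n) (suc r) ⟩
  suc r ^ suc n                              ∎
  where open ≡-Reasoning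

subset : ℕ → (ℕ → Bool) → (ℕ → Bool) → Bool
subset zero    C T = true
subset (suc n) C T = (not (C 0) ∨ T 0) ∧ subset n (C ∘ suc) (T ∘ suc)

subset-intro : ∀ n C T → (∀ i → i < n → C i ≡ true → T i ≡ true) → subset n C T ≡ true
subset-intro zero    C T h = refl
subset-intro (suc n) C T h
  rewrite subset-intro n (C ∘ suc) (T ∘ suc) (λ i i<n → h (suc i) (s≤s i<n))
  with C 0 in eq
... | false = refl
... | true rewrite h 0 (s≤s z≤n) eq = refl

subset-elim : ∀ n C T → subset n C T ≡ true → ∀ i → i < n → C i ≡ true → T i ≡ true
subset-elim (suc n) C T h zero    _ Ci with C 0 | T 0 | h
... | true | true | _ = refl
subset-elim (suc n) C T h (suc i) (s≤s i<n) Ci with not (C 0) ∨ T 0 | h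
... | true | h' = subset-elim n (C ∘ suc) (T ∘ suc) h' i i<n Ci

supersets : ℕ → ℕ → (ℕ → Bool) → ℕ
supersets r n C = ∑ (subsets r n) (λ T → ⟦ subset n C T ⟧)

supersets-suc : ∀ r n C → supersets r (suc n) C ≡
  ∑ (subsets r n) (λ f → ⟦ subset n (C ∘ suc) f ⟧ + r * ⟦ not (C 0) ∧ subset n (C ∘ suc) f ⟧)
supersets-suc r n C = trans (∑-subsets-suc r n _) (∑-cong (subsets r n) stepwise)
  where
  stepwise : ∀ f → ⟦ (not (C 0) ∨ true) ∧ subset n (C ∘ suc) f ⟧
    + r * ⟦ (not (C 0) ∨ false) ∧ subset n (C ∘ suc) f ⟧
    ≡ ⟦ subset n (C ∘ suc) f ⟧ + r * ⟦ not (C 0) ∧ subset n (C ∘ suc) f ⟧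
  stepwise f with C 0
  ... | true  = refl
  ... | false = refl

-- A point of C admits only the one entry `true` out of `suc r` for its coordinate, while any other
-- point admits all of them.
supersets-count : ∀ r n C → suc r ^ count n C * supersets r n C ≡ suc r ^ n
supersets-count r zero C = refl
supersets-count r (suc n) C rewrite count-suc n C | supersets-suc r n C with C 0
... | true = begin
  suc r ^ suc c * ∑ xs (λ f → ⟦ subset n C' f ⟧ + r * 0)
    ≡⟨ cong (suc r ^ suc c *_) (∑-cong xs λ f → trans (cong (⟦ subset n C' f ⟧ +_) (*-zeroʳ r)) (+-identityʳ _)) ⟩
  suc r ^ suc c * supersets r n C'      ≡⟨ *-assoc (suc r) (suc r ^ c) _ ⟩
  suc r * (suc r ^ c * supersets r n C') ≡⟨ cong (suc r *_) (supersets-count r n C') ⟩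
  suc r ^ suc n ∎
  where
  open ≡-Reasoning
  C' = C ∘ suc
  c = count n C'
  xs = subsets r n
... | false = begin
  suc r ^ c * ∑ xs (λ f → ⟦ subset n C' f ⟧ + r * ⟦ subset n C' f ⟧)
    ≡⟨ cong (suc r ^ c *_) (∑-*ˡ xs (suc r) (λ f → ⟦ subset n C' f ⟧)) ⟩
  suc r ^ c * (suc r * supersets r n C')
    ≡⟨ solve 3 (λ a b d → a :* (b :* d) := b :* (a :* d)) refl (suc r ^ c) (suc r) (supersets r n C') ⟩
  suc r * (suc r ^ c * supersets r n C') ≡⟨ cong (suc r *_) (supersets-count r n C') ⟩
  suc r ^ suc n ∎
  where
  open ≡-Reasoning
  C' = C ∘ suc
  c = count n C'
  xs = subsets r n

-- A point outside C lies in a random superset of C with probability 1/(1+r).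
supersets-point : ∀ r n C a → a < n → C a ≡ false →
  suc r * ∑ (subsets r n) (λ T → ⟦ subset n C T ⟧ * ⟦ T a ⟧) ≡ supersets r n C
supersets-point r (suc n) C zero _ Ca
  rewrite ∑-subsets-suc r n (λ T → ⟦ subset (suc n) C T ⟧ * ⟦ T 0 ⟧) | supersets-suc r n C | Ca = begin
  suc r * ∑ xs (λ f → ⟦ s f ⟧ * 1 + r * (⟦ s f ⟧ * 0))
    ≡⟨ cong (suc r *_) (∑-cong xs λ f →
        solve 2 (λ a b → a :* con 1 :+ b :* (a :* con 0) := a) refl ⟦ s f ⟧ r) ⟩
  suc r * ∑ xs (λ f → ⟦ s f ⟧)     ≡⟨ sym (∑-*ˡ xs (suc r) _) ⟩
  ∑ xs (λ f → ⟦ s f ⟧ + r * ⟦ s f ⟧) ∎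
  where
  open ≡-Reasoning
  xs = subsets r n
  s : (ℕ → Bool) → Bool
  s f = subset n (C ∘ suc) f
supersets-point r (suc n) C (suc a) (s≤s a<n) Ca
  rewrite ∑-subsets-suc r n (λ T → ⟦ subset (suc n) C T ⟧ * ⟦ T (suc a) ⟧) | supersets-suc r n C with C 0
... | true = begin
  suc r * ∑ xs (λ f → ⟦ s f ⟧ * ⟦ f a ⟧ + r * 0)
    ≡⟨ cong (suc r *_) (∑-cong xs λ f → trans (cong (⟦ s f ⟧ * ⟦ f a ⟧ +_) (*-zeroʳ r)) (+-identityʳ _)) ⟩
  suc r * ∑ xs (λ f → ⟦ s f ⟧ * ⟦ f a ⟧) ≡⟨ supersets-point r n (C ∘ suc) a a<n Ca ⟩
  ∑ xs (λ f → ⟦ s f ⟧)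
    ≡⟨ ∑-cong xs (λ f → sym (trans (cong (⟦ s f ⟧ +_) (*-zeroʳ r)) (+-identityʳ _))) ⟩
  ∑ xs (λ f → ⟦ s f ⟧ + r * 0) ∎
  where
  open ≡-Reasoning
  xs = subsets r n
  s : (ℕ → Bool) → Bool
  s f = subset n (C ∘ suc) f
... | false = begin
  suc r * ∑ xs (λ f → ⟦ s f ⟧ * ⟦ f a ⟧ + r * (⟦ s f ⟧ * ⟦ f a ⟧))
    ≡⟨ cong (suc r *_) (∑-*ˡ xs (suc r) _) ⟩
  suc r * (suc r * ∑ xs (λ f → ⟦ s f ⟧ * ⟦ f a ⟧))
    ≡⟨ cong (suc r *_) (supersets-point r n (C ∘ suc) a a<n Ca) ⟩
  suc r * ∑ xs (λ f → ⟦ s f ⟧) ≡⟨ sym (∑-*ˡ xs (suc r) _) ⟩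
  ∑ xs (λ f → ⟦ s f ⟧ + r * ⟦ s f ⟧) ∎
  where
  open ≡-Reasoning
  xs = subsets r n
  s : (ℕ → Bool) → Bool
  s f = subset n (C ∘ suc) f

_∩_ : (ℕ → Bool) → (ℕ → Bool) → ℕ → Bool
(W ∩ T) i = W i ∧ T i

_∖_ : (ℕ → Bool) → (ℕ → Bool) → ℕ → Bool
(W ∖ C) i = W i ∧ not (C i)

⟦∧⟧ : ∀ a c → ⟦ a ∧ c ⟧ ≡ ⟦ a ⟧ * ⟦ c ⟧
⟦∧⟧ true  c = sym (*-identityˡ _)
⟦∧⟧ false c = refl

count-∩≤ : ∀ n W C T → count n (W ∩ T) ≤ count n C + count n ((W ∖ C) ∩ T)
count-∩≤ n W C T = ≤-trans (∑-mono (upTo n) (λ {i} _ → pt (W i) (C i) (T i)))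
  (≤-reflexive (∑-+ (upTo n) (λ i → ⟦ C i ⟧) (λ i → ⟦ ((W ∖ C) ∩ T) i ⟧)))
  where
  pt : ∀ w c t → ⟦ w ∧ t ⟧ ≤ ⟦ c ⟧ + ⟦ (w ∧ not c) ∧ t ⟧
  pt false c t = z≤n
  pt true true t = ≤-trans (⟦⟧≤1 t) (s≤s z≤n)
  pt true false t = ≤-refl

-- Markov's inequality before summation: where `v ≤ k` fails, `suc k ≤ v`, so the term `⟦ a ⟧ * v`
-- pays.
⟦≤⟧-markov : ∀ a k v → ⟦ a ⟧ * suc k ≤ ⟦ a ∧ ⌊ v ≤? k ⌋ ⟧ * suc k + ⟦ a ⟧ * v
⟦≤⟧-markov false k v = z≤n
⟦≤⟧-markov true k v with v ≤? k
... | yes _ = m≤m+n _ _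
... | no v≰k = +-monoˡ-≤ 0 (≰⇒> v≰k)

-- C holds the cells that a batch reads, W the changed cells. Given that T contains C, every point
-- of W outside C is kept with probability 1 / `suc r`, on average at most ω of them, so by Markov
-- at most half of these T keep more than `2 * ω`. The points of C add at most c.
sampling : ∀ r n C W c ω →
  count n C ≤ c → count n W ≤ suc r * ω →
  suc r ^ n ≤ 2 * (suc r ^ c *
    ∑ (subsets r n) (λ T → ⟦ subset n C T ∧ ⌊ count n (W ∩ T) ≤? c + 2 * ω ⌋ ⟧))
sampling r n C W c ω C≤c W≤ω = begin
  suc r ^ n                        ≡⟨ sym (supersets-count r n C) ⟩
  suc r ^ count n C * N            ≤⟨ *-monoˡ-≤ N (^-monoʳ-≤ (suc r) C≤c) ⟩
  suc r ^ c * N                    ≤⟨ *-monoʳ-≤ (suc r ^ c) N≤ ⟩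
  suc r ^ c * (2 * good)           ≡⟨ solve 2 (λ a b → a :* (con 2 :* b) := con 2 :* (a :* b)) refl (suc r ^ c) good ⟩
  2 * (suc r ^ c * good)           ≤⟨ *-monoʳ-≤ 2 (*-monoʳ-≤ (suc r ^ c) (∑-mono xs (λ {T} _ → good≤ T))) ⟩
  _ ∎
  where
  open ≤-Reasoning
  xs = subsets r n
  N = supersets r n C
  V : (ℕ → Bool) → ℕ
  V T = count n ((W ∖ C) ∩ T)
  good = ∑ xs (λ T → ⟦ subset n C T ∧ ⌊ V T ≤? 2 * ω ⌋ ⟧)
  good≤ : ∀ T → ⟦ subset n C T ∧ ⌊ V T ≤? 2 * ω ⌋ ⟧ ≤
                ⟦ subset n C T ∧ ⌊ count n (W ∩ T) ≤? c + 2 * ω ⌋ ⟧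
  good≤ T with subset n C T | V T ≤? 2 * ω
  ... | false | _ = z≤n
  ... | true | no _ = z≤n
  ... | true | yes V≤ with count n (W ∩ T) ≤? c + 2 * ω
  ...   | yes _ = ≤-refl
  ...   | no ¬p = ⊥-elim (¬p (≤-trans (count-∩≤ n W C T) (+-mono-≤ C≤c V≤)))
  Z = ∑ xs (λ T → ⟦ subset n C T ⟧ * V T)
  Z-eq : Z ≡ ∑ (upTo n) (λ a → ⟦ (W ∖ C) a ⟧ * ∑ xs (λ T → ⟦ subset n C T ⟧ * ⟦ T a ⟧))
  Z-eq = trans (∑-cong xs (λ T → sym (∑-*ˡ (upTo n) ⟦ subset n C T ⟧ _)))
    (trans (∑-swap xs (upTo n) _) (∑-cong (upTo n) λ a →
      trans (∑-cong xs (λ T → trans (cong (⟦ subset n C T ⟧ *_) (⟦∧⟧ ((W ∖ C) a) (T a)))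
              (solve 3 (λ x y z → x :* (y :* z) := y :* (x :* z)) refl
                 ⟦ subset n C T ⟧ ⟦ (W ∖ C) a ⟧ ⟦ T a ⟧)))
            (∑-*ˡ xs ⟦ (W ∖ C) a ⟧ _)))
  pt : ∀ {a} → a ∈ upTo n →
    suc r * (⟦ (W ∖ C) a ⟧ * ∑ xs (λ T → ⟦ subset n C T ⟧ * ⟦ T a ⟧)) ≤ ⟦ W a ⟧ * N
  pt {a} a∈ with W a | C a in eq
  ... | false | _ = ≤-reflexive (*-zeroʳ (suc r))
  ... | true  | true = ≤-trans (≤-reflexive (*-zeroʳ (suc r))) z≤n
  ... | true  | false = ≤-reflexive (trans (cong (suc r *_) (*-identityˡ _))
          (trans (supersets-point r n C a (∈-upTo⁻ a∈) eq) (sym (*-identityˡ N))))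
  Z≤ : Z ≤ ω * N
  Z≤ = *-cancelˡ-≤ (suc r) (begin
    suc r * Z ≡⟨ cong (suc r *_) Z-eq ⟩
    suc r * ∑ (upTo n) _ ≡⟨ sym (∑-*ˡ (upTo n) (suc r) _) ⟩
    ∑ (upTo n) _ ≤⟨ ∑-mono (upTo n) pt ⟩
    ∑ (upTo n) (λ a → ⟦ W a ⟧ * N) ≡⟨ ∑-*ʳ (upTo n) N _ ⟩
    count n W * N ≤⟨ *-monoˡ-≤ N W≤ω ⟩
    suc r * ω * N ≡⟨ *-assoc (suc r) ω N ⟩
    suc r * (ω * N) ∎)
  k = 2 * ω
  markov : N * suc k ≤ good * suc k + Z
  markov = begin
    N * suc k ≡⟨ sym (∑-*ʳ xs (suc k) _) ⟩
    ∑ xs _ ≤⟨ ∑-mono xs (λ {T} _ → ⟦≤⟧-markov (subset n C T) k (V T)) ⟩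
    ∑ xs _ ≡⟨ ∑-+ xs _ _ ⟩
    _ ≡⟨ cong (_+ Z) (∑-*ʳ xs (suc k) _) ⟩
    good * suc k + Z ∎
  -- Since k is `2 * ω`, `2 * Z` is at most `N * suc k`, so Markov loses at most half of N. Adding
  -- `2 * Z` to both sides replaces the subtraction.
  N≤ : N ≤ 2 * good
  N≤ = *-cancelʳ-≤ N (2 * good) (suc k) (+-cancelʳ-≤ (2 * Z) (N * suc k) (2 * good * suc k) (begin
    N * suc k + 2 * Z ≤⟨ +-monoʳ-≤ (N * suc k) (≤-trans (*-monoʳ-≤ 2 Z≤) (≤-trans (≤-reflexive
       (solve 2 (λ a b → con 2 :* (a :* b) := b :* (con 2 :* a)) refl ω N)) (*-monoʳ-≤ N (n≤1+n k)))) ⟩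
    N * suc k + N * suc k ≡⟨ solve 1 (λ a → a :+ a := con 2 :* a) refl (N * suc k) ⟩
    2 * (N * suc k) ≤⟨ *-monoʳ-≤ 2 markov ⟩
    2 * (good * suc k + Z) ≡⟨ solve 3 (λ a b c → con 2 :* (a :* b :+ c) := con 2 :* a :* b :+ con 2 :* c) refl good (suc k) Z ⟩
    2 * good * suc k + 2 * Z ∎))

-- Counting points

isPoint : ℕ → ℕ → Bool
isPoint a i = ⌊ i ≟ a ⌋

isPoint-refl : ∀ a → isPoint a a ≡ true
isPoint-refl a with a ≟ a
... | yes _ = refl
... | no ¬p = ⊥-elim (¬p refl)

isPoint-suc : ∀ a i → ⟦ isPoint (suc a) (suc i) ⟧ ≡ ⟦ isPoint a i ⟧
isPoint-suc a i with i ≟ a | suc i ≟ suc a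
... | yes _ | yes _ = refl
... | no _  | no _  = refl
... | yes p | no ¬q = ⊥-elim (¬q (cong suc p))
... | no ¬p | yes q = ⊥-elim (¬p (suc-injective q))

count-point : ∀ n a → count n (isPoint a) ≤ 1
count-point zero a = z≤n
count-point (suc n) zero rewrite count-suc n (isPoint 0)
  | ∑-const (upTo n) 0 | *-zeroʳ (length (upTo n)) = ≤-refl
count-point (suc n) (suc a) rewrite count-suc n (isPoint (suc a)) =
  ≤-trans (≤-reflexive (∑-cong (upTo n) (isPoint-suc a))) (count-point n a)

count-point-< : ∀ n a → a < n → 1 ≤ count n (isPoint a)
count-point-< (suc n) zero _ rewrite count-suc n (isPoint 0) = s≤s z≤n
count-point-< (suc n) (suc a) (s≤s a<n) rewrite count-suc n (isPoint (suc a)) =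
  ≤-trans (count-point-< n a a<n) (≤-reflexive (sym (∑-cong (upTo n) (isPoint-suc a))))

count-insert : ∀ n f g a → (∀ i → i ≢ a → f i ≡ true → g i ≡ true) → count n f ≤ suc (count n g)
count-insert n f g a h = begin
  count n f                         ≤⟨ ∑-mono (upTo n) (λ {i} _ → pt i) ⟩
  ∑ (upTo n) (λ i → ⟦ isPoint a i ⟧ + ⟦ g i ⟧) ≡⟨ ∑-+ (upTo n) _ _ ⟩
  count n (isPoint a) + count n g   ≤⟨ +-monoˡ-≤ (count n g) (count-point n a) ⟩
  suc (count n g) ∎
  where
  open ≤-Reasoning
  pt : ∀ i → ⟦ f i ⟧ ≤ ⟦ isPoint a i ⟧ + ⟦ g i ⟧
  pt i with i ≟ a
  ... | yes _ = ≤-trans (⟦⟧≤1 (f i)) (s≤s z≤n)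
  ... | no i≢a with f i in eq
  ...   | false = z≤n
  ...   | true rewrite h i i≢a eq = ≤-refl

count-remove : ∀ n f g a → a < n → (∀ i → f i ≡ true → g i ≡ true) → f a ≡ false → g a ≡ true →
  suc (count n f) ≤ count n g
count-remove n f g a a<n h fa ga = begin
  suc (count n f)                   ≤⟨ +-monoˡ-≤ (count n f) (count-point-< n a a<n) ⟩
  count n (isPoint a) + count n f   ≡⟨ sym (∑-+ (upTo n) _ _) ⟩
  ∑ (upTo n) (λ i → ⟦ isPoint a i ⟧ + ⟦ f i ⟧) ≤⟨ ∑-mono (upTo n) (λ {i} _ → pt i) ⟩
  count n g ∎
  where
  open ≤-Reasoning
  pt : ∀ i → ⟦ isPoint a i ⟧ + ⟦ f i ⟧ ≤ ⟦ g i ⟧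
  pt i with i ≟ a
  ... | yes refl rewrite fa | ga = ≤-refl
  ... | no i≢a with f i in eq
  ...   | false = z≤n
  ...   | true rewrite h i eq = ≤-refl

-- Samples and `count` live on ℕ, whereas cells are elements of `Fin n`; beyond n the predicate is
-- continued by `false`.
onℕ : ∀ {n} → (Fin n → Bool) → ℕ → Bool
onℕ {zero}  f i       = false
onℕ {suc n} f zero    = f zero
onℕ {suc n} f (suc i) = onℕ (f ∘ suc) i

onℕ-toℕ : ∀ {n} (f : Fin n → Bool) a → onℕ f (toℕ a) ≡ f a
onℕ-toℕ f zero    = refl
onℕ-toℕ f (suc a) = onℕ-toℕ (f ∘ suc) a

onℕ-true : ∀ {n} (f : Fin n → Bool) i → onℕ f i ≡ true → ∃ λ a → toℕ a ≡ i × f a ≡ true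
onℕ-true {suc n} f zero h = zero , refl , h
onℕ-true {suc n} f (suc i) h with onℕ-true (f ∘ suc) i h
... | a , e , fa = suc a , cong suc e , fa

elem : List ℕ → ℕ → Bool
elem []      i = false
elem (a ∷ l) i = isPoint a i ∨ elem l i

elem-∈ : ∀ {l a} → a ∈ l → elem l a ≡ true
elem-∈ {a = a} (here refl) rewrite isPoint-refl a = refl
elem-∈ {l = c ∷ l} (there p) rewrite elem-∈ p = ∨-zeroʳ _

∈-elem : ∀ l {a} → elem l a ≡ true → a ∈ l
∈-elem (c ∷ l) {a} h with a ≟ c
... | yes e = here e
... | no _  = there (∈-elem l h)

count-elem : ∀ N l → count N (elem l) ≤ length l
count-elem N [] = ≤-reflexive (trans (∑-const (upTo N) 0) (*-zeroʳ (length (upTo N))))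
count-elem N (a ∷ l) = ≤-trans (count-insert N (elem (a ∷ l)) (elem l) a h) (s≤s (count-elem N l))
  where
  h : ∀ i → i ≢ a → elem (a ∷ l) i ≡ true → elem l i ≡ true
  h i i≢a e with i ≟ a
  ... | yes p = ⊥-elim (i≢a p)
  ... | no _ = e

-- Cell-probe programs

module CellProbe (S w : ℕ) where
  private
    put : Mem S w → Fin S → Word w → Mem S w
    put = writeMem {S} {w}

  value : Prog S w A → Mem S w → A
  value p m = proj₁ (run p m)

  final : Prog S w A → Mem S w → Mem S w
  final p m = proj₁ (proj₂ (run p m))

  cost : Prog S w A → Mem S w → ℕ
  cost p m = proj₂ (proj₂ (run p m))

  -- Writes are not listed: what a run does depends on the initial contents only through the cells
  -- it reads. A cell that is read after having been written is listed all the same.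
  reads : Prog S w A → Mem S w → List (Fin S)
  reads (ret a)       m = []
  reads (read i k)    m = i ∷ reads (k (m i)) m
  reads (write i x p) m = reads p (put m i x)

  run-read : ∀ i (k : Word w → Prog S w A) m →
    run (read i k) m ≡ (value (k (m i)) m , final (k (m i)) m , suc (cost (k (m i)) m))
  run-read i k m with run (k (m i)) m
  ... | _ = refl

  run-write : ∀ i x (p : Prog S w A) m → run (write i x p) m ≡
    (value p (put m i x) , final p (put m i x) , suc (cost p (put m i x)))
  run-write i x p m with run p (put m i x)
  ... | _ = refl

  length-reads≤cost : ∀ (p : Prog S w A) m → length (reads p m) ≤ cost p m
  length-reads≤cost (ret a)       m = z≤n
  length-reads≤cost (read i k)    m rewrite run-read i k m = s≤s (length-reads≤cost (k (m i)) m)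
  length-reads≤cost (write i x p) m rewrite run-write i x p m =
    m≤n⇒m≤1+n (length-reads≤cost p (put m i x))

  put-same : ∀ (m : Mem S w) i x → put m i x i ≡ x
  put-same m i x with i Fin.≟ i
  ... | yes _ = refl
  ... | no ¬p = ⊥-elim (¬p refl)

  put-other : ∀ (m : Mem S w) i x j → j ≢ i → put m i x j ≡ m j
  put-other m i x j j≢i with j Fin.≟ i
  ... | yes p = ⊥-elim (j≢i p)
  ... | no _ = refl

  Agree : (ℕ → Bool) → Mem S w → Mem S w → Set
  Agree T m m' = ∀ a → T (toℕ a) ≡ true → m a ≡ m' a

  Agree-write : ∀ {T m m'} i x → Agree T m m' → Agree T (put m i x) (put m' i x)
  Agree-write {T} {m} {m'} i x h a Ta = by-cases (a Fin.≟ i)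
    where
    by-cases : Dec (a ≡ i) → put m i x a ≡ put m' i x a
    by-cases (yes refl) = trans (put-same m a x) (sym (put-same m' a x))
    by-cases (no a≢i)   =
      trans (put-other m i x a a≢i) (trans (h a Ta) (sym (put-other m' i x a a≢i)))

  Within : (ℕ → Bool) → List (Fin S) → Set
  Within T l = ∀ {a} → a ∈ l → T (toℕ a) ≡ true

  -- Every word received comes from a cell of T, where both memories agree, and a common write
  -- preserves agreement; so the two runs take the same branches. Equality of the read lists allows
  -- the test `Within` to be made on either memory.
  run-agree : ∀ T (p : Prog S w A) m m' → Agree T m m' → Within T (reads p m) →
    value p m ≡ value p m' × reads p m ≡ reads p m'
  run-agree T (ret a) m m' h r = refl , refl
  run-agree T (read i k) m m' h r
    rewrite run-read i k m | run-read i k m' | sym (h i (r (here refl))) =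
    let e , e' = run-agree T (k (m i)) m m' h (r ∘ there) in e , cong (i ∷_) e'
  run-agree T (write i x p) m m' h r
    rewrite run-write i x p m | run-write i x p m' =
    run-agree T p (put m i x) (put m' i x) (Agree-write {T} i x h) r

  differs : Mem S w → Mem S w → ℕ → Bool
  differs m m₀ = onℕ (λ a → not ⌊ m a Fin.≟ m₀ a ⌋)

  differs-true : ∀ {m m₀ : Mem S w} {a} → m a ≢ m₀ a → differs m m₀ (toℕ a) ≡ true
  differs-true {m} {m₀} {a} h rewrite onℕ-toℕ (λ a → not ⌊ m a Fin.≟ m₀ a ⌋) a with m a Fin.≟ m₀ a
  ... | yes p = ⊥-elim (h p)
  ... | no _  = refl

  differs-false : ∀ {m m₀ : Mem S w} {a} → m a ≡ m₀ a → differs m m₀ (toℕ a) ≡ false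
  differs-false {m} {m₀} {a} h rewrite onℕ-toℕ (λ a → not ⌊ m a Fin.≟ m₀ a ⌋) a with m a Fin.≟ m₀ a
  ... | yes p = refl
  ... | no ¬p = ⊥-elim (¬p h)

  differs-elim : ∀ {m m₀ : Mem S w} i → differs m m₀ i ≡ true → ∃ λ a → toℕ a ≡ i × m a ≢ m₀ a
  differs-elim {m} {m₀} i h with onℕ-true (λ a → not ⌊ m a Fin.≟ m₀ a ⌋) i h
  ... | a , e , q with m a Fin.≟ m₀ a
  ...   | no ¬p = a , e , ¬p

  changes : Mem S w → Mem S w → ℕ
  changes m m₀ = count S (differs m m₀)

  changes-write : ∀ (m m₀ : Mem S w) i x → changes (put m i x) m₀ ≤ suc (changes m m₀)
  changes-write m m₀ i x = count-insert S _ _ (toℕ i) h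
    where
    h : ∀ j → j ≢ toℕ i → differs (put m i x) m₀ j ≡ true → differs m m₀ j ≡ true
    h j j≢i d with differs-elim j d
    ... | a , refl , ne = differs-true λ e →
      ne (trans (put-other m i x a (λ p → j≢i (cong toℕ p))) e)

  changes-final : ∀ (p : Prog S w A) m m₀ → changes (final p m) m₀ ≤ changes m m₀ + cost p m
  changes-final (ret a) m m₀ = m≤m+n _ _
  changes-final (read i k) m m₀ rewrite run-read i k m =
    ≤-trans (changes-final (k (m i)) m m₀) (+-monoʳ-≤ (changes m m₀) (n≤1+n _))
  changes-final (write i x p) m m₀ rewrite run-write i x p m = begin
    changes (final p m') m₀          ≤⟨ changes-final p m' m₀ ⟩
    changes m' m₀ + cost p m'        ≤⟨ +-monoˡ-≤ (cost p m') (changes-write m m₀ i x) ⟩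
    suc (changes m m₀ + cost p m')   ≡⟨ sym (+-suc _ _) ⟩
    changes m m₀ + suc (cost p m')   ∎
    where
    open ≤-Reasoning
    m' = put m i x

  changes-self : ∀ m → changes m m ≤ 0
  changes-self m = ≤-trans (∑-mono (upTo S) {g = λ _ → 0} (λ {i} _ → same i))
    (≤-reflexive (trans (∑-const (upTo S) 0) (*-zeroʳ (length (upTo S)))))
    where
    same : ∀ i → ⟦ differs m m i ⟧ ≤ 0
    same i with differs m m i in d
    ... | false = z≤n
    ... | true with differs-elim {m} {m} i d
    ...   | _ , _ , ne = ⊥-elim (ne refl)

  -- The content of a message. It agrees with m on the sample, so it can replace m in any run that
  -- reads only there, and it differs from m₀ only in sampled cells that were changed, which are
  -- few.
  mix : (ℕ → Bool) → Mem S w → Mem S w → Mem S w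
  mix T m m₀ a = if T (toℕ a) then m a else m₀ a

  mix-agree : ∀ T m m₀ → Agree T m (mix T m m₀)
  mix-agree T m m₀ a Ta rewrite Ta = refl

  changes-mix : ∀ T m m₀ → changes (mix T m m₀) m₀ ≤ count S (differs m m₀ ∩ T)
  changes-mix T m m₀ = ∑-mono (upTo S) (λ {i} _ → imp i)
    where
    differs-mix : ∀ a → mix T m m₀ a ≢ m₀ a → (differs m m₀ ∩ T) (toℕ a) ≡ true
    differs-mix a ne with T (toℕ a)
    ... | true rewrite differs-true {m} {m₀} ne = refl
    ... | false = ⊥-elim (ne refl)
    imp : ∀ i → ⟦ differs (mix T m m₀) m₀ i ⟧ ≤ ⟦ (differs m m₀ ∩ T) i ⟧
    imp i with differs (mix T m m₀) m₀ i in d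
    ... | false = z≤n
    ... | true with differs-elim {mix T m m₀} {m₀} i d
    ...   | a , refl , ne rewrite differs-mix a ne = ≤-refl

  oneWrite : Mem S w → List (Mem S w)
  oneWrite m = concatMap (λ a → map (put m a) (allFin (2 ^ w))) (allFin S)

  -- All possible messages. In each of k rounds either nothing happens or one of S cells receives
  -- one of `2 ^ w` words; hence the exact length `(1 + S * 2 ^ w) ^ k`, repetitions included.
  patches : Mem S w → ℕ → List (Mem S w)
  patches m₀ zero    = m₀ ∷ []
  patches m₀ (suc k) = patches m₀ k ++ concatMap oneWrite (patches m₀ k)

  length-concatMap-const : ∀ {B C : Set} (xs : List B) (f : B → List C) c →
    (∀ x → length (f x) ≡ c) → length (concatMap f xs) ≡ length xs * c
  length-concatMap-const [] f c h = refl
  length-concatMap-const (x ∷ xs) f c h =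
    trans (length-++ (f x)) (cong₂ _+_ (h x) (length-concatMap-const xs f c h))

  length-oneWrite : ∀ m → length (oneWrite m) ≡ S * 2 ^ w
  length-oneWrite m = trans
    (length-concatMap-const (allFin S) _ (2 ^ w) λ a →
      trans (length-map (put m a) (allFin (2 ^ w))) (length-tabulate {n = 2 ^ w} id))
    (cong (_* 2 ^ w) (length-tabulate {n = S} id))

  length-patches : ∀ m₀ k → length (patches m₀ k) ≡ (1 + S * 2 ^ w) ^ k
  length-patches m₀ zero = refl
  length-patches m₀ (suc k) = begin
    length (patches m₀ k ++ concatMap oneWrite (patches m₀ k)) ≡⟨ length-++ (patches m₀ k) ⟩
    l + length (concatMap oneWrite (patches m₀ k))
      ≡⟨ cong (l +_) (length-concatMap-const (patches m₀ k) oneWrite (S * 2 ^ w) length-oneWrite) ⟩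
    l + l * (S * 2 ^ w)   ≡⟨ sym (*-suc l (S * 2 ^ w)) ⟩
    l * (1 + S * 2 ^ w)   ≡⟨ *-comm l (1 + S * 2 ^ w) ⟩
    (1 + S * 2 ^ w) * l   ≡⟨ cong ((1 + S * 2 ^ w) *_) (length-patches m₀ k) ⟩
    (1 + S * 2 ^ w) ^ suc k ∎
    where
    open ≡-Reasoning
    l = length (patches m₀ k)

  -- Resetting one differing cell to its value in m₀ lowers `changes`, and the last round makes up
  -- for that write. Memories are functions, so equality is claimed pointwise.
  patches-complete : ∀ m₀ k m → changes m m₀ ≤ k → ∃ λ m' → m' ∈ patches m₀ k × (∀ a → m' a ≡ m a)
  patches-complete m₀ k m h with any? (λ a → ¬? (m a Fin.≟ m₀ a))
  patches-complete m₀ k m h | no ¬p =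
    m₀ , base k , λ a → sym (decidable-stable (m a Fin.≟ m₀ a) (λ ne → ¬p (a , ne)))
    where
    base : ∀ k → m₀ ∈ patches m₀ k
    base zero    = here refl
    base (suc k) = ∈-++⁺ˡ (base k)
  patches-complete m₀ zero m h | yes (a , ne) = ⊥-elim (<⇒≱ (s≤s z≤n)
    (≤-trans (count-remove S (λ _ → false) _ (toℕ a) (toℕ<n a) (λ _ ()) refl (differs-true ne)) h))
  patches-complete m₀ (suc k) m h | yes (a , ne)
    with patches-complete m₀ k (put m a (m₀ a))
      (≤-pred (≤-trans (count-remove S _ _ (toℕ a) (toℕ<n a) sub' (differs-false (put-same m a (m₀ a)))
        (differs-true ne)) h))
    where
    sub' : ∀ i → differs (put m a (m₀ a)) m₀ i ≡ true → differs m m₀ i ≡ true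
    sub' i d with differs-elim i d
    ... | j , refl , nj = differs-true λ e → nj (at j e)
      where
      at : ∀ j → m j ≡ m₀ j → put m a (m₀ a) j ≡ m₀ j
      at j e with j Fin.≟ a
      ... | yes refl = refl
      ... | no _ = e
  ... | m' , m'∈ , eq = put m' a (m a) , ∈-++⁺ʳ (patches m₀ k) mem , pt
    where
    mem : put m' a (m a) ∈ concatMap oneWrite (patches m₀ k)
    mem = ∈-concat⁺′ (∈-concat⁺′ (∈-map⁺ (put m' a) (∈-allFin (m a)))
            (∈-map⁺ (λ a → map (put m' a) (allFin (2 ^ w))) (∈-allFin a))) (∈-map⁺ oneWrite m'∈)
    pt : ∀ j → put m' a (m a) j ≡ m j
    pt j with j Fin.≟ a
    ... | yes refl = refl
    ... | no j≢a = trans (eq j) (put-other m a (m₀ a) j j≢a)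

-- Sequences of updates

applyUpds : ∀ {n} → List (Upd n) → Str (Alph n) n × Str (Alph n) n → Str (Alph n) n × Str (Alph n) n
applyUpds []       st = st
applyUpds (u ∷ us) st = applyUpds us (applyUpd u st)

module _ {n S w : ℕ} (D : DynLCS n S w) where
  open DynLCS D
  open CellProbe S w

  step-run : ∀ st m u → step D (st , m) u ≡
    (value (update u) m , cost (update u) m , (applyUpd u st , final (update u) m))
  step-run st m u with run (update u) m
  ... | _ = refl

  Cheap : ℕ → Config D → List (Upd n) → Set
  Cheap c cfg []       = ⊤
  Cheap c cfg (u ∷ us) = proj₁ (proj₂ (step D cfg u)) ≤ c × Cheap c (proj₂ (proj₂ (step D cfg u))) us

  -- The run is followed until an update first exceeds the budget; the updates before it are then
  -- the witness.
  cheap-or-expensive : ∀ c cfg us → Cheap c cfg us ⊎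
    (∃ λ us' → ∃ λ u → c < proj₁ (proj₂ (step D (after D cfg us') u)))
  cheap-or-expensive c cfg [] = inj₁ tt
  cheap-or-expensive c cfg (u ∷ us) with proj₁ (proj₂ (step D cfg u)) ≤? c
  ... | no ¬p = inj₂ ([] , u , ≰⇒> ¬p)
  ... | yes p with cheap-or-expensive c (proj₂ (proj₂ (step D cfg u))) us
  ...   | inj₁ q = inj₁ (p , q)
  ...   | inj₂ (us' , v , q) = inj₂ (u ∷ us' , v , q)

  changes-after : ∀ c st m m₀ us → Cheap c (st , m) us →
    changes (proj₂ (after D (st , m) us)) m₀ ≤ changes m m₀ + length us * c
  changes-after c st m m₀ [] _ = m≤m+n _ _
  changes-after c st m m₀ (u ∷ us) (p , ps) rewrite step-run st m u = begin
    changes (proj₂ (after D (applyUpd u st , m') us)) m₀ ≤⟨ changes-after c _ m' m₀ us ps ⟩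
    changes m' m₀ + length us * c   ≤⟨ +-monoˡ-≤ _ (≤-trans (changes-final (update u) m m₀) (+-monoʳ-≤ (changes m m₀) p)) ⟩
    changes m m₀ + c + length us * c ≡⟨ +-assoc (changes m m₀) c _ ⟩
    changes m m₀ + suc (length us) * c ∎
    where
    open ≤-Reasoning
    m' = final (update u) m

  cheap-last : ∀ c st m us u → Cheap c (st , m) (us ++ u ∷ []) →
    Cheap c (st , m) us × cost (update u) (proj₂ (after D (st , m) us)) ≤ c
  cheap-last c st m [] u (p , _) rewrite step-run st m u = tt , p
  cheap-last c st m (v ∷ us) u (p , ps) rewrite step-run st m v =
    let q , r = cheap-last c _ _ us u ps in (p , q) , r

  correct-last : ∀ st m us u → correctFrom D (st , m) (us ++ u ∷ []) →
    let st' = applyUpd u (applyUpds us st) in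
    IsLCSLength (proj₁ st') (proj₂ st') (value (update u) (proj₂ (after D (st , m) us)))
  correct-last st m [] u h rewrite step-run st m u = proj₁ h
  correct-last st m (v ∷ us) u h rewrite step-run st m v = correct-last _ _ us u (proj₂ h)

-- Products and mixed radix

∏ : ℕ → (ℕ → ℕ) → ℕ
∏ zero    f = 1
∏ (suc n) f = f 0 * ∏ n (f ∘ suc)

every : ℕ → (ℕ → Bool) → Bool
every zero    f = true
every (suc n) f = f 0 ∧ every n (f ∘ suc)

every-elim : ∀ n f → every n f ≡ true → ∀ i → i < n → f i ≡ true
every-elim (suc n) f h zero _ with f 0
... | true = refl
every-elim (suc n) f h (suc i) (s≤s i<n) with f 0
... | true = every-elim n (f ∘ suc) h i i<n

every-intro : ∀ n f → (∀ i → i < n → f i ≡ true) → every n f ≡ true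
every-intro zero    f h = refl
every-intro (suc n) f h rewrite h 0 (s≤s z≤n) = every-intro n (f ∘ suc) (λ i i<n → h (suc i) (s≤s i<n))

-- The weight of a path becomes a product over its levels, the form in which the digits can be
-- summed out one by one.
∏-every : ∀ n c a e → ⟦ every n a ⟧ * c ^ count n e ≡ ∏ n (λ i → ⟦ a i ⟧ * c ^ ⟦ e i ⟧)
∏-every zero    c a e = refl
∏-every (suc n) c a e rewrite count-suc n e = begin
  ⟦ a 0 ∧ every n (a ∘ suc) ⟧ * c ^ (⟦ e 0 ⟧ + count n (e ∘ suc))
    ≡⟨ cong₂ _*_ (⟦∧⟧ (a 0) _) (^-distribˡ-+-* c ⟦ e 0 ⟧ _) ⟩
  ⟦ a 0 ⟧ * ⟦ every n (a ∘ suc) ⟧ * (c ^ ⟦ e 0 ⟧ * c ^ count n (e ∘ suc))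
    ≡⟨ solve 4 (λ x y z u → x :* y :* (z :* u) := x :* z :* (y :* u)) refl
         ⟦ a 0 ⟧ ⟦ every n (a ∘ suc) ⟧ (c ^ ⟦ e 0 ⟧) (c ^ count n (e ∘ suc)) ⟩
  ⟦ a 0 ⟧ * c ^ ⟦ e 0 ⟧ * (⟦ every n (a ∘ suc) ⟧ * c ^ count n (e ∘ suc))
    ≡⟨ cong (⟦ a 0 ⟧ * c ^ ⟦ e 0 ⟧ *_) (∏-every n c (a ∘ suc) (e ∘ suc)) ⟩
  _ ∎
  where open ≡-Reasoning

mixed-mono : ∀ {m q r q' r'} → r < m → q < q' → q * m + r < q' * m + r'
mixed-mono {m} {q} {r} {q'} {r'} r<m q<q' = begin-strict
  q * m + r   <⟨ +-monoʳ-< (q * m) r<m ⟩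
  q * m + m   ≡⟨ +-comm (q * m) m ⟩
  suc q * m   ≤⟨ *-monoˡ-≤ m q<q' ⟩
  q' * m      ≤⟨ m≤m+n (q' * m) r' ⟩
  q' * m + r' ∎
  where open ≤-Reasoning

quot-unique : ∀ {m q r q' r'} → r < m → r' < m → q * m + r ≡ q' * m + r' → q ≡ q'
quot-unique {m} {q} {r} {q'} {r'} r<m r'<m eq with <-cmp q q'
... | tri≈ _ e _ = e
... | tri< q<q' _ _ = ⊥-elim (<⇒≢ (mixed-mono r<m q<q') eq)
... | tri> _ _ q'<q = ⊥-elim (<⇒≢ (mixed-mono r'<m q'<q) (sym eq))

rem-unique : ∀ {m q r q' r'} → r < m → r' < m → q * m + r ≡ q' * m + r' → r ≡ r'
rem-unique {m} {q} {r} {q'} {r'} r<m r'<m eq with quot-unique {m} {q} {r} {q'} {r'} r<m r'<m eq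
... | refl = +-cancelˡ-≡ (q * m) r r' eq

mixed-bound : ∀ {m q r k} → q < k → r < m → q * m + r < k * m
mixed-bound {m} {q} {r} {k} q<k r<m = subst (q * m + r <_) (+-identityʳ (k * m)) (mixed-mono {r' = 0} r<m q<k)

mixed-/ : ∀ q r m .{{_ : NonZero m}} → r < m → (q * m + r) / m ≡ q
mixed-/ q r m r<m = quot-unique {m} {_} {(q * m + r) % m} {q} {r} (m%n<n (q * m + r) m) r<m
  (trans (+-comm _ ((q * m + r) % m)) (sym (m≡m%n+[m/n]*n (q * m + r) m)))

mixed-% : ∀ q r m .{{_ : NonZero m}} → r < m → (q * m + r) % m ≡ r
mixed-% q r m r<m = rem-unique {m} {(q * m + r) / m} {(q * m + r) % m} {q} {r} (m%n<n (q * m + r) m) r<m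
  (trans (+-comm _ ((q * m + r) % m)) (sym (m≡m%n+[m/n]*n (q * m + r) m)))

/-%-eq : ∀ n m .{{_ : NonZero m}} → n / m * m + n % m ≡ n
/-%-eq n m = trans (+-comm (n / m * m) (n % m)) (sym (m≡m%n+[m/n]*n n m))

-- Deleting v from h does not affect the later entries, which differ from v, and it lowers the count
-- by `⟦ h v ⟧`. This is how disjoint paths meet a heavy vertex at most once.
count-distinct : ∀ N (h : ℕ → Bool) {vs} → AllPairs _≢_ vs → All (_< N) vs →
  ∑ vs (λ v → ⟦ h v ⟧) ≤ count N h
count-distinct N h [] [] = z≤n
count-distinct N h {v ∷ vs} (v≢ ∷ distinct) (v< ∷ vs<) = begin
  ⟦ h v ⟧ + ∑ vs (λ u → ⟦ h u ⟧)   ≤⟨ +-monoʳ-≤ ⟦ h v ⟧ (∑-mono vs (λ u∈ → others (All.lookup v≢ u∈))) ⟩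
  ⟦ h v ⟧ + ∑ vs (λ u → ⟦ h' u ⟧)  ≤⟨ +-monoʳ-≤ ⟦ h v ⟧ (count-distinct N h' distinct vs<) ⟩
  ⟦ h v ⟧ + count N h'             ≤⟨ restore ⟩
  count N h ∎
  where
  open ≤-Reasoning
  h' : ℕ → Bool
  h' i = h i ∧ not (isPoint v i)
  others : ∀ {u} → v ≢ u → ⟦ h u ⟧ ≤ ⟦ h' u ⟧
  others {u} v≢u with u ≟ v
  ... | yes e = ⊥-elim (v≢u (sym e))
  ... | no _ with h u
  ...   | true  = ≤-refl
  ...   | false = z≤n
  h'⊆h : ∀ i → h' i ≡ true → h i ≡ true
  h'⊆h i e with h i
  ... | true = refl
  h'v : h' v ≡ false
  h'v with h v | v ≟ v
  ... | false | _     = refl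
  ... | true  | yes _ = refl
  ... | true  | no ¬p = ⊥-elim (¬p refl)
  restore : ⟦ h v ⟧ + count N h' ≤ count N h
  restore with h v in hv
  ... | true  = count-remove N h' h v v< h'⊆h h'v hv
  ... | false = ∑-mono (upTo N) (λ {i} _ → ∧-≤ (h i) (not (isPoint v i)))
    where
    ∧-≤ : ∀ x y → ⟦ x ∧ y ⟧ ≤ ⟦ x ⟧
    ∧-≤ true  y = ⟦⟧≤1 y
    ∧-≤ false y = z≤n

Batch : Set
Batch = List (ℕ × ℕ)

-- The butterfly network

-- A path runs from a source y, a number of G digits in base b, to a target p of G + 1 digits.  At
-- level i it passes through the vertex that remembers all but the last i + 1 digits of p and all but
-- the last G - 1 - i digits of y, and its edge there adds one more digit of p.
module Network (b' G : ℕ) where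

  b N : ℕ
  b = suc b'
  N = b ^ suc G

  pre : ℕ → ℕ → ℕ
  pre zero    p = p
  pre (suc k) p = pre k (p / b)

  pre-/ : ∀ k p → pre k (p / b) ≡ pre k p / b
  pre-/ zero    p = refl
  pre-/ (suc k) p = pre-/ k (p / b)

  pre-mono : ∀ {k l p p'} → k ≤ l → pre k p ≡ pre k p' → pre l p ≡ pre l p'
  pre-mono {k} {l} {p} {p'} k≤l e with m≤n⇒∃[o]m+o≡n k≤l
  ... | o , refl = go o
    where
    go : ∀ o → pre (k + o) p ≡ pre (k + o) p'
    go zero rewrite +-identityʳ k = e
    go (suc o) rewrite +-suc k o | pre-/ (k + o) p | pre-/ (k + o) p' = cong (_/ b) (go o)

  pre-< : ∀ k j p → p < b ^ (k + j) → pre k p < b ^ j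
  pre-< zero    j p p< = p<
  pre-< (suc k) j p p< = pre-< k j (p / b) (m<n*o⇒m/o<n (subst (p <_) (*-comm b (b ^ (k + j))) p<))

  ∑-digits : ∀ n f → ∑ (upTo (b ^ suc n)) f ≡ ∑ (upTo (b ^ n)) (λ q → ∑ (upTo b) (λ d → f (q * b + d)))
  ∑-digits n f = trans (cong (λ l → ∑ (upTo l) f) (*-comm b (b ^ n))) (∑-upTo-* (b ^ n) b f)

  pre-fibre : ∀ k j c → ∑ (upTo (b ^ (k + j))) (λ p → ⟦ ⌊ pre k p ≟ c ⌋ ⟧) ≤ b ^ k
  pre-fibre zero j c = count-point (b ^ j) c
  pre-fibre (suc k) j c = begin
    ∑ (upTo (b ^ (suc k + j))) (λ p → ⟦ ⌊ pre (suc k) p ≟ c ⌋ ⟧) ≡⟨ ∑-digits (k + j) _ ⟩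
    ∑ (upTo (b ^ (k + j))) (λ q → ∑ (upTo b) (λ d → ⟦ ⌊ pre k ((q * b + d) / b) ≟ c ⌋ ⟧))
      ≤⟨ ∑-mono (upTo (b ^ (k + j))) (λ {q} _ → ∑-bound (upTo b) (λ {d} d∈ →
           ≤-reflexive (cong (λ z → ⟦ ⌊ pre k z ≟ c ⌋ ⟧) (mixed-/ q d b (∈-upTo⁻ d∈))))) ⟩
    ∑ (upTo (b ^ (k + j))) (λ q → length (upTo b) * ⟦ ⌊ pre k q ≟ c ⌋ ⟧)
      ≡⟨ ∑-*ˡ (upTo (b ^ (k + j))) (length (upTo b)) (λ q → ⟦ ⌊ pre k q ≟ c ⌋ ⟧) ⟩
    length (upTo b) * ∑ (upTo (b ^ (k + j))) (λ q → ⟦ ⌊ pre k q ≟ c ⌋ ⟧)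
      ≤⟨ *-mono-≤ (≤-reflexive (length-upTo b)) (pre-fibre k j c) ⟩
    b * b ^ k ∎
    where open ≤-Reasoning

  -- The last digit is summed out first: it enters only the factor of level 0, and the other factors
  -- depend on `p / b` alone. The j leading digits carry no weight of their own, which gives
  -- `b ^ j`.
  ∑-paths : ∀ R j k (f : ℕ → ℕ → ℕ → ℕ) → (∀ i u → ∑ (upTo b) (f i u) ≤ R) →
    ∑ (upTo (b ^ (k + j))) (λ p → ∏ k (λ i → f i (pre (suc i) p) (pre i p % b))) ≤ b ^ j * R ^ k
  ∑-paths R j zero f h = ≤-reflexive (trans (∑-const (upTo (b ^ j)) 1) (cong (_* 1) (length-upTo (b ^ j))))
  ∑-paths R j (suc k) f h = begin
    ∑ (upTo (b ^ suc (k + j))) (λ p → ∏ (suc k) (λ i → f i (pre (suc i) p) (pre i p % b)))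
      ≡⟨ ∑-digits (k + j) _ ⟩
    ∑ (upTo (b ^ (k + j))) (λ q → ∑ (upTo b) (λ d → F ((q * b + d) / b) ((q * b + d) % b)))
      ≤⟨ ∑-mono (upTo (b ^ (k + j))) (λ {q} _ → ∑-mono (upTo b) (λ {d} d∈ →
           ≤-reflexive (cong₂ F (mixed-/ q d b (∈-upTo⁻ d∈)) (mixed-% q d b (∈-upTo⁻ d∈))))) ⟩
    ∑ (upTo (b ^ (k + j))) (λ q → ∑ (upTo b) (λ d → f 0 q d * rest q))
      ≤⟨ ∑-mono (upTo (b ^ (k + j))) (λ {q} _ →
           ≤-trans (≤-reflexive (∑-*ʳ (upTo b) (rest q) (f 0 q))) (*-monoˡ-≤ (rest q) (h 0 q))) ⟩
    ∑ (upTo (b ^ (k + j))) (λ q → R * rest q) ≡⟨ ∑-*ˡ (upTo (b ^ (k + j))) R rest ⟩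
    R * ∑ (upTo (b ^ (k + j))) rest          ≤⟨ *-monoʳ-≤ R (∑-paths R j k (f ∘ suc) (h ∘ suc)) ⟩
    R * (b ^ j * R ^ k)  ≡⟨ solve 3 (λ x y z → x :* (y :* z) := y :* (x :* z)) refl R (b ^ j) (R ^ k) ⟩
    b ^ j * R ^ suc k ∎
    where
    open ≤-Reasoning
    rest : ℕ → ℕ
    rest q = ∏ k (λ i → f (suc i) (pre (suc i) q) (pre i q % b))
    F : ℕ → ℕ → ℕ
    F q d = f 0 q d * rest q

  -- The kept digits of the target precede the `suc i` kept digits of the source. The target prefix
  -- is an argument, because `∑-paths` weighs edges by prefix and digit.
  vertexAt : ℕ → ℕ → ℕ → ℕ
  vertexAt i y u = u * b ^ suc i + pre (G ∸ suc i) y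

  vertex edge : ℕ → ℕ → ℕ → ℕ
  vertex i y p = vertexAt i y (pre (suc i) p)
  edge i y p = (i * N + vertex i y p) * b + pre i p % b

  edges : ℕ
  edges = G * N * b

  low-< : ∀ {i y} → i < G → y < b ^ G → pre (G ∸ suc i) y < b ^ suc i
  low-< {i} {y} i<G y< = pre-< (G ∸ suc i) (suc i) y (subst (λ g → y < b ^ g) (sym (m∸n+n≡m i<G)) y<)

  high-< : ∀ {i p} → i < G → p < N → pre (suc i) p < b ^ (G ∸ i)
  high-< {i} {p} i<G p< = pre-< (suc i) (G ∸ i) p
    (subst (λ g → p < b ^ suc g) (sym (m+[n∸m]≡n (<⇒≤ i<G))) p<)

  pow-split : ∀ {i} → i < G → b ^ (G ∸ i) * b ^ suc i ≡ N
  pow-split {i} i<G = trans (sym (^-distribˡ-+-* b (G ∸ i) (suc i)))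
    (cong (b ^_) (trans (+-suc (G ∸ i) i) (cong suc (m∸n+n≡m (<⇒≤ i<G)))))

  vertex-< : ∀ {i y p} → i < G → y < b ^ G → p < N → vertex i y p < N
  vertex-< {i} {y} {p} i<G y< p< = subst (vertex i y p <_) (pow-split i<G)
    (mixed-bound (high-< i<G p<) (low-< i<G y<))

  edge-< : ∀ {i y p} → i < G → y < b ^ G → p < N → edge i y p < edges
  edge-< {i} {y} {p} i<G y< p< =
    mixed-bound (mixed-bound i<G (vertex-< i<G y< p<)) (m%n<n (pre i p) b)

  batches : List ℕ → List Batch
  batches []       = [] ∷ []
  batches (y ∷ ys) = concatMap (λ Q → map (λ p → (y , p) ∷ Q) (upTo N)) (batches ys)

  ∑-batches : ∀ y ys f →
    ∑ (batches (y ∷ ys)) f ≡ ∑ (batches ys) (λ Q → ∑ (upTo N) (λ p → f ((y , p) ∷ Q)))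
  ∑-batches y ys f = trans (∑-concatMap (batches ys) _ f)
    (∑-cong (batches ys) λ Q → ∑-map (upTo N) _ f)

  batches-sources : ∀ ys {Q} → Q ∈ batches ys → map proj₁ Q ≡ ys
  batches-sources [] (here refl) = refl
  batches-sources (y ∷ ys) Q∈ with ∈-concat⁻′ (map (λ Q → map (λ p → (y , p) ∷ Q) (upTo N)) (batches ys)) Q∈
  ... | _ , Q∈l , l∈ with ∈-map⁻ _ l∈
  ... | Q' , Q'∈ , refl with ∈-map⁻ _ Q∈l
  ... | p , p∈ , refl = cong (y ∷_) (batches-sources ys Q'∈)

  batches-targets : ∀ ys {Q} → Q ∈ batches ys → ∀ {yp} → yp ∈ Q → proj₂ yp < N
  batches-targets [] (here refl) ()
  batches-targets (y ∷ ys) Q∈ yp∈ with ∈-concat⁻′ (map (λ Q → map (λ p → (y , p) ∷ Q) (upTo N)) (batches ys)) Q∈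
  ... | _ , Q∈l , l∈ with ∈-map⁻ _ l∈
  ... | Q' , Q'∈ , refl with ∈-map⁻ _ Q∈l
  batches-targets (y ∷ ys) Q∈ (here refl) | _ | _ | p , p∈ , refl = ∈-upTo⁻ p∈
  batches-targets (y ∷ ys) Q∈ (there m) | _ | Q' , Q'∈ , refl | p , p∈ , refl = batches-targets ys Q'∈ m

  prodQ : (ℕ → ℕ → ℕ) → Batch → ℕ
  prodQ g []            = 1
  prodQ g ((y , p) ∷ Q) = g y p * prodQ g Q

  ∑-batches-prod : ∀ X g ys → (∀ y → ∑ (upTo N) (g y) ≤ X) → ∑ (batches ys) (prodQ g) ≤ X ^ length ys
  ∑-batches-prod X g [] h = ≤-refl
  ∑-batches-prod X g (y ∷ ys) h = begin
    ∑ (batches (y ∷ ys)) (prodQ g)  ≡⟨ ∑-batches y ys _ ⟩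
    ∑ (batches ys) (λ Q → ∑ (upTo N) (λ p → g y p * prodQ g Q))
      ≤⟨ ∑-mono (batches ys) (λ {Q} _ →
           ≤-trans (≤-reflexive (∑-*ʳ (upTo N) (prodQ g Q) (g y))) (*-monoˡ-≤ (prodQ g Q) (h y))) ⟩
    ∑ (batches ys) (λ Q → X * prodQ g Q) ≡⟨ ∑-*ˡ (batches ys) X _ ⟩
    X * ∑ (batches ys) (prodQ g)    ≤⟨ *-monoʳ-≤ X (∑-batches-prod X g ys h) ⟩
    X * X ^ length ys ∎
    where open ≤-Reasoning

  meets : ℕ → ℕ → ℕ × ℕ → ℕ → Bool
  meets y p (y' , p') i = ⌊ vertex i y p ≟ vertex i y' p' ⌋

  fresh : ℕ → ℕ → Batch → Bool
  fresh y p []       = true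
  fresh y p (r ∷ Q) = every G (λ i → not (meets y p r i)) ∧ fresh y p Q

  disjoint : Batch → Bool
  disjoint []            = true
  disjoint ((y , p) ∷ Q) = fresh y p Q ∧ disjoint Q

  not-every : ∀ n f → 1 ≤ ⟦ every n (not ∘ f) ⟧ + count n f
  not-every zero f = ≤-refl
  not-every (suc n) f rewrite count-suc n f with f 0
  ... | true = s≤s z≤n
  ... | false = not-every n (f ∘ suc)

  not-fresh : ∀ y p Q → 1 ≤ ⟦ fresh y p Q ⟧ + ∑ Q (λ r → count G (meets y p r))
  not-fresh y p [] = ≤-refl
  not-fresh y p (r ∷ Q) with every G (λ i → not (meets y p r i)) | not-every G (meets y p r)
  ... | true | _ = ≤-trans (not-fresh y p Q) (+-monoʳ-≤ ⟦ fresh y p Q ⟧ (m≤n+m _ (count G (meets y p r))))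
  ... | false | h = ≤-trans h (m≤m+n _ _)

  -- A meeting at level i forces equal source prefixes and equal target prefixes. The first is the
  -- factor on the right; the second leaves `suc i` digits of p free.
  meets-count : ∀ {i y y'} p' → i < G → y < b ^ G → y' < b ^ G →
    ∑ (upTo N) (λ p → ⟦ meets y p (y' , p') i ⟧) ≤
    ⟦ ⌊ pre (G ∸ suc i) y' ≟ pre (G ∸ suc i) y ⌋ ⟧ * b ^ suc i
  meets-count {i} {y} {y'} p' i<G y< y'< with pre (G ∸ suc i) y' ≟ pre (G ∸ suc i) y
  ... | no ne = ≤-trans (∑-mono (upTo N) {g = λ _ → 0} (λ {p} _ → zero-term p))
          (≤-reflexive (trans (∑-const (upTo N) 0) (*-zeroʳ (length (upTo N)))))
    where
    zero-term : ∀ p → ⟦ meets y p (y' , p') i ⟧ ≤ 0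
    zero-term p with vertex i y p ≟ vertex i y' p'
    ... | no _ = ≤-refl
    ... | yes e = ⊥-elim (ne (sym (rem-unique {b ^ suc i} {pre (suc i) p} {_} {pre (suc i) p'}
                    (low-< i<G y<) (low-< i<G y'<) e)))
  ... | yes _ = ≤-trans (∑-mono (upTo N) {g = λ p → ⟦ ⌊ pre (suc i) p ≟ pre (suc i) p' ⌋ ⟧} (λ {p} _ → term p))
          (≤-trans (subst (λ g → ∑ (upTo (b ^ suc g)) (λ p → ⟦ ⌊ pre (suc i) p ≟ pre (suc i) p' ⌋ ⟧) ≤ b ^ suc i)
                     (m+[n∸m]≡n (<⇒≤ i<G)) (pre-fibre (suc i) (G ∸ i) (pre (suc i) p')))
                   (m≤m+n _ 0))
    where
    term : ∀ p → ⟦ meets y p (y' , p') i ⟧ ≤ ⟦ ⌊ pre (suc i) p ≟ pre (suc i) p' ⌋ ⟧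
    term p with vertex i y p ≟ vertex i y' p' | pre (suc i) p ≟ pre (suc i) p'
    ... | no _  | _ = z≤n
    ... | yes _ | yes _ = ≤-refl
    ... | yes e | no ne' = ⊥-elim (ne' (quot-unique {b ^ suc i} (low-< i<G y<) (low-< i<G y'<) e))

  -- Each level-i prefix class of sources has at most b^(G-1-i) members.
  Spread : List ℕ → Set
  Spread ys = ∀ i c → i < G → ∑ ys (λ y' → ⟦ ⌊ pre (G ∸ suc i) y' ≟ c ⌋ ⟧) ≤ b ^ (G ∸ suc i)

  spread-tail : ∀ y ys → Spread (y ∷ ys) → Spread ys
  spread-tail y ys s i c i<G = ≤-trans (m≤n+m _ _) (s i c i<G)

  spread-all : Spread (upTo (b ^ G))
  spread-all i c i<G = subst (λ g → ∑ (upTo (b ^ g)) (λ y → ⟦ ⌊ pre (G ∸ suc i) y ≟ c ⌋ ⟧) ≤ b ^ (G ∸ suc i))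
    (m∸n+n≡m i<G) (pre-fibre (G ∸ suc i) (suc i) c)

  -- Union bound. At level i at most b^(G-1-i) sources of Q have the right prefix, and each blocks
  -- at most b^(i+1) targets: `b ^ G` per level, `G * b ^ G` in all. This is at most half of N,
  -- which is `b * b ^ G`.
  ∑-fresh : 2 * G ≤ b → ∀ y Q → y < b ^ G → (∀ {y'} → y' ∈ map proj₁ Q → y' < b ^ G) →
    Spread (map proj₁ Q) → N ≤ 2 * ∑ (upTo N) (λ p → ⟦ fresh y p Q ⟧)
  ∑-fresh 2G≤b y Q y< Q< s = +-cancelʳ-≤ N N (2 * fr) (begin
    N + N                        ≡⟨ cong (N +_) (sym (+-identityʳ N)) ⟩
    2 * N                        ≡⟨ cong (2 *_) (sym (trans (∑-const (upTo N) 1) (trans (*-identityʳ _) (length-upTo N)))) ⟩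
    2 * ∑ (upTo N) (λ _ → 1)     ≤⟨ *-monoʳ-≤ 2 (∑-mono (upTo N) (λ {p} _ → not-fresh y p Q)) ⟩
    2 * ∑ (upTo N) _             ≡⟨ cong (2 *_) (∑-+ (upTo N) _ _) ⟩
    2 * (fr + ∑ (upTo N) (λ p → ∑ Q (λ r → count G (meets y p r))))
                                 ≤⟨ *-monoʳ-≤ 2 (+-monoʳ-≤ fr bad) ⟩
    2 * (fr + G * b ^ G)         ≡⟨ solve 3 (λ x g z → con 2 :* (x :+ g :* z) := con 2 :* x :+ con 2 :* g :* z) refl fr G (b ^ G) ⟩
    2 * fr + 2 * G * b ^ G       ≤⟨ +-monoʳ-≤ (2 * fr) (*-monoˡ-≤ (b ^ G) 2G≤b) ⟩
    2 * fr + N                   ∎)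
    where
    open ≤-Reasoning
    fr = ∑ (upTo N) (λ p → ⟦ fresh y p Q ⟧)
    per-level : ∀ {i} → i ∈ upTo G → ∑ Q (λ r → ∑ (upTo N) (λ p → ⟦ meets y p r i ⟧)) ≤ b ^ G
    per-level {i} i∈ = begin
      ∑ Q (λ r → ∑ (upTo N) (λ p → ⟦ meets y p r i ⟧))
        ≤⟨ ∑-mono Q (λ {r} r∈ → meets-count (proj₂ r) i<G y< (Q< (∈-map⁺ proj₁ r∈))) ⟩
      ∑ Q (λ r → ⟦ ⌊ pre (G ∸ suc i) (proj₁ r) ≟ c ⌋ ⟧ * b ^ suc i) ≡⟨ ∑-*ʳ Q (b ^ suc i) _ ⟩
      ∑ Q (λ r → ⟦ ⌊ pre (G ∸ suc i) (proj₁ r) ≟ c ⌋ ⟧) * b ^ suc i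
        ≡⟨ cong (_* b ^ suc i) (sym (∑-map Q proj₁ _)) ⟩
      ∑ (map proj₁ Q) (λ y' → ⟦ ⌊ pre (G ∸ suc i) y' ≟ c ⌋ ⟧) * b ^ suc i
        ≤⟨ *-monoˡ-≤ (b ^ suc i) (s i c i<G) ⟩
      b ^ (G ∸ suc i) * b ^ suc i ≡⟨ sym (^-distribˡ-+-* b (G ∸ suc i) (suc i)) ⟩
      b ^ (G ∸ suc i + suc i)     ≡⟨ cong (b ^_) (m∸n+n≡m i<G) ⟩
      b ^ G ∎
      where
      i<G = ∈-upTo⁻ i∈
      c = pre (G ∸ suc i) y
    bad : ∑ (upTo N) (λ p → ∑ Q (λ r → count G (meets y p r))) ≤ G * b ^ G
    bad = begin
      ∑ (upTo N) (λ p → ∑ Q (λ r → count G (meets y p r)))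
        ≡⟨ ∑-cong (upTo N) (λ p → ∑-swap Q (upTo G) _) ⟩
      ∑ (upTo N) (λ p → ∑ (upTo G) (λ i → ∑ Q (λ r → ⟦ meets y p r i ⟧)))
        ≡⟨ ∑-swap (upTo N) (upTo G) _ ⟩
      ∑ (upTo G) (λ i → ∑ (upTo N) (λ p → ∑ Q (λ r → ⟦ meets y p r i ⟧)))
        ≡⟨ ∑-cong (upTo G) (λ i → ∑-swap (upTo N) Q _) ⟩
      ∑ (upTo G) (λ i → ∑ Q (λ r → ∑ (upTo N) (λ p → ⟦ meets y p r i ⟧)))
        ≤⟨ ∑-bound (upTo G) per-level ⟩
      length (upTo G) * b ^ G ≡⟨ cong (_* b ^ G) (length-upTo G) ⟩
      G * b ^ G ∎

  -- The paths are added one after another, and each time at least half of the targets avoid all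
  -- paths chosen so far.
  disjoint-many : 2 * G ≤ b → ∀ ys → (∀ {y} → y ∈ ys → y < b ^ G) → Spread ys →
    N ^ length ys ≤ 2 ^ length ys * ∑ (batches ys) (λ Q → ⟦ disjoint Q ⟧)
  disjoint-many 2G≤b [] ys< s = ≤-refl
  disjoint-many 2G≤b (y ∷ ys) ys< s = begin
    N * N ^ l                     ≤⟨ *-monoʳ-≤ N (disjoint-many 2G≤b ys (ys< ∘ there) (spread-tail y ys s)) ⟩
    N * (2 ^ l * d)               ≡⟨ solve 3 (λ x y z → x :* (y :* z) := y :* (z :* x)) refl N (2 ^ l) d ⟩
    2 ^ l * (d * N)               ≡⟨ cong (2 ^ l *_) (sym (∑-*ʳ (batches ys) N _)) ⟩
    2 ^ l * ∑ (batches ys) (λ Q → ⟦ disjoint Q ⟧ * N) ≤⟨ *-monoʳ-≤ (2 ^ l) (∑-mono (batches ys) stepwise) ⟩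
    2 ^ l * ∑ (batches ys) (λ Q → 2 * ∑ (upTo N) (λ p → ⟦ disjoint ((y , p) ∷ Q) ⟧))
      ≡⟨ cong (2 ^ l *_) (trans (∑-*ˡ (batches ys) 2 _) (cong (2 *_) (sym (∑-batches y ys _)))) ⟩
    2 ^ l * (2 * d')              ≡⟨ solve 2 (λ x y → x :* (con 2 :* y) := con 2 :* x :* y) refl (2 ^ l) d' ⟩
    2 ^ suc l * d' ∎
    where
    open ≤-Reasoning
    l = length ys
    d = ∑ (batches ys) (λ Q → ⟦ disjoint Q ⟧)
    d' = ∑ (batches (y ∷ ys)) (λ Q → ⟦ disjoint Q ⟧)
    stepwise : ∀ {Q} → Q ∈ batches ys →
      ⟦ disjoint Q ⟧ * N ≤ 2 * ∑ (upTo N) (λ p → ⟦ disjoint ((y , p) ∷ Q) ⟧)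
    stepwise {Q} Q∈ = begin
      ⟦ disjoint Q ⟧ * N  ≤⟨ *-monoʳ-≤ ⟦ disjoint Q ⟧ (∑-fresh 2G≤b y Q (ys< (here refl))
          (λ y'∈ → ys< (there (subst (_ ∈_) src y'∈))) (subst Spread (sym src) (spread-tail y ys s))) ⟩
      ⟦ disjoint Q ⟧ * (2 * ∑ (upTo N) (λ p → ⟦ fresh y p Q ⟧))
        ≡⟨ solve 2 (λ x y → x :* (con 2 :* y) := con 2 :* (y :* x)) refl
             ⟦ disjoint Q ⟧ (∑ (upTo N) (λ p → ⟦ fresh y p Q ⟧)) ⟩
      2 * (∑ (upTo N) (λ p → ⟦ fresh y p Q ⟧) * ⟦ disjoint Q ⟧)
        ≡⟨ cong (2 *_) (sym (∑-*ʳ (upTo N) ⟦ disjoint Q ⟧ _)) ⟩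
      2 * ∑ (upTo N) (λ p → ⟦ fresh y p Q ⟧ * ⟦ disjoint Q ⟧)
        ≡⟨ cong (2 *_) (∑-cong (upTo N) (λ p → sym (⟦∧⟧ (fresh y p Q) (disjoint Q)))) ⟩
      2 * ∑ (upTo N) (λ p → ⟦ fresh y p Q ∧ disjoint Q ⟧) ∎
      where src = batches-sources ys Q∈

  fresh-elim : ∀ {y p Q} → fresh y p Q ≡ true → ∀ {r} → r ∈ Q → ∀ i → i < G →
    vertex i y p ≢ vertex i (proj₁ r) (proj₂ r)
  fresh-elim {y} {p} {r ∷ Q} h (here refl) i i<G e
    with every G (λ i → not (meets y p r i)) in eq
  ... | true with vertex i y p ≟ vertex i (proj₁ r) (proj₂ r) | every-elim G _ eq i i<G
  ...   | no ne | _ = ne e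
  fresh-elim {y} {p} {r ∷ Q} h (there m) i i<G e
    with every G (λ i → not (meets y p r i))
  ... | true = fresh-elim {y} {p} {Q} h m i i<G e

  vertexOf : ℕ → ℕ × ℕ → ℕ
  vertexOf i (y , p) = vertex i y p

  disjoint-distinct : ∀ {i} → i < G → ∀ Q → disjoint Q ≡ true → AllPairs _≢_ (map (vertexOf i) Q)
  disjoint-distinct i<G [] _ = []
  disjoint-distinct {i} i<G ((y , p) ∷ Q) h with fresh y p Q in fr
  ... | true = All-map⁺ (All.tabulate λ r∈ → fresh-elim {y} {p} {Q} fr r∈ i i<G) ∷ disjoint-distinct i<G Q h

  -- The part of the network whose edges satisfy cov; a vertex is heavy if it has many such out-edges.
  module Covered (K : ℕ) (1≤K : 1 ≤ K) (cov : ℕ → Bool) where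

    degree : ℕ → ℕ
    degree v = ∑ (upTo b) (λ d → ⟦ cov (v * b + d) ⟧)

    heavy : ℕ → ℕ → Bool
    heavy i v = ⌊ K ≤? degree (i * N + v) ⌋

    heavies : ℕ
    heavies = ∑ (upTo G) (λ i → count N (heavy i))

    -- Double counting: in the mixed radix code every edge leaves exactly one vertex, so the degrees
    -- sum to the number of covered edges.
    heavies≤cov : K * heavies ≤ count edges cov
    heavies≤cov = begin
      K * heavies  ≡⟨ sym (∑-*ˡ (upTo G) K _) ⟩
      ∑ (upTo G) (λ i → K * count N (heavy i)) ≡⟨ ∑-cong (upTo G) (λ i → sym (∑-*ˡ (upTo N) K _)) ⟩
      ∑ (upTo G) (λ i → ∑ (upTo N) (λ v → K * ⟦ heavy i v ⟧))
        ≤⟨ ∑-mono (upTo G) (λ {i} _ → ∑-mono (upTo N) (λ {v} _ → term (i * N + v))) ⟩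
      ∑ (upTo G) (λ i → ∑ (upTo N) (λ v → degree (i * N + v))) ≡⟨ sym (∑-upTo-* G N degree) ⟩
      ∑ (upTo (G * N)) degree ≡⟨ sym (∑-upTo-* (G * N) b (λ e → ⟦ cov e ⟧)) ⟩
      count edges cov ∎
      where
      open ≤-Reasoning
      term : ∀ v → K * ⟦ ⌊ K ≤? degree v ⌋ ⟧ ≤ degree v
      term v with K ≤? degree v
      ... | yes p = ≤-trans (≤-reflexive (*-identityʳ K)) p
      ... | no _  = ≤-trans (≤-reflexive (*-zeroʳ K)) z≤n

    inside : ℕ → ℕ → Bool
    inside y p = every G (λ i → cov (edge i y p))

    light : ℕ → ℕ → ℕ → Bool
    light y p i = not (heavy i (vertex i y p))

    lights : ℕ → ℕ → ℕ
    lights y p = count G (light y p)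

    -- The weight b for each light vertex evens out the levels: a light vertex offers fewer than K
    -- digits of weight b, a heavy one at most b digits of weight 1, and `K * b` bounds both. The
    -- leading digit of p selects no edge and accounts for the factor b.
    ∑-inside : ∀ y → ∑ (upTo N) (λ p → ⟦ inside y p ⟧ * b ^ lights y p) ≤ b * (K * b) ^ G
    ∑-inside y = begin
      ∑ (upTo N) (λ p → ⟦ inside y p ⟧ * b ^ lights y p)
        ≡⟨ ∑-cong (upTo N) (λ p → ∏-every G b _ (light y p)) ⟩
      ∑ (upTo N) (λ p → ∏ G (λ i → f i (pre (suc i) p) (pre i p % b)))
        ≡⟨ cong (λ g → ∑ (upTo (b ^ g)) (λ p → ∏ G (λ i → f i (pre (suc i) p) (pre i p % b)))) (+-comm 1 G) ⟩
      ∑ (upTo (b ^ (G + 1))) _  ≤⟨ ∑-paths (K * b) 1 G f f-bound ⟩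
      b ^ 1 * (K * b) ^ G       ≡⟨ cong (_* (K * b) ^ G) (*-identityʳ b) ⟩
      b * (K * b) ^ G ∎
      where
      open ≤-Reasoning
      f : ℕ → ℕ → ℕ → ℕ
      f i u d = ⟦ cov ((i * N + vertexAt i y u) * b + d) ⟧ * b ^ ⟦ not (heavy i (vertexAt i y u)) ⟧
      f-bound : ∀ i u → ∑ (upTo b) (f i u) ≤ K * b
      f-bound i u = ≤-trans (≤-reflexive (∑-*ʳ (upTo b) (b ^ ⟦ not ⌊ K ≤? degree v ⌋ ⟧) (λ d → ⟦ cov (v * b + d) ⟧)))
        (bound (K ≤? degree v))
        where
        v = i * N + vertexAt i y u
        bound : (D : Dec (K ≤ degree v)) → degree v * b ^ ⟦ not ⌊ D ⌋ ⟧ ≤ K * b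
        bound (yes _) = begin
          degree v * 1  ≡⟨ *-identityʳ (degree v) ⟩
          degree v      ≤⟨ ∑-bound (upTo b) (λ {d} _ → ⟦⟧≤1 (cov (v * b + d))) ⟩
          length (upTo b) * 1 ≡⟨ trans (*-identityʳ _) (trans (length-upTo b) (sym (*-identityˡ b))) ⟩
          1 * b         ≤⟨ *-monoˡ-≤ b 1≤K ⟩
          K * b ∎
        bound (no ¬p) = *-mono-≤ (<⇒≤ (≰⇒> ¬p)) (≤-reflexive (*-identityʳ b))

    insideQ : Batch → Bool
    insideQ []            = true
    insideQ ((y , p) ∷ Q) = inside y p ∧ insideQ Q

    lightsQ : Batch → ℕ
    lightsQ Q = ∑ Q (λ r → lights (proj₁ r) (proj₂ r))

    insideQ-prod : ∀ Q → ⟦ insideQ Q ⟧ * b ^ lightsQ Q ≡ prodQ (λ y p → ⟦ inside y p ⟧ * b ^ lights y p) Q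
    insideQ-prod [] = refl
    insideQ-prod ((y , p) ∷ Q) = begin
      ⟦ inside y p ∧ insideQ Q ⟧ * b ^ (lights y p + lightsQ Q)
        ≡⟨ cong₂ _*_ (⟦∧⟧ (inside y p) _) (^-distribˡ-+-* b (lights y p) _) ⟩
      ⟦ inside y p ⟧ * ⟦ insideQ Q ⟧ * (b ^ lights y p * b ^ lightsQ Q)
        ≡⟨ solve 4 (λ x y z u → x :* y :* (z :* u) := x :* z :* (y :* u)) refl
             ⟦ inside y p ⟧ ⟦ insideQ Q ⟧ (b ^ lights y p) (b ^ lightsQ Q) ⟩
      ⟦ inside y p ⟧ * b ^ lights y p * (⟦ insideQ Q ⟧ * b ^ lightsQ Q)
        ≡⟨ cong (⟦ inside y p ⟧ * b ^ lights y p *_) (insideQ-prod Q) ⟩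
      _ ∎
      where open ≡-Reasoning

    heavyQ : Batch → ℕ
    heavyQ Q = ∑ Q (λ r → count G (λ i → heavy i (vertex i (proj₁ r) (proj₂ r))))

    heavyQ≤ : ∀ Q → disjoint Q ≡ true → (∀ {r} → r ∈ Q → proj₁ r < b ^ G × proj₂ r < N) → heavyQ Q ≤ heavies
    heavyQ≤ Q dQ Q< = ≤-trans (≤-reflexive (∑-swap Q (upTo G) _)) (∑-mono (upTo G) λ {i} i∈ →
      ≤-trans (≤-reflexive (sym (∑-map Q (vertexOf i) (λ v → ⟦ heavy i v ⟧))))
        (count-distinct N (heavy i) (disjoint-distinct (∈-upTo⁻ i∈) Q dQ)
          (All-map⁺ (All.tabulate λ r∈ → vertex-< (∈-upTo⁻ i∈) (proj₁ (Q< r∈)) (proj₂ (Q< r∈))))))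

    levels-split : ∀ Q → lightsQ Q + heavyQ Q ≡ length Q * G
    levels-split Q = begin
      lightsQ Q + heavyQ Q ≡⟨ sym (∑-+ Q _ _) ⟩
      ∑ Q (λ r → lights (proj₁ r) (proj₂ r) + count G (λ i → heavy i (vertex i (proj₁ r) (proj₂ r))))
        ≡⟨ ∑-cong Q (λ r → trans (sym (∑-+ (upTo G) _ _))
             (trans (∑-cong (upTo G) (λ i → one (heavy i (vertex i (proj₁ r) (proj₂ r)))))
               (trans (∑-const (upTo G) 1) (trans (*-identityʳ _) (length-upTo G))))) ⟩
      ∑ Q (λ _ → G) ≡⟨ ∑-const Q G ⟩
      length Q * G ∎
      where
      open ≡-Reasoning
      one : ∀ x → ⟦ not x ⟧ + ⟦ x ⟧ ≡ 1
      one true = refl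
      one false = refl

    -- A light vertex leaves fewer than K choices and a heavy one at most b; since the paths of a
    -- disjoint batch never share a vertex, each heavy vertex is met at most once.
    few-inside : ∀ ys h → (∀ {y} → y ∈ ys → y < b ^ G) → heavies ≤ h →
      ∑ (batches ys) (λ Q → ⟦ disjoint Q ∧ insideQ Q ⟧) * b ^ (length ys * G ∸ h)
        ≤ (b * (K * b) ^ G) ^ length ys
    few-inside ys h ys< hv = begin
      ∑ (batches ys) (λ Q → ⟦ disjoint Q ∧ insideQ Q ⟧) * b ^ (length ys * G ∸ h)
        ≡⟨ sym (∑-*ʳ (batches ys) _ _) ⟩
      ∑ (batches ys) (λ Q → ⟦ disjoint Q ∧ insideQ Q ⟧ * b ^ (length ys * G ∸ h))
        ≤⟨ ∑-mono (batches ys) term ⟩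
      ∑ (batches ys) (prodQ (λ y p → ⟦ inside y p ⟧ * b ^ lights y p))
        ≤⟨ ∑-batches-prod _ _ ys ∑-inside ⟩
      (b * (K * b) ^ G) ^ length ys ∎
      where
      open ≤-Reasoning
      term : ∀ {Q} → Q ∈ batches ys → ⟦ disjoint Q ∧ insideQ Q ⟧ * b ^ (length ys * G ∸ h) ≤
        prodQ (λ y p → ⟦ inside y p ⟧ * b ^ lights y p) Q
      term {Q} Q∈ with disjoint Q in dQ
      ... | false = z≤n
      ... | true = ≤-trans (*-monoʳ-≤ ⟦ insideQ Q ⟧ (^-monoʳ-≤ b exponent)) (≤-reflexive (insideQ-prod Q))
        where
        src = batches-sources ys Q∈
        Q< : ∀ {r} → r ∈ Q → proj₁ r < b ^ G × proj₂ r < N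
        Q< r∈ = ys< (subst (_ ∈_) src (∈-map⁺ proj₁ r∈)) , batches-targets ys Q∈ r∈
        len : length Q ≡ length ys
        len = trans (sym (length-map proj₁ Q)) (cong length src)
        exponent : length ys * G ∸ h ≤ lightsQ Q
        exponent = m≤n+o⇒m∸n≤o (length ys * G) h (begin
          length ys * G ≡⟨ cong (_* G) (sym len) ⟩
          length Q * G  ≡⟨ sym (levels-split Q) ⟩
          lightsQ Q + heavyQ Q ≡⟨ +-comm (lightsQ Q) (heavyQ Q) ⟩
          heavyQ Q + lightsQ Q ≤⟨ +-monoˡ-≤ (lightsQ Q) (≤-trans (heavyQ≤ Q dQ Q<) hv) ⟩
          h + lightsQ Q ∎)

-- Strings by position

-- Positions beyond the end of the string read as 0.
at : List (Fin σ) → ℕ → ℕ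
at []      i       = 0
at (x ∷ l) zero    = toℕ x
at (x ∷ l) (suc i) = at l i

atᵥ : ∀ {n} → Vec (Fin σ) n → ℕ → ℕ
atᵥ v = at (toList v)

prefix-at : ∀ {u l : List (Fin σ)} → Prefix _≡_ u l → length u ≤ length l × (∀ k → k < length u → at u k ≡ at l k)
prefix-at [] = z≤n , λ _ ()
prefix-at (refl ∷ p) with prefix-at p
... | le , eq = s≤s le , λ { zero _ → refl ; (suc k) (s≤s k<) → eq k k< }

infix-at : ∀ {u l : List (Fin σ)} → Infix _≡_ u l →
  ∃ λ i → i + length u ≤ length l × (∀ k → k < length u → at u k ≡ at l (i + k))
infix-at (here p) = 0 , prefix-at p
infix-at (there p) with infix-at p
... | i , le , eq = suc i , s≤s le , eq

at-prefix : ∀ L (l l' : List (Fin σ)) → L ≤ length l → L ≤ length l' →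
  (∀ k → k < L → at l k ≡ at l' k) → Prefix _≡_ (take L l) l'
at-prefix zero l l' _ _ _ = []
at-prefix (suc L) (x ∷ l) (y ∷ l') (s≤s p) (s≤s q) h =
  toℕ-injective (h 0 (s≤s z≤n)) ∷ at-prefix L l l' p q (λ k k< → h (suc k) (s≤s k<))

drop-infix : ∀ i {u l : List (Fin σ)} → Prefix _≡_ u (drop i l) → Infix _≡_ u l
drop-infix zero p = here p
drop-infix (suc i) {l = []} p = here p
drop-infix (suc i) {l = x ∷ l} p = there (drop-infix i p)

at-drop : ∀ i (l : List (Fin σ)) k → at (drop i l) k ≡ at l (i + k)
at-drop zero l k = refl
at-drop (suc i) [] k = refl
at-drop (suc i) (x ∷ l) k = at-drop i l k

common-substring : ∀ {n} (s t : Str σ n) L i j → i + L ≤ n → j + L ≤ n →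
  (∀ k → k < L → atᵥ s (i + k) ≡ atᵥ t (j + k)) →
  ∃ λ u → CommonSubstring s t u × length u ≡ L
common-substring {n = n} s t L i j i≤ j≤ h =
  u , (drop-infix i (at-prefix L s' s' Ls Ls (λ _ _ → refl)) ,
       drop-infix j (at-prefix L s' t' Ls Lt (λ k k< →
         trans (at-drop i (toList s) k) (trans (h k k<) (sym (at-drop j (toList t) k)))))) ,
  trans (length-take L s') (m≤n⇒m⊓n≡m Ls)
  where
  s' = drop i (toList s)
  t' = drop j (toList t)
  u = take L s'
  fits : ∀ {n} i (v : Str _ n) → i + L ≤ n → L ≤ length (drop i (toList v))
  fits i v i≤ = ≤-trans (m+n≤o⇒n≤o∸m i i≤)
    (≤-reflexive (sym (trans (length-drop i (toList v)) (cong (_∸ i) (length-toList v)))))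
    where
    m+n≤o⇒n≤o∸m : ∀ m {n o} → m + n ≤ o → n ≤ o ∸ m
    m+n≤o⇒n≤o∸m m {n} {o} p = m+n≤o⇒m≤o∸n n (subst (_≤ o) (+-comm m n) p)
  Ls = fits i s i≤
  Lt = fits j t j≤

common-substring-at : ∀ {n} {s t : Str σ n} {u} → CommonSubstring s t u →
  ∃ λ i → ∃ λ j → i + length u ≤ n × j + length u ≤ n ×
    (∀ k → k < length u → atᵥ s (i + k) ≡ atᵥ t (j + k))
common-substring-at {s = s} {t} (p , q) with infix-at p | infix-at q
... | i , i≤ , hi | j , j≤ , hj =
  i , j , subst (_ ≤_) (length-toList s) i≤ , subst (_ ≤_) (length-toList t) j≤ ,
  λ k k< → trans (sym (hi k k<)) (hj k k<)

at-update-same : ∀ {n} (v : Str σ n) i c → atᵥ (v [ i ]≔ c) (toℕ i) ≡ toℕ c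
at-update-same (x ∷ v) zero    c = refl
at-update-same (x ∷ v) (suc i) c = at-update-same v i c

at-update-other : ∀ {n} (v : Str σ n) i c k → k ≢ toℕ i → atᵥ (v [ i ]≔ c) k ≡ atᵥ v k
at-update-other (x ∷ v) zero    c zero    ne = ⊥-elim (ne refl)
at-update-other (x ∷ v) zero    c (suc k) ne = refl
at-update-other (x ∷ v) (suc i) c zero    ne = refl
at-update-other (x ∷ v) (suc i) c (suc k) ne = at-update-other v i c k (ne ∘ cong suc)

at-tabulate : ∀ {n} (f : Fin n → Fin σ) i → atᵥ (tabulate f) (toℕ i) ≡ toℕ (f i)
at-tabulate f zero    = refl
at-tabulate f (suc i) = at-tabulate (f ∘ suc) i

-- The strings

-- The block of a path (y , p) in s has a switch at offset G + 2; the letter at offset c in front of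
-- it shows p without its last c - 1 digits, the one at offset c behind it shows y without its last
-- 2G + 2 - c digits.  The block of an edge in t consists of a separator and of the letters at the
-- offsets level + 1, …, level + G + 3 of any path through that edge: they do not depend on the path.
module Gadget (n b' G : ℕ) .{{_ : NonZero n}} where
  open Network b' G

  infixl 7 _/^_ _%^_
  _/^_ _%^_ : ℕ → ℕ → ℕ
  x /^ k = _/_ x (b ^ k) {{m^n≢0 b k}}
  x %^ k = _%_ x (b ^ k) {{m^n≢0 b k}}

  %^-< : ∀ x k → x %^ k < b ^ k
  %^-< x k = m%n<n x (b ^ k) {{m^n≢0 b k}}

  /^-%^-eq : ∀ x k → x /^ k * b ^ k + x %^ k ≡ x
  /^-%^-eq x k = /-%-eq x (b ^ k) {{m^n≢0 b k}}

  mixed-/^ : ∀ q r k → r < b ^ k → (q * b ^ k + r) /^ k ≡ q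
  mixed-/^ q r k = mixed-/ q r (b ^ k) {{m^n≢0 b k}}

  mixed-%^ : ∀ q r k → r < b ^ k → (q * b ^ k + r) %^ k ≡ r
  mixed-%^ q r k = mixed-% q r (b ^ k) {{m^n≢0 b k}}

  /^-< : ∀ {x n} k → x < n * b ^ k → x /^ k < n
  /^-< k = m<n*o⇒m/o<n {{m^n≢0 b k}}

  Y Ws Wt : ℕ
  Y = b ^ G
  Ws = 2 * G + 3
  Wt = G + 4

  instance
    Ws-nonZero : NonZero Ws
    Ws-nonZero = >-nonZero (≤-trans (s≤s z≤n) (m≤n+m 3 (2 * G)))
    Wt-nonZero : NonZero Wt
    Wt-nonZero = >-nonZero (≤-trans (s≤s z≤n) (m≤n+m 4 G))

  fin : ℕ → Fin n
  fin c = fromℕ< (m%n<n c n)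

  toℕ-fin : ∀ {c} → c < n → toℕ (fin c) ≡ c
  toℕ-fin {c} c<n = trans (toℕ-fromℕ< (m%n<n c n)) (m<n⇒m%n≡m c<n)

  string : (ℕ → ℕ) → Str n n
  string f = tabulate (λ i → fin (f (toℕ i)))

  at-string : ∀ f → (∀ k → f k < n) → ∀ k → k < n → atᵥ (string f) k ≡ f k
  at-string f f< k k<n = trans (cong (atᵥ (string f)) (sym (toℕ-fromℕ< k<n)))
    (trans (at-tabulate _ (fromℕ< k<n)) (trans (toℕ-fin (f< _)) (cong f (toℕ-fromℕ< k<n))))

  -- The letters 0 and 1 are fillers occurring in only one of the two strings; 2 switches a block on.
  label : ℕ → ℕ → ℕ → ℕ
  label y p c with c ≤? suc G
  ... | yes _ = pre (c ∸ 1) p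
  ... | no _  = pre (2 * G + 2 ∸ c) y

  -- Labels stay below N, so letters at different offsets never coincide, and the shift by 3 keeps
  -- clear of the fillers and the switch.
  letter : ℕ → ℕ → ℕ → ℕ
  letter y p c = 3 + (c * N + label y p c)

  sCell : ℕ → ℕ → ℕ → ℕ
  sCell y p c with c ≟ 0 | c ≟ G + 2
  ... | yes _ | _     = 0
  ... | no _  | yes _ = 0
  ... | no _  | no _  = letter y p c

  sBlock : ℕ → ℕ → ℕ
  sBlock B c with B <? N * Y
  ... | yes _ = sCell (B %^ G) (B /^ G) c
  ... | no _  = 0

  sCode : ℕ → ℕ
  sCode k = sBlock (k / Ws) (k % Ws)

  record Decoded : Set where
    constructor decoded
    field level source target : ℕ
  open Decoded public

  pre-mult : ∀ k q → pre k (q * b ^ k) ≡ q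
  pre-mult zero q = *-identityʳ q
  pre-mult (suc k) q = trans (cong (pre k) (trans (cong (_/ b) eq) (m*n/n≡m (q * b ^ k) b))) (pre-mult k q)
    where
    eq : q * b ^ suc k ≡ q * b ^ k * b
    eq = trans (cong (q *_) (*-comm b (b ^ k))) (sym (*-assoc q (b ^ k) b))

  -- One particular path through the edge with number e: the digits of source and target that the
  -- edge does not determine are set to 0.
  mixedRadix : ℕ → Decoded
  mixedRadix e = decoded i (v %^ suc i * b ^ (G ∸ suc i)) ((v /^ suc i * b + e % b) * b ^ i)
    where
    i v : ℕ
    i = e / b /^ suc G
    v = e / b %^ suc G

  mixedRadix-level : ∀ {e} → e < edges → level (mixedRadix e) < G
  mixedRadix-level {e} e< = /^-< (suc G) (m<n*o⇒m/o<n e<)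

  mixedRadix-edge : ∀ {e} → edge (level (mixedRadix e)) (source (mixedRadix e)) (target (mixedRadix e)) ≡ e
  mixedRadix-edge {e} = begin
    (i * N + vertex i y p) * b + pre i p % b
      ≡⟨ cong₂ (λ x z → (i * N + x) * b + z) vertex-eq (trans (cong (_% b) (pre-mult i (u * b + e % b))) (mixed-% u (e % b) b (m%n<n e b))) ⟩
    (i * N + v) * b + e % b ≡⟨ cong (λ x → x * b + e % b) (/^-%^-eq (e / b) (suc G)) ⟩
    e / b * b + e % b       ≡⟨ /-%-eq e b ⟩
    e ∎
    where
    open ≡-Reasoning
    i v u y p : ℕ
    i = e / b /^ suc G
    v = e / b %^ suc G
    u = v /^ suc i
    y = source (mixedRadix e)
    p = target (mixedRadix e)
    vertex-eq : vertex i y p ≡ v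
    vertex-eq = trans (cong₂ (λ x z → x * b ^ suc i + z)
        (trans (pre-/ i p) (trans (cong (_/ b) (pre-mult i (u * b + e % b))) (mixed-/ u (e % b) b (m%n<n e b))))
        (pre-mult (G ∸ suc i) (v %^ suc i)))
      (/^-%^-eq v (suc i))

  mixedRadix-source-< : ∀ {e} → e < edges → source (mixedRadix e) < Y
  mixedRadix-source-< {e} e< = <-≤-trans (*-monoˡ-< (b ^ (G ∸ suc i)) {{m^n≢0 b (G ∸ suc i)}} (%^-< v (suc i)))
    (≤-reflexive (trans (sym (^-distribˡ-+-* b (suc i) (G ∸ suc i))) (cong (b ^_) (m+[n∸m]≡n (mixedRadix-level e<)))))
    where
    i v : ℕ
    i = e / b /^ suc G
    v = e / b %^ suc G

  mixedRadix-target-< : ∀ {e} → e < edges → target (mixedRadix e) < N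
  mixedRadix-target-< {e} e< = <-≤-trans (*-monoˡ-< (b ^ i) {{m^n≢0 b i}} u<)
    (≤-reflexive (trans (cong (_* b ^ i) (*-comm (b ^ (G ∸ i)) b)) (trans (sym (^-distribˡ-+-* b (suc (G ∸ i)) i))
      (cong (λ g → b ^ suc g) (m∸n+n≡m (<⇒≤ i<G))))))
    where
    i v : ℕ
    i = e / b /^ suc G
    v = e / b %^ suc G
    i<G : i < G
    i<G = mixedRadix-level e<
    u< : v /^ suc i * b + e % b < b ^ (G ∸ i) * b
    u< = mixed-bound {k = b ^ (G ∸ i)} (/^-< {n = b ^ (G ∸ i)} (suc i) (subst (v <_) (sym (pow-split i<G)) (%^-< (e / b) (suc G)))) (m%n<n e b)

  module _ {i y p : ℕ} (i<G : i < G) (y< : y < Y) (p< : p < N) where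
    private
      e v : ℕ
      e = edge i y p
      v = i * N + vertex i y p
      e/b : e / b ≡ v
      e/b = mixed-/ v (pre i p % b) b (m%n<n (pre i p) b)
      e%b : e % b ≡ pre i p % b
      e%b = mixed-% v (pre i p % b) b (m%n<n (pre i p) b)
      w< : vertex i y p < N
      w< = vertex-< i<G y< p<

    mixedRadix-edge-level : level (mixedRadix (edge i y p)) ≡ i
    mixedRadix-edge-level = trans (cong (_/^ suc G) e/b) (mixed-/^ i (vertex i y p) (suc G) w<)

    private
      w-eq : e / b %^ suc G ≡ vertex i y p
      w-eq = trans (cong (_%^ suc G) e/b) (mixed-%^ i (vertex i y p) (suc G) w<)

    mixedRadix-edge-target : pre i (target (mixedRadix (edge i y p))) ≡ pre i p
    mixedRadix-edge-target = begin
      pre i (target (mixedRadix e)) ≡⟨ cong₂ (λ j w → pre i ((w /^ suc j * b + e % b) * b ^ j)) mixedRadix-edge-level w-eq ⟩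
      pre i ((vertex i y p /^ suc i * b + e % b) * b ^ i) ≡⟨ pre-mult i _ ⟩
      vertex i y p /^ suc i * b + e % b
        ≡⟨ cong₂ (λ q r → q * b + r) (mixed-/^ (pre (suc i) p) _ (suc i) (low-< i<G y<)) e%b ⟩
      pre (suc i) p * b + pre i p % b ≡⟨ cong (λ q → q * b + pre i p % b) (pre-/ i p) ⟩
      pre i p / b * b + pre i p % b ≡⟨ /-%-eq (pre i p) b ⟩
      pre i p ∎
      where open ≡-Reasoning

    mixedRadix-edge-source : pre (G ∸ suc i) (source (mixedRadix (edge i y p))) ≡ pre (G ∸ suc i) y
    mixedRadix-edge-source = begin
      pre (G ∸ suc i) (source (mixedRadix e))
        ≡⟨ cong₂ (λ j w → pre (G ∸ suc i) (w %^ suc j * b ^ (G ∸ suc j))) mixedRadix-edge-level w-eq ⟩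
      pre (G ∸ suc i) (vertex i y p %^ suc i * b ^ (G ∸ suc i)) ≡⟨ pre-mult (G ∸ suc i) _ ⟩
      vertex i y p %^ suc i ≡⟨ mixed-%^ (pre (suc i) p) _ (suc i) (low-< i<G y<) ⟩
      pre (G ∸ suc i) y ∎
      where open ≡-Reasoning

  abstract
    -- The last two laws fix everything that the window of an edge at level i can show: each of its
    -- letters is a prefix of `pre i p` or of `pre (G ∸ suc i) y`.
    decode : ℕ → Decoded
    decode = mixedRadix

    decode-level : ∀ {e} → e < edges → level (decode e) < G
    decode-level = mixedRadix-level

    decode-edge : ∀ {e} → edge (level (decode e)) (source (decode e)) (target (decode e)) ≡ e
    decode-edge = mixedRadix-edge

    decode-source-< : ∀ {e} → e < edges → source (decode e) < Y
    decode-source-< = mixedRadix-source-<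

    decode-target-< : ∀ {e} → e < edges → target (decode e) < N
    decode-target-< = mixedRadix-target-<

    decode-edge-level : ∀ {i y p} → i < G → y < Y → p < N → level (decode (edge i y p)) ≡ i
    decode-edge-level = mixedRadix-edge-level

    decode-edge-target : ∀ {i y p} → i < G → y < Y → p < N →
      pre i (target (decode (edge i y p))) ≡ pre i p
    decode-edge-target = mixedRadix-edge-target

    decode-edge-source : ∀ {i y p} → i < G → y < Y → p < N →
      pre (G ∸ suc i) (source (decode (edge i y p))) ≡ pre (G ∸ suc i) y
    decode-edge-source = mixedRadix-edge-source

  -- Position r faces offset `level d + r` of a path block in s, which puts the switch where that
  -- sum is `G + 2`. A switch that is off shows 1, a letter that s never contains.
  tCell : Decoded → ℕ → ℕ
  tCell d r with r ≟ 0 | level d + r ≟ G + 2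
  ... | yes _ | _     = 1
  ... | no _  | yes _ = 1
  ... | no _  | no _  = letter (source d) (target d) (level d + r)

  tBlock : ℕ → ℕ → ℕ
  tBlock e r with e <? edges
  ... | yes _ = tCell (decode e) r
  ... | no _  = 1

  tCode : ℕ → ℕ
  tCode k = tBlock (k / Wt) (k % Wt)

  sSlot : ℕ → ℕ → ℕ
  sSlot y p = (p * Y + y) * Ws + (G + 2)

  tSlot : ℕ → ℕ
  tSlot e = e * Wt + (G + 2 ∸ level (decode e))

  module Sized (sFits : N * Y * Ws ≤ n) (tFits : edges * Wt ≤ n) (lettersFit : 3 + Ws * N ≤ n) where

    pre-≤ : ∀ k p → pre k p ≤ p
    pre-≤ zero    p = ≤-refl
    pre-≤ (suc k) p = ≤-trans (pre-≤ k (p / b)) (m/n≤m p b)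

    label-< : ∀ {y p} c → y < Y → p < N → label y p c < N
    label-< {y} {p} c y< p< with c ≤? suc G
    ... | yes _ = ≤-<-trans (pre-≤ (c ∸ 1) p) p<
    ... | no _  = ≤-<-trans (pre-≤ (2 * G + 2 ∸ c) y) (<-≤-trans y< (m≤m+n Y (b' * Y)))

    label-low : ∀ {y p} c → c ≤ suc G → label y p c ≡ pre (c ∸ 1) p
    label-low c c≤ with c ≤? suc G
    ... | yes _ = refl
    ... | no ¬p = ⊥-elim (¬p c≤)

    label-high : ∀ {y p} c → suc G < c → label y p c ≡ pre (2 * G + 2 ∸ c) y
    label-high c c> with c ≤? suc G
    ... | yes p = ⊥-elim (<⇒≱ c> p)
    ... | no _ = refl

    letter-< : ∀ {y p} c → c < Ws → y < Y → p < N → letter y p c < n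
    letter-< c c< y< p< = <-≤-trans (+-monoʳ-< 3 (mixed-bound c< (label-< c y< p<))) lettersFit

    filler-< : ∀ {c} → c ≤ 2 → c < n
    filler-< c≤2 = ≤-trans (s≤s c≤2) (≤-trans (m≤m+n 3 (Ws * N)) lettersFit)

    sCell-cases : ∀ y p c → sCell y p c ≡ 0 ⊎ sCell y p c ≡ letter y p c
    sCell-cases y p c with c ≟ 0 | c ≟ G + 2
    ... | yes _ | _     = inj₁ refl
    ... | no _  | yes _ = inj₁ refl
    ... | no _  | no _  = inj₂ refl

    sCell-letter : ∀ y p c → c ≢ 0 → c ≢ G + 2 → sCell y p c ≡ letter y p c
    sCell-letter y p c c≢0 c≢ with c ≟ 0 | c ≟ G + 2
    ... | yes e | _     = ⊥-elim (c≢0 e)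
    ... | no _  | yes e = ⊥-elim (c≢ e)
    ... | no _  | no _  = refl

    tCell-cases : ∀ d r → tCell d r ≡ 1 ⊎ tCell d r ≡ letter (source d) (target d) (level d + r)
    tCell-cases d r with r ≟ 0 | level d + r ≟ G + 2
    ... | yes _ | _     = inj₁ refl
    ... | no _  | yes _ = inj₁ refl
    ... | no _  | no _  = inj₂ refl

    tCell-letter : ∀ d r → r ≢ 0 → level d + r ≢ G + 2 → tCell d r ≡ letter (source d) (target d) (level d + r)
    tCell-letter d r r≢0 r≢ with r ≟ 0 | level d + r ≟ G + 2
    ... | yes e | _     = ⊥-elim (r≢0 e)
    ... | no _  | yes e = ⊥-elim (r≢ e)
    ... | no _  | no _  = refl

    tCell-zero : ∀ d → tCell d 0 ≡ 1
    tCell-zero d with level d + 0 ≟ G + 2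
    ... | _ = refl

    tCell-slot : ∀ d r → level d + r ≡ G + 2 → tCell d r ≡ 1
    tCell-slot d r e with r ≟ 0 | level d + r ≟ G + 2
    ... | yes _ | _     = refl
    ... | no _  | yes _ = refl
    ... | no _  | no ne = ⊥-elim (ne e)

    sBlock-in : ∀ {y p} c → y < Y → p < N → sBlock (p * Y + y) c ≡ sCell y p c
    sBlock-in {y} {p} c y< p< with p * Y + y <? N * Y
    ... | no ≮ = ⊥-elim (≮ (mixed-bound p< y<))
    ... | yes _ = cong₂ (λ u v → sCell u v c) (mixed-%^ p y G y<) (mixed-/^ p y G y<)

    sCode-block : ∀ {y p c} → y < Y → p < N → c < Ws → sCode ((p * Y + y) * Ws + c) ≡ sCell y p c
    sCode-block {y} {p} {c} y< p< c< =
      trans (cong₂ sBlock (mixed-/ (p * Y + y) c Ws c<) (mixed-% (p * Y + y) c Ws c<)) (sBlock-in c y< p<)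

    tBlock-in : ∀ {e} r → e < edges → tBlock e r ≡ tCell (decode e) r
    tBlock-in {e} r e< with e <? edges
    ... | yes _ = refl
    ... | no ≮ = ⊥-elim (≮ e<)

    tCode-block : ∀ {e r} → e < edges → r < Wt → tCode (e * Wt + r) ≡ tCell (decode e) r
    tCode-block {e} {r} e< r< =
      trans (cong₂ tBlock (mixed-/ e r Wt r<) (mixed-% e r Wt r<)) (tBlock-in r e<)

    tBlock-zero : ∀ e → tBlock e 0 ≡ 1
    tBlock-zero e with e <? edges
    ... | yes _ = tCell-zero (decode e)
    ... | no _  = refl

    tCode-start : ∀ q → tCode (q * Wt) ≡ 1
    tCode-start q = trans (cong (tBlock (q * Wt / Wt)) (m*n%n≡0 q Wt)) (tBlock-zero (q * Wt / Wt))

    Ws-mid : G + 2 < Ws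
    Ws-mid = subst (_≤ Ws) (+-suc G 2) (+-monoˡ-≤ 3 (m≤m+n G (G + 0)))

    decode-offset : ∀ {e r} → e < edges → r < Wt → level (decode e) + r < Ws
    decode-offset {e} {r} e< r< = begin-strict
      level (decode e) + r <⟨ +-mono-≤-< (<⇒≤pred (decode-level e<)) r< ⟩
      pred G + (G + 4)     ≤⟨ lem G (≤-trans (s≤s z≤n) (decode-level e<)) ⟩
      Ws ∎
      where
      open ≤-Reasoning
      lem : ∀ g → 1 ≤ g → pred g + (g + 4) ≤ 2 * g + 3
      lem (suc g) _ = ≤-reflexive (solve 1 (λ g → g :+ (con 1 :+ g :+ con 4) := con 2 :* (con 1 :+ g) :+ con 3) refl g)

    letter-≥3 : ∀ y p c {v} → v ≡ letter y p c → 3 ≤ v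
    letter-≥3 y p c refl = m≤m+n 3 (c * N + label y p c)

    sBlock-cases : ∀ B c → sBlock B c ≡ 0 ⊎ 3 ≤ sBlock B c
    sBlock-cases B c with B <? N * Y
    ... | no _ = inj₁ refl
    ... | yes _ = map₂ (letter-≥3 (B %^ G) (B /^ G) c) (sCell-cases (B %^ G) (B /^ G) c)

    sCode-cases : ∀ k → sCode k ≡ 0 ⊎ 3 ≤ sCode k
    sCode-cases k = sBlock-cases (k / Ws) (k % Ws)

    tBlock-cases : ∀ e r → tBlock e r ≡ 1 ⊎ (3 ≤ tBlock e r × e < edges)
    tBlock-cases e r with e <? edges
    ... | no _ = inj₁ refl
    ... | yes e< = map₂ (λ q → letter-≥3 (source (decode e)) (target (decode e)) (level (decode e) + r) q , e<)
                     (tCell-cases (decode e) r)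

    tCode-cases : ∀ k → tCode k ≡ 1 ⊎ (3 ≤ tCode k × k / Wt < edges)
    tCode-cases k = tBlock-cases (k / Wt) (k % Wt)

    sBlock-< : ∀ B c → c < Ws → sBlock B c < n
    sBlock-< B c c< with B <? N * Y
    ... | no _ = filler-< z≤n
    ... | yes B< = cases (sCell-cases (B %^ G) (B /^ G) c)
      where
      cases : ∀ {v} → v ≡ 0 ⊎ v ≡ letter (B %^ G) (B /^ G) c → v < n
      cases (inj₁ refl) = filler-< z≤n
      cases (inj₂ refl) = letter-< c c< (%^-< B G) (/^-< G B<)

    sCode-< : ∀ k → sCode k < n
    sCode-< k = sBlock-< (k / Ws) (k % Ws) (m%n<n k Ws)

    tBlock-< : ∀ e r → r < Wt → tBlock e r < n
    tBlock-< e r r< with e <? edges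
    ... | no _ = filler-< (s≤s z≤n)
    ... | yes e< = cases (tCell-cases (decode e) r)
      where
      cases : ∀ {v} → v ≡ 1 ⊎ v ≡ letter (source (decode e)) (target (decode e)) (level (decode e) + r) → v < n
      cases (inj₁ refl) = filler-< (s≤s z≤n)
      cases (inj₂ refl) = letter-< (level (decode e) + r) (decode-offset e< r<) (decode-source-< e<) (decode-target-< e<)

    tCode-< : ∀ k → tCode k < n
    tCode-< k = tBlock-< (k / Wt) (k % Wt) (m%n<n k Wt)

    letter-label : ∀ {y p y' p'} c → letter y p c ≡ letter y' p' c → label y p c ≡ label y' p' c
    letter-label {y} {p} {y'} {p'} c e = +-cancelˡ-≡ (c * N) _ _ (+-cancelˡ-≡ 3 _ _ e)

-- Aligning common windows with blocks

module Alignment (G : ℕ) .{{_ : NonZero (G + 4)}} (level : ℕ → ℕ) where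

  Wt : ℕ
  Wt = G + 4

  tSlot : ℕ → ℕ
  tSlot e = e * Wt + (G + 2 ∸ level e)

  -- S' and T' are the letter codes of two strings.  The second one is cut into blocks of length Wt
  -- that start with the separator 1; a switched-on block e and the gadget at base share exactly the
  -- window of length G + 3 around their common letter 2.
  module Shared (n E base : ℕ) (sCode tCode S' T' : ℕ → ℕ) (x : ℕ → Bool)
    (sLetter : ℕ → ℕ) (tLetter : ℕ → ℕ → ℕ)
    (level-< : ∀ {e} → e < E → level e < G)
    (sCode-cases : ∀ k → sCode k ≡ 0 ⊎ 3 ≤ sCode k)
    (tCode-cases : ∀ k → tCode k ≡ 1 ⊎ (3 ≤ tCode k × k / Wt < E))
    (sCode-letter : ∀ {c} → 0 < c → c < 2 * G + 3 → c ≢ G + 2 → sCode (base + c) ≡ sLetter c)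
    (tCode-letter : ∀ {e r} → e < E → 0 < r → r < Wt → level e + r ≢ G + 2 →
      tCode (e * Wt + r) ≡ tLetter e (level e + r))
    (tCode-start : ∀ q → tCode (q * Wt) ≡ 1)
    (tCode-slot : ∀ {e} → e < E → tCode (tSlot e) ≡ 1)
    (S-spec : ∀ k → k < n → (k ≡ base + (G + 2) × S' k ≡ 2) ⊎ (k ≢ base + (G + 2) × S' k ≡ sCode k))
    (T-on : ∀ e → e < E → x e ≡ false → T' (tSlot e) ≡ 2)
    (T-spec : ∀ k → k < n → (∃ λ e → e < E × x e ≡ false × k ≡ tSlot e) ⊎ T' k ≡ tCode k)
    where

    0<Wt : 0 < Wt
    0<Wt = ≤-trans (s≤s z≤n) (m≤n+m 4 G)

    1<Wt : 1 < Wt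
    1<Wt = ≤-trans (s≤s (s≤s z≤n)) (m≤n+m 4 G)

    0<G+3 : 0 < G + 3
    0<G+3 = ≤-trans (s≤s z≤n) (m≤n+m 3 G)

    suc-<Wt : ∀ {k} → k < G + 3 → suc k < Wt
    suc-<Wt {k} k< = subst (suc (suc k) ≤_) (sym (+-suc G 3)) (s≤s k<)

    S'≢1 : ∀ k → k < n → S' k ≢ 1
    S'≢1 k k< e = from (S-spec k k<)
      where
      from : (k ≡ base + (G + 2) × S' k ≡ 2) ⊎ (k ≢ base + (G + 2) × S' k ≡ sCode k) → ⊥
      from (inj₁ (_ , q)) with trans (sym q) e
      ... | ()
      from (inj₂ (_ , q)) with sCode-cases k
      ... | inj₂ z = <⇒≱ (s≤s (s≤s z≤n)) (subst (3 ≤_) (trans (sym q) e) z)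
      ... | inj₁ z with trans (sym z) (trans (sym q) e)
      ...   | ()

    S'≡2 : ∀ k → k < n → S' k ≡ 2 → k ≡ base + (G + 2)
    S'≡2 k k< e with S-spec k k<
    ... | inj₁ (q , _) = q
    ... | inj₂ (_ , q) with sCode-cases k
    ...   | inj₂ z = ⊥-elim (<⇒≱ (s≤s (s≤s (s≤s z≤n))) (subst (3 ≤_) (trans (sym q) e) z))
    ...   | inj₁ z with trans (sym z) (trans (sym q) e)
    ...     | ()

    S'-off : ∀ {k} → k < n → k ≢ base + (G + 2) → S' k ≡ sCode k
    S'-off k< ne with S-spec _ k<
    ... | inj₁ (q , _) = ⊥-elim (ne q)
    ... | inj₂ (_ , q) = q

    slot-< : ∀ e → G + 2 ∸ level e < Wt
    slot-< e = ≤-<-trans (m∸n≤m (G + 2) (level e)) (+-monoʳ-< G (s≤s (s≤s (s≤s z≤n))))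

    slot-level : ∀ {e} → e < E → level e + (G + 2 ∸ level e) ≡ G + 2
    slot-level e< = m+[n∸m]≡n (≤-trans (<⇒≤ (level-< e<)) (m≤m+n G 2))

    T'-off : ∀ {e r} → e < E → r < Wt → level e + r ≢ G + 2 → e * Wt + r < n →
      T' (e * Wt + r) ≡ tCode (e * Wt + r)
    T'-off {e} {r} e< r< ne k< with T-spec (e * Wt + r) k<
    ... | inj₂ q = q
    ... | inj₁ (e' , e'< , _ , k≡) with quot-unique {Wt} {e} {r} {e'} r< (slot-< e') k≡
    ...   | refl = ⊥-elim (ne (trans (cong (level e +_)
                     (rem-unique {Wt} {e} {r} {e'} r< (slot-< e') k≡)) (slot-level e'<)))

    T'-start : ∀ q → q * Wt < n → T' (q * Wt) ≡ 1
    T'-start q k< with T-spec (q * Wt) k<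
    ... | inj₂ e = trans e (tCode-start q)
    ... | inj₁ (e' , e'< , _ , k≡) = ⊥-elim (<⇒≢ pos
          (rem-unique {Wt} {q} {0} {e'} 0<Wt (slot-< e') (trans (+-identityʳ (q * Wt)) k≡)))
      where
      pos : 0 < G + 2 ∸ level e'
      pos = m<n⇒0<n∸m (<-≤-trans (level-< e'<) (m≤m+n G 2))

    level-offset : ∀ {e r} → e < E → r < Wt → level e + r < 2 * G + 3
    level-offset {e} {r} e< r< = begin-strict
      level e + r      <⟨ +-monoʳ-< (level e) r< ⟩
      level e + Wt     ≡⟨ cong (level e +_) (+-suc G 3) ⟩
      level e + suc (G + 3) ≡⟨ +-suc (level e) (G + 3) ⟩
      suc (level e) + (G + 3) ≤⟨ +-monoˡ-≤ (G + 3) (level-< e<) ⟩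
      G + (G + 3)      ≡⟨ +-assoc G G 3 ⟨
      G + G + 3        ≡⟨ cong (λ z → G + z + 3) (+-identityʳ G) ⟨
      2 * G + 3 ∎
      where open ≤-Reasoning

    -- A window of length `G + 3` free of 1 is one whole block without its separator. It covers the
    -- slot of the block, which can only show 2; as 2 occurs just once in S', the position in S' is
    -- determined too, and the remaining letters can be compared offset by offset.
    aligned : ∀ i₀ j₀ → i₀ + (G + 3) ≤ n → j₀ + (G + 3) ≤ n →
      (∀ k → k < G + 3 → S' (i₀ + k) ≡ T' (j₀ + k)) →
      ∃ λ e → e < E × x e ≡ false ×
        (∀ k → k < G + 3 → level e + suc k ≢ G + 2 → sLetter (level e + suc k) ≡ tLetter e (level e + suc k))
    aligned i₀ j₀ i₀≤ j₀≤ eq = e , e< , proj₁ xe , letters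
      where
      iPos : ∀ {k} → k < G + 3 → i₀ + k < n
      iPos k< = <-≤-trans (+-monoʳ-< i₀ k<) i₀≤
      jPos : ∀ {k} → k < G + 3 → j₀ + k < n
      jPos k< = <-≤-trans (+-monoʳ-< j₀ k<) j₀≤
      T'≢1 : ∀ k → k < G + 3 → T' (j₀ + k) ≢ 1
      T'≢1 k k< e = S'≢1 (i₀ + k) (iPos k<) (trans (eq k k<) e)
      e r : ℕ
      e = j₀ / Wt
      r = j₀ % Wt
      j₀-eq : e * Wt + r ≡ j₀
      j₀-eq = /-%-eq j₀ Wt
      not-start : ∀ q k → k < G + 3 → q * Wt ≡ j₀ + k → ⊥
      not-start q k k< start =
        T'≢1 k k< (subst (λ z → T' z ≡ 1) start (T'-start q (subst (_< n) (sym start) (jPos k<))))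
      -- The window avoids the separators, so it has to start right behind one.
      offset : ∀ r → r < Wt → e * Wt + r ≡ j₀ → r ≡ 1
      offset zero r< p = ⊥-elim (not-start e 0 0<G+3
        (trans (sym (+-identityʳ (e * Wt))) (trans p (sym (+-identityʳ j₀)))))
      offset (suc zero) r< p = refl
      offset (suc (suc r')) r< p = ⊥-elim (not-start (suc e) k₁ k₁< start)
        where
        -- The distance from the start of the window to the next separator; being at most `G + 2`,
        -- it ends inside the window.
        k₁ : ℕ
        k₁ = Wt ∸ suc (suc r')
        k₁< : k₁ < G + 3
        k₁< = s≤s⁻¹ (subst (suc (suc k₁) ≤_) (+-suc G 3)
                (≤-trans (+-monoʳ-≤ 2 (∸-monoʳ-≤ {2} {suc (suc r')} Wt (s≤s (s≤s z≤n))))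
                  (≤-reflexive (m+[n∸m]≡n 1<Wt))))
        start : suc e * Wt ≡ j₀ + k₁
        start = begin
          Wt + e * Wt ≡⟨ +-comm Wt (e * Wt) ⟩
          e * Wt + Wt ≡⟨ cong (e * Wt +_) (sym (m+[n∸m]≡n (<⇒≤ r<))) ⟩
          e * Wt + (suc (suc r') + k₁) ≡⟨ sym (+-assoc (e * Wt) (suc (suc r')) k₁) ⟩
          e * Wt + suc (suc r') + k₁ ≡⟨ cong (_+ k₁) p ⟩
          j₀ + k₁ ∎
          where open ≡-Reasoning
      j₀≡ : ∀ k → e * Wt + suc k ≡ j₀ + k
      j₀≡ k = trans (sym (+-assoc (e * Wt) 1 k))
        (cong (_+ k) (trans (cong (e * Wt +_) (sym (offset r (m%n<n j₀ Wt) j₀-eq))) j₀-eq))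
      -- Behind the block of the last edge `tCode` is always 1, so a window without 1 must lie in
      -- the block of an edge.
      e< : e < E
      e< with T-spec (j₀ + 0) (jPos 0<G+3)
      ... | inj₁ (e' , e'< , _ , k≡) =
              subst (_< E) (sym (quot-unique {Wt} {e} {1} {e'} 1<Wt (slot-< e') (trans (j₀≡ 0) k≡))) e'<
      ... | inj₂ q with tCode-cases (j₀ + 0)
      ...   | inj₁ z = ⊥-elim (T'≢1 0 0<G+3 (trans q z))
      ...   | inj₂ (_ , z) = subst (λ z → z / Wt < E) (+-identityʳ j₀) z
      i : ℕ
      i = level e
      i<G : i < G
      i<G = level-< e<
      -- The window starts at position 1 of the block, so the slot at position `G + 2 ∸ i` has index
      -- `G + 1 ∸ i` in it.
      k₀ : ℕ
      k₀ = G + 1 ∸ i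
      k₀-suc : suc k₀ ≡ G + 2 ∸ i
      k₀-suc = trans (sym (+-∸-assoc 1 (≤-trans (<⇒≤ i<G) (m≤m+n G 1)))) (cong (_∸ i) (sym (+-suc G 1)))
      k₀< : k₀ < G + 3
      k₀< = ≤-<-trans (m∸n≤m (G + 1) i) (+-monoʳ-< G (s≤s (s≤s z≤n)))
      slot-pos : j₀ + k₀ ≡ tSlot e
      slot-pos = trans (sym (j₀≡ k₀)) (cong (e * Wt +_) k₀-suc)
      xe : x e ≡ false × T' (j₀ + k₀) ≡ 2
      xe with T-spec (j₀ + k₀) (jPos k₀<)
      ... | inj₂ q = ⊥-elim (T'≢1 k₀ k₀< (trans q (trans (cong tCode slot-pos) (tCode-slot e<))))
      ... | inj₁ (e' , e'< , xe' , k≡) =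
              subst (λ z → x z ≡ false) (sym e≡e') xe' ,
              trans (cong T' slot-pos) (T-on e e< (subst (λ z → x z ≡ false) (sym e≡e') xe'))
        where
        e≡e' : e ≡ e'
        e≡e' = quot-unique {Wt} {e} {_} {e'} (slot-< e) (slot-< e') (trans (sym slot-pos) k≡)
      s-pos : i₀ + k₀ ≡ base + (G + 2)
      s-pos = S'≡2 (i₀ + k₀) (iPos k₀<) (trans (eq k₀ k₀<) (proj₂ xe))
      i₀-eq : i₀ ≡ base + suc i
      i₀-eq = +-cancelʳ-≡ k₀ i₀ (base + suc i) (trans s-pos (trans (cong (base +_) (begin
        G + 2 ≡⟨ +-suc G 1 ⟩
        suc (G + 1) ≡⟨ cong suc (sym (m+[n∸m]≡n (≤-trans (<⇒≤ i<G) (m≤m+n G 1)))) ⟩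
        suc i + k₀ ∎)) (sym (+-assoc base (suc i) k₀))))
        where open ≡-Reasoning
      letters : ∀ k → k < G + 3 → i + suc k ≢ G + 2 → sLetter (i + suc k) ≡ tLetter e (i + suc k)
      letters k k< c≢ = begin
        sLetter (i + suc k)     ≡⟨ sym (sCode-letter (≤-trans (s≤s z≤n) (m≤n+m (suc k) i)) (level-offset e< (suc-<Wt k<)) c≢) ⟩
        sCode (base + (i + suc k)) ≡⟨ cong sCode posn ⟩
        sCode (i₀ + k)         ≡⟨ sym (S'-off (iPos k<) k≢) ⟩
        S' (i₀ + k)            ≡⟨ eq k k< ⟩
        T' (j₀ + k)            ≡⟨ cong T' (sym (j₀≡ k)) ⟩
        T' (e * Wt + suc k)    ≡⟨ T'-off e< (suc-<Wt k<) c≢ (subst (_< n) (sym (j₀≡ k)) (jPos k<)) ⟩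
        tCode (e * Wt + suc k) ≡⟨ tCode-letter e< (s≤s z≤n) (suc-<Wt k<) c≢ ⟩
        tLetter e (i + suc k)  ∎
        where
        open ≡-Reasoning
        posn : base + (i + suc k) ≡ i₀ + k
        posn = trans (cong (base +_) (+-suc i k)) (trans (sym (+-assoc base (suc i) k)) (cong (_+ k) (sym i₀-eq)))
        k≢ : i₀ + k ≢ base + (G + 2)
        k≢ z = c≢ (+-cancelˡ-≡ base (i + suc k) (G + 2) (trans posn z))

    window : ∀ {e} → e < E → x e ≡ false →
      (∀ k → k < G + 3 → level e + suc k ≢ G + 2 → sLetter (level e + suc k) ≡ tLetter e (level e + suc k)) →
      base + suc (level e) + (G + 3) ≤ n → e * Wt + 1 + (G + 3) ≤ n →
      ∀ k → k < G + 3 → S' (base + suc (level e) + k) ≡ T' (e * Wt + 1 + k)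
    window {e} e< xe letters i≤ j≤ k k< = go (level e + suc k ≟ G + 2)
      where
      open ≡-Reasoning
      sPos : base + suc (level e) + k ≡ base + (level e + suc k)
      sPos = trans (+-assoc base (suc (level e)) k) (cong (base +_) (sym (+-suc (level e) k)))
      tPos : e * Wt + 1 + k ≡ e * Wt + suc k
      tPos = +-assoc (e * Wt) 1 k
      s< : base + (level e + suc k) < n
      s< = subst (_< n) sPos (<-≤-trans (+-monoʳ-< (base + suc (level e)) k<) i≤)
      t< : e * Wt + suc k < n
      t< = subst (_< n) tPos (<-≤-trans (+-monoʳ-< (e * Wt + 1) k<) j≤)
      on-slot : S' (base + (G + 2)) ≡ 2 → level e + suc k ≡ G + 2 → S' (base + suc (level e) + k) ≡ T' (e * Wt + 1 + k)
      on-slot S2 c≡ = begin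
        S' (base + suc (level e) + k) ≡⟨ cong S' (trans sPos (cong (base +_) c≡)) ⟩
        S' (base + (G + 2))    ≡⟨ S2 ⟩
        2                      ≡⟨ sym (T-on e e< xe) ⟩
        T' (tSlot e)           ≡⟨ cong (λ z → T' (e * Wt + z)) (sym (trans (sym (m+n∸m≡n (level e) (suc k))) (cong (_∸ level e) c≡))) ⟩
        T' (e * Wt + suc k)    ≡⟨ cong T' (sym tPos) ⟩
        T' (e * Wt + 1 + k) ∎
      go : Dec (level e + suc k ≡ G + 2) → S' (base + suc (level e) + k) ≡ T' (e * Wt + 1 + k)
      go (no c≢) = begin
        S' (base + suc (level e) + k) ≡⟨ cong S' sPos ⟩
        S' (base + (level e + suc k)) ≡⟨ S'-off s< (λ z → c≢ (+-cancelˡ-≡ base _ _ z)) ⟩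
        sCode (base + (level e + suc k)) ≡⟨ sCode-letter (≤-trans (s≤s z≤n) (m≤n+m (suc k) (level e))) (level-offset e< (suc-<Wt k<)) c≢ ⟩
        sLetter (level e + suc k) ≡⟨ letters k k< c≢ ⟩
        tLetter e (level e + suc k) ≡⟨ sym (tCode-letter e< (s≤s z≤n) (suc-<Wt k<) c≢) ⟩
        tCode (e * Wt + suc k) ≡⟨ sym (T'-off e< (suc-<Wt k<) c≢ t<) ⟩
        T' (e * Wt + suc k)    ≡⟨ cong T' (sym tPos) ⟩
        T' (e * Wt + 1 + k) ∎
      go (yes c≡) with S-spec (base + (G + 2)) (subst (λ z → base + z < n) c≡ s<)
      ... | inj₁ (_ , S2) = on-slot S2 c≡
      ... | inj₂ (ne , _) = ⊥-elim (ne refl)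

-- Path queries answered by longest common substrings

module LCS (n b' G : ℕ) .{{n≢0 : NonZero n}} where

  open Network b' G
  open Gadget n b' G

  -- An edge e is marked when x e ≡ false, so that unmarked sets of edges are subsets of x.
  module Instances (sFits : N * Y * Ws ≤ n) (tFits : edges * Wt ≤ n) (lettersFit : 3 + Ws * N ≤ n) where

    open Sized sFits tFits lettersFit

    s₀ t₀ : Str (Alph n) n
    s₀ = string sCode
    t₀ = string tCode

    mark : ℕ → Upd n
    mark e = true , fin (tSlot e) , fin 2

    query : ℕ → ℕ → Upd n
    query y p = false , fin (sSlot y p) , fin 2

    marked : (ℕ → Bool) → List ℕ
    marked x = filterᵇ (not ∘ x) (upTo edges)

    marks : (ℕ → Bool) → List (Upd n)
    marks x = map mark (marked x)

    length-marks : ∀ x → length (marks x) ≤ edges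
    length-marks x = ≤-trans (≤-reflexive (length-map mark (marked x)))
      (≤-trans (length-filter (T? ∘ not ∘ x) (upTo edges)) (≤-reflexive (length-upTo edges)))

    marked-< : ∀ {x e} → e ∈ marked x → e < edges × x e ≡ false
    marked-< {x} {e} e∈ with ∈-filter⁻ (T? ∘ not ∘ x) {xs = upTo edges} e∈
    ... | e∈' , q = ∈-upTo⁻ e∈' , off (x e) q
      where
      off : ∀ c → Bool.T (not c) → c ≡ false
      off false _ = refl

    ∈-marked : ∀ {x e} → e < edges → x e ≡ false → e ∈ marked x
    ∈-marked {x} {e} e< xe = ∈-filter⁺ (T? ∘ not ∘ x) (∈-upTo⁺ e<) (subst (λ c → Bool.T (not c)) (sym xe) _)

    switchOn : List ℕ → Str (Alph n) n → Str (Alph n) n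
    switchOn []       t = t
    switchOn (e ∷ es) t = switchOn es (t [ fin (tSlot e) ]≔ fin 2)

    applyUpds-marks : ∀ es s t → applyUpds (map mark es) (s , t) ≡ (s , switchOn es t)
    applyUpds-marks []       s t = refl
    applyUpds-marks (e ∷ es) s t = applyUpds-marks es s _

    fin-2 : toℕ (fin 2) ≡ 2
    fin-2 = toℕ-fin (filler-< ≤-refl)

    tSlot-< : ∀ {e} → e < edges → tSlot e < n
    tSlot-< {e} e< = <-≤-trans (mixed-bound e< (≤-<-trans (m∸n≤m (G + 2) (level (decode e)))
      (+-monoʳ-< G (s≤s (s≤s (s≤s z≤n)))))) tFits

    sSlot-< : ∀ {y p} → y < Y → p < N → sSlot y p < n
    sSlot-< y< p< = <-≤-trans (mixed-bound (mixed-bound p< y<) Ws-mid) sFits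

    at-set : ∀ (v : Str (Alph n) n) pos → pos < n → ∀ k →
      (k ≡ pos × atᵥ (v [ fin pos ]≔ fin 2) k ≡ 2) ⊎ (k ≢ pos × atᵥ (v [ fin pos ]≔ fin 2) k ≡ atᵥ v k)
    at-set v pos pos< k with k ≟ pos
    ... | no ne = inj₂ (ne , at-update-other v (fin pos) (fin 2) k (λ q → ne (trans q (toℕ-fin pos<))))
    ... | yes refl = inj₁ (refl , trans (cong (atᵥ (v [ fin k ]≔ fin 2)) (sym (toℕ-fin pos<)))
                       (trans (at-update-same v (fin k) (fin 2)) fin-2))

    switchOn-cases : ∀ es t → (∀ {e} → e ∈ es → e < edges) → ∀ k →
      (∃ λ e → e ∈ es × k ≡ tSlot e) ⊎ atᵥ (switchOn es t) k ≡ atᵥ t k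
    switchOn-cases [] t es< k = inj₂ refl
    switchOn-cases (e ∷ es) t es< k with switchOn-cases es (t [ fin (tSlot e) ]≔ fin 2) (es< ∘ there) k
    ... | inj₁ (e' , e'∈ , q) = inj₁ (e' , there e'∈ , q)
    ... | inj₂ q with at-set t (tSlot e) (tSlot-< (es< (here refl))) k
    ...   | inj₁ (k≡ , _) = inj₁ (e , here refl , k≡)
    ...   | inj₂ (_ , q') = inj₂ (trans q q')

    switchOn-keeps : ∀ es t → (∀ {e} → e ∈ es → e < edges) → ∀ k → atᵥ t k ≡ 2 → atᵥ (switchOn es t) k ≡ 2
    switchOn-keeps [] t es< k h = h
    switchOn-keeps (e ∷ es) t es< k h = switchOn-keeps es _ (es< ∘ there) k first
      where
      first : atᵥ (t [ fin (tSlot e) ]≔ fin 2) k ≡ 2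
      first with at-set t (tSlot e) (tSlot-< (es< (here refl))) k
      ... | inj₁ (_ , q) = q
      ... | inj₂ (_ , q) = trans q h

    switchOn-on : ∀ es t → (∀ {e} → e ∈ es → e < edges) → ∀ {e} → e ∈ es → atᵥ (switchOn es t) (tSlot e) ≡ 2
    switchOn-on (e ∷ es) t es< (here refl) = switchOn-keeps es _ (es< ∘ there) (tSlot e) first
      where
      first : atᵥ (t [ fin (tSlot e) ]≔ fin 2) (tSlot e) ≡ 2
      first with at-set t (tSlot e) (tSlot-< (es< (here refl))) (tSlot e)
      ... | inj₁ (_ , q) = q
      ... | inj₂ (ne , _) = ⊥-elim (ne refl)
    switchOn-on (e ∷ es) t es< (there m) = switchOn-on es _ (es< ∘ there) m

    module _ {y p : ℕ} (y< : y < Y) (p< : p < N) (x : ℕ → Bool) where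

      private
        base : ℕ
        base = (p * Y + y) * Ws
        s' t' : Str (Alph n) n
        s' = s₀ [ fin (sSlot y p) ]≔ fin 2
        t' = switchOn (marked x) t₀

        S-spec : ∀ k → k < n → (k ≡ sSlot y p × atᵥ s' k ≡ 2) ⊎ (k ≢ sSlot y p × atᵥ s' k ≡ sCode k)
        S-spec k k< with at-set s₀ (sSlot y p) (sSlot-< y< p<) k
        ... | inj₁ q = inj₁ q
        ... | inj₂ (ne , q) = inj₂ (ne , trans q (at-string sCode sCode-< k k<))

        T-on : ∀ e → e < edges → x e ≡ false → atᵥ t' (tSlot e) ≡ 2
        T-on e e< xe = switchOn-on (marked x) t₀ (proj₁ ∘ marked-<) (∈-marked e< xe)

        T-spec : ∀ k → k < n → (∃ λ e → e < edges × x e ≡ false × k ≡ tSlot e) ⊎ atᵥ t' k ≡ tCode k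
        T-spec k k< with switchOn-cases (marked x) t₀ (proj₁ ∘ marked-<) k
        ... | inj₁ (e , e∈ , q) = inj₁ (e , proj₁ (marked-< e∈) , proj₂ (marked-< e∈) , q)
        ... | inj₂ q = inj₂ (trans q (at-string tCode tCode-< k k<))

        tLetter : ℕ → ℕ → ℕ
        tLetter e c = letter (source (decode e)) (target (decode e)) c

        sCode-letter : ∀ {c} → 0 < c → c < Ws → c ≢ G + 2 → sCode (base + c) ≡ letter y p c
        sCode-letter 0<c c< c≢ = trans (sCode-block y< p< c<) (sCell-letter y p _ (λ z → <⇒≢ 0<c (sym z)) c≢)

        tCode-letter : ∀ {e r} → e < edges → 0 < r → r < Wt → level (decode e) + r ≢ G + 2 →
          tCode (e * Wt + r) ≡ tLetter e (level (decode e) + r)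
        tCode-letter e< 0<r r< c≢ =
          trans (tCode-block e< r<) (tCell-letter (decode _) _ (λ z → <⇒≢ 0<r (sym z)) c≢)

        tCode-slot : ∀ {e} → e < edges → tCode (tSlot e) ≡ 1
        tCode-slot {e} e< = trans (tCode-block e< (≤-<-trans (m∸n≤m (G + 2) (level (decode e)))
            (+-monoʳ-< G (s≤s (s≤s (s≤s z≤n))))))
          (tCell-slot (decode e) _ (m+[n∸m]≡n (≤-trans (<⇒≤ (decode-level e<)) (m≤m+n G 2))))

        open Alignment.Shared G (level ∘ decode) n edges base sCode tCode (atᵥ s') (atᵥ t') x
          (letter y p) tLetter decode-level sCode-cases tCode-cases sCode-letter tCode-letter
          tCode-start tCode-slot S-spec T-on T-spec
          using (aligned; window)

      -- The last letter of the window of level i sits at offset i + G + 3; this computes how many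
      -- digits of y are cut off there.
      high-index : ∀ i → 2 * G + 2 ∸ (i + suc (G + 2)) ≡ G ∸ suc i
      high-index i = trans (cong₂ _∸_
        (solve 1 (λ g → con 2 :* g :+ con 2 := (g :+ con 2) :+ g) refl G)
        (solve 2 (λ i g → i :+ (con 1 :+ (g :+ con 2)) := (g :+ con 2) :+ (con 1 :+ i)) refl i G))
        ([m+n]∸[m+o]≡n∸o (G + 2) G (suc i))

      -- The two outermost letters suffice. The first shows `pre i p`, which contains both the
      -- target prefix of the vertex and the digit of the edge; the last shows the source prefix of
      -- the vertex.
      same-edge : ∀ {e} → e < edges →
        (∀ k → k < G + 3 → level (decode e) + suc k ≢ G + 2 →
          letter y p (level (decode e) + suc k) ≡ tLetter e (level (decode e) + suc k)) →
        edge (level (decode e)) y p ≡ e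
      same-edge {e} e< letters = trans (cong₂ (λ u z → (i * N + u) * b + z % b)
          (cong₂ (λ u v → u * b ^ suc i + v) (pre-mono (n≤1+n i) target-eq) source-eq) target-eq)
          (decode-edge {e})
        where
        d : Decoded
        d = decode e
        i : ℕ
        i = level d
        i<G : i < G
        i<G = decode-level e<
        labels : ∀ k → k < G + 3 → i + suc k ≢ G + 2 →
          label y p (i + suc k) ≡ label (source d) (target d) (i + suc k)
        labels k k< c≢ = letter-label {y} {p} {source d} {target d} (i + suc k) (letters k k< c≢)
        i+1≤ : i + 1 ≤ suc G
        i+1≤ = ≤-trans (≤-reflexive (+-comm i 1)) (m≤n⇒m≤1+n i<G)
        target-eq : pre i p ≡ pre i (target d)
        target-eq = begin
          pre i p                ≡⟨ cong (λ c → pre (c ∸ 1) p) (+-comm 1 i) ⟩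
          pre (i + 1 ∸ 1) p      ≡⟨ sym (label-low {y} {p} (i + 1) i+1≤) ⟩
          label y p (i + 1)      ≡⟨ labels 0 (≤-trans (s≤s z≤n) (m≤n+m 3 G))
                                      (<⇒≢ (≤-<-trans i+1≤ (≤-reflexive (sym (trans (+-suc G 1) (cong suc (+-comm G 1))))))) ⟩
          label (source d) (target d) (i + 1) ≡⟨ label-low {source d} {target d} (i + 1) i+1≤ ⟩
          pre (i + 1 ∸ 1) (target d) ≡⟨ cong (λ c → pre (c ∸ 1) (target d)) (+-comm i 1) ⟩
          pre i (target d) ∎
          where open ≡-Reasoning
        big : G + 2 < i + suc (G + 2)
        big = m≤n+m (suc (G + 2)) i
        big' : suc G < i + suc (G + 2)
        big' = ≤-<-trans (≤-trans (≤-reflexive (+-comm 1 G)) (+-monoʳ-≤ G (s≤s z≤n))) big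
        source-eq : pre (G ∸ suc i) y ≡ pre (G ∸ suc i) (source d)
        source-eq = begin
          pre (G ∸ suc i) y      ≡⟨ cong (λ z → pre z y) (sym (high-index i)) ⟩
          pre (2 * G + 2 ∸ (i + suc (G + 2))) y ≡⟨ sym (label-high {y} {p} (i + suc (G + 2)) big') ⟩
          label y p (i + suc (G + 2)) ≡⟨ labels (G + 2) (+-monoʳ-< G (s≤s (s≤s (s≤s z≤n)))) (λ z → <⇒≢ big (sym z)) ⟩
          label (source d) (target d) (i + suc (G + 2)) ≡⟨ label-high {source d} {target d} (i + suc (G + 2)) big' ⟩
          pre (2 * G + 2 ∸ (i + suc (G + 2))) (source d) ≡⟨ cong (λ z → pre z (source d)) (high-index i) ⟩
          pre (G ∸ suc i) (source d) ∎
          where open ≡-Reasoning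

      private
        Answer : ℕ → Set
        Answer L = let st = applyUpd (query y p) (applyUpds (marks x) (s₀ , t₀)) in
          IsLCSLength (proj₁ st) (proj₂ st) L

        answer : ∀ {L} → Answer L → IsLCSLength s' t' L
        answer {L} = subst (λ st → let st' = applyUpd (query y p) st in IsLCSLength (proj₁ st') (proj₂ st') L)
          (applyUpds-marks (marked x) s₀ t₀)

      private
        Window : ℕ → Set
        Window e = ∀ k → k < G + 3 → level (decode e) + suc k ≢ G + 2 →
          letter y p (level (decode e) + suc k) ≡ tLetter e (level (decode e) + suc k)

        no-window : (∀ i → i < G → x (edge i y p) ≡ true) → (∃ λ e → e < edges × x e ≡ false × Window e) → ⊥
        no-window path (e , e< , xe , letters) = true≢false
          (trans (sym (path (level (decode e)) (decode-level e<))) (trans (cong x (same-edge e< letters)) xe))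
          where
          true≢false : true ≢ false
          true≢false ()

        no-long : (∀ i → i < G → x (edge i y p) ≡ true) → ∀ {L} → G + 3 ≤ L →
          (∃ λ i → ∃ λ j → i + L ≤ n × j + L ≤ n × (∀ k → k < L → atᵥ s' (i + k) ≡ atᵥ t' (j + k))) → ⊥
        no-long path {L} long (i₀ , j₀ , i≤ , j≤ , eq) =
          no-window path (aligned i₀ j₀ (fits i₀ i≤) (fits j₀ j≤) (λ k k< → eq k (<-≤-trans k< long)))
          where
          fits : ∀ i → i + L ≤ n → i + (G + 3) ≤ n
          fits i q = ≤-trans (+-monoʳ-≤ i long) q

      lcs-unmarked : (∀ i → i < G → x (edge i y p) ≡ true) → ∀ {L} → Answer L → L ≤ G + 2
      lcs-unmarked path {L} ans = go (answer ans) (L ≤? G + 2)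
        where
        go : IsLCSLength s' t' L → Dec (L ≤ G + 2) → L ≤ G + 2
        go _ (yes q) = q
        go ((u , cs , len) , _) (no ¬q) = ⊥-elim (no-long path
          (subst₂ _≤_ (sym (+-suc G 2)) (sym len) (≰⇒> ¬q)) (common-substring-at {s = s'} {t'} {u} cs))

      lcs-marked : ∀ {i} → i < G → x (edge i y p) ≡ false → ∀ {L} → Answer L → G + 3 ≤ L
      lcs-marked {i} i<G xe {L} ans =
        subst (_≤ L) (proj₂ (proj₂ common)) (proj₂ (answer ans) (proj₁ common) (proj₁ (proj₂ common)))
        where
        e : ℕ
        e = edge i y p
        e< : e < edges
        e< = edge-< i<G y< p<
        d : Decoded
        d = decode e
        lv : level d ≡ i
        lv = decode-edge-level i<G y< p<
        -- Towards the middle of the window the letters show ever shorter prefixes, so equality of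
        -- the outermost ones passes inwards by `pre-mono`.
        labels : ∀ k → k < G + 3 → label y p (level d + suc k) ≡ label (source d) (target d) (level d + suc k)
        labels k k< = by-side (level d + suc k ≤? suc G)
          where
          c : ℕ
          c = level d + suc k
          by-side : Dec (c ≤ suc G) → label y p c ≡ label (source d) (target d) c
          by-side (yes c≤) = trans (label-low {y} {p} c c≤)
            (trans (pre-mono {i} {c ∸ 1} (subst (i ≤_) (cong (_∸ 1) (sym (+-suc (level d) k)))
                      (subst (λ z → i ≤ z + k) (sym lv) (m≤m+n i k)))
                    (sym (decode-edge-target i<G y< p<)))
              (sym (label-low {source d} {target d} c c≤)))
          by-side (no c≰) = trans (label-high {y} {p} c (≰⇒> c≰))
            (trans (pre-mono {G ∸ suc i} {2 * G + 2 ∸ c}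
                      (≤-trans (≤-reflexive (sym (high-index i))) (∸-monoʳ-≤ (2 * G + 2)
                        (+-mono-≤ (≤-reflexive lv) (subst (suc k ≤_) (+-suc G 2) k<))))
                      (sym (decode-edge-source i<G y< p<)))
              (sym (label-high {source d} {target d} c (≰⇒> c≰))))
        i₀≤ : base + suc (level d) + (G + 3) ≤ n
        i₀≤ = begin
          base + suc (level d) + (G + 3) ≡⟨ +-assoc base (suc (level d)) (G + 3) ⟩
          base + (suc (level d) + (G + 3)) ≤⟨ +-monoʳ-≤ base (+-monoˡ-≤ (G + 3) (decode-level e<)) ⟩
          base + (G + (G + 3)) ≡⟨ cong (base +_) (solve 1 (λ g → g :+ (g :+ con 3) := con 2 :* g :+ con 3) refl G) ⟩
          base + Ws ≡⟨ +-comm base Ws ⟩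
          suc (p * Y + y) * Ws ≤⟨ *-monoˡ-≤ Ws (mixed-bound p< y<) ⟩
          N * Y * Ws ≤⟨ sFits ⟩
          n ∎
          where open ≤-Reasoning
        j₀≤ : e * Wt + 1 + (G + 3) ≤ n
        j₀≤ = begin
          e * Wt + 1 + (G + 3) ≡⟨ solve 2 (λ w g → w :+ con 1 :+ (g :+ con 3) := (g :+ con 4) :+ w) refl (e * Wt) G ⟩
          suc e * Wt ≤⟨ *-monoˡ-≤ Wt e< ⟩
          edges * Wt ≤⟨ tFits ⟩
          n ∎
          where open ≤-Reasoning
        common : ∃ λ u → CommonSubstring s' t' u × length u ≡ G + 3
        common = common-substring s' t' (G + 3) (base + suc (level d)) (e * Wt + 1) i₀≤ j₀≤
          (window e< xe (λ k k< _ → cong (λ z → 3 + ((level d + suc k) * N + z)) (labels k k<)) i₀≤ j₀≤)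

-- The counting argument

∧-elim : ∀ a {c} → a ∧ c ≡ true → a ≡ true × c ≡ true
∧-elim true refl = refl , refl

∧-intro : ∀ {a c} → a ≡ true → c ≡ true → a ∧ c ≡ true
∧-intro refl refl = refl

⟦⟧-imp : ∀ {a c} → (a ≡ true → c ≡ true) → ⟦ a ⟧ ≤ ⟦ c ⟧
⟦⟧-imp {false} h = z≤n
⟦⟧-imp {true} h rewrite h refl = ≤-refl

≤?-true : ∀ {m n} → m ≤ n → ⌊ m ≤? n ⌋ ≡ true
≤?-true {m} {n} p with m ≤? n
... | yes _ = refl
... | no ¬p = ⊥-elim (¬p p)

≤?-elim : ∀ {m n} → ⌊ m ≤? n ⌋ ≡ true → m ≤ n
≤?-elim {m} {n} h with m ≤? n
... | yes p = p

guard : Bool → List ℕ → List ℕ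
guard true  l = l
guard false l = []

guard-∈ : ∀ c {l a} → a ∈ guard c l → c ≡ true × a ∈ l
guard-∈ true a∈ = refl , a∈

∈-guard : ∀ {c l a} → c ≡ true → a ∈ l → a ∈ guard c l
∈-guard refl a∈ = a∈

pairs : List ℕ → List ℕ → Batch
pairs ys ps = concatMap (λ y → map (y ,_) ps) ys

pairs-∈ : ∀ ys ps {y p} → (y , p) ∈ pairs ys ps → y ∈ ys × p ∈ ps
pairs-∈ (y' ∷ ys) ps m with ∈-++⁻ (map (y' ,_) ps) m
... | inj₂ q = let y∈ , p∈ = pairs-∈ ys ps q in there y∈ , p∈
... | inj₁ q with ∈-map⁻ (y' ,_) q
...   | p , p∈ , refl = here refl , p∈

∈-pairs : ∀ {ys ps y p} → y ∈ ys → p ∈ ps → (y , p) ∈ pairs ys ps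
∈-pairs {y = y} (here refl) p∈ = ∈-++⁺ˡ (∈-map⁺ (y ,_) p∈)
∈-pairs {y' ∷ ys} {ps} (there q) p∈ = ∈-++⁺ʳ (map (y' ,_) ps) (∈-pairs q p∈)

concatQ : (ℕ → ℕ → List ℕ) → Batch → List ℕ
concatQ f []            = []
concatQ f ((y , p) ∷ Q) = f y p ++ concatQ f Q

∈-concatQ : ∀ {f Q y p a} → (y , p) ∈ Q → a ∈ f y p → a ∈ concatQ f Q
∈-concatQ (here refl) a∈ = ∈-++⁺ˡ a∈
∈-concatQ {f} {(y' , p') ∷ Q} (there m) a∈ = ∈-++⁺ʳ (f y' p') (∈-concatQ m a∈)

concatQ-∈ : ∀ f Q {a} → a ∈ concatQ f Q → ∃ λ y → ∃ λ p → (y , p) ∈ Q × a ∈ f y p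
concatQ-∈ f ((y , p) ∷ Q) a∈ with ∈-++⁻ (f y p) a∈
... | inj₁ q = y , p , here refl , q
... | inj₂ q with concatQ-∈ f Q q
...   | y' , p' , m , q' = y' , p' , there m , q'

length-concatQ : ∀ f c Q → (∀ {y p} → (y , p) ∈ Q → length (f y p) ≤ c) → length (concatQ f Q) ≤ length Q * c
length-concatQ f c [] h = z≤n
length-concatQ f c ((y , p) ∷ Q) h = ≤-trans (≤-reflexive (length-++ (f y p)))
  (+-mono-≤ (h (here refl)) (length-concatQ f c Q (h ∘ there)))

module Averaging {Q X T : Set} (Qs : List Q) (Xs : List X) (Ts : List T)
  (good : Q → X → Bool) (surv : T → Q → X → Bool) where

  survivors : T → ℕ
  survivors τ = ∑ Qs (λ q → ∑ Xs (λ x → ⟦ good q x ⟧ * ⟦ surv τ q x ⟧))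

  -- Exchange of sums: every good pair survives for at least a 1 / c share of the samples, so some
  -- sample keeps at least a 1 / c share of all good pairs.
  best : ∀ c → 0 < length Ts →
    (∀ {q x} → q ∈ Qs → x ∈ Xs → length Ts ≤ c * ∑ Ts (λ τ → ⟦ surv τ q x ⟧)) →
    ∃ λ τ → ∑ Qs (λ q → ∑ Xs (λ x → ⟦ good q x ⟧)) ≤ c * survivors τ
  best c pos h with ∑-average Ts survivors pos
  ... | τ , av = τ , *-cancelˡ-≤ (length Ts) {{>-nonZero pos}} (begin
    length Ts * ∑ Qs (λ q → ∑ Xs (λ x → ⟦ good q x ⟧))
      ≡⟨ sym (∑-*ˡ Qs (length Ts) _) ⟩
    ∑ Qs (λ q → length Ts * ∑ Xs (λ x → ⟦ good q x ⟧))
      ≡⟨ ∑-cong Qs (λ q → sym (∑-*ˡ Xs (length Ts) _)) ⟩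
    ∑ Qs (λ q → ∑ Xs (λ x → length Ts * ⟦ good q x ⟧))
      ≤⟨ ∑-mono Qs (λ {q} q∈ → ∑-mono Xs (λ {x} x∈ → *-monoˡ-≤ ⟦ good q x ⟧ (h q∈ x∈))) ⟩
    ∑ Qs (λ q → ∑ Xs (λ x → c * ∑ Ts (λ τ → ⟦ surv τ q x ⟧) * ⟦ good q x ⟧))
      ≡⟨ ∑-cong Qs (λ q → ∑-cong Xs (λ x → trans (*-assoc c _ _) (cong (c *_)
           (trans (sym (∑-*ʳ Ts ⟦ good q x ⟧ _)) (∑-cong Ts (λ τ → *-comm ⟦ surv τ q x ⟧ ⟦ good q x ⟧)))))) ⟩
    ∑ Qs (λ q → ∑ Xs (λ x → c * ∑ Ts (λ τ → ⟦ good q x ⟧ * ⟦ surv τ q x ⟧)))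
      ≡⟨ ∑-cong Qs (λ q → ∑-*ˡ Xs c _) ⟩
    ∑ Qs (λ q → c * ∑ Xs (λ x → ∑ Ts (λ τ → ⟦ good q x ⟧ * ⟦ surv τ q x ⟧)))
      ≡⟨ ∑-*ˡ Qs c _ ⟩
    c * ∑ Qs (λ q → ∑ Xs (λ x → ∑ Ts (λ τ → ⟦ good q x ⟧ * ⟦ surv τ q x ⟧)))
      ≡⟨ cong (c *_) (trans (∑-cong Qs (λ q → ∑-swap Xs Ts _)) (∑-swap Qs Ts _)) ⟩
    c * ∑ Ts survivors               ≤⟨ *-monoʳ-≤ c av ⟩
    c * (length Ts * survivors τ)    ≡⟨ solve 3 (λ x y z → x :* (y :* z) := y :* (x :* z)) refl c (length Ts) (survivors τ) ⟩
    length Ts * (c * survivors τ) ∎)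
    where open ≤-Reasoning

module Contradiction {n S w : ℕ} (D : DynLCS n S w) (correct : Correct D) .{{n≢0 : NonZero n}}
  (b' G K r t ω h U : ℕ) where

  open Network b' G
  open Gadget n b' G
  open LCS n b' G
  open DynLCS D
  open CellProbe S w

  module Fitting (sFits : N * Y * Ws ≤ n) (tFits : edges * Wt ≤ n) (lettersFit : 3 + Ws * N ≤ n) where

    open Instances sFits tFits lettersFit

    module Assuming
      (cheap : ∀ {x y p} → x ∈ subsets 1 edges → y < Y → p < N →
        Cheap D t (initConfig D s₀ t₀) (marks x ++ query y p ∷ []))
      (1≤K : 1 ≤ K) (2G≤b : 2 * G ≤ b)
      (fewWrites : edges * t ≤ suc r * ω)
      (fewInside : (b * (K * b) ^ G) ^ Y ≤ U * b ^ (Y * G ∸ h))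
      where

      private
        cells : ℕ
        -- The cells read by the Y queries, and twice the bound ω on the expected number of other
        -- changed cells that are kept.
        cells = Y * t + 2 * ω

        ys : List ℕ
        ys = upTo Y

        Xs : List (ℕ → Bool)
        Xs = subsets 1 edges

        Ts : List (ℕ → Bool)
        Ts = subsets r S

        m₀ : Mem S w
        m₀ = init s₀ t₀

        mem : (ℕ → Bool) → Mem S w
        mem x = proj₂ (after D (initConfig D s₀ t₀) (marks x))

        prog : ℕ → ℕ → Prog S w ℕ
        prog y p = update (query y p)

        ys-< : ∀ {y} → y ∈ ys → y < Y
        ys-< = ∈-upTo⁻

        length-ys : length ys ≡ Y
        length-ys = length-upTo Y

        batch-< : ∀ {Q} → Q ∈ batches ys → ∀ {r} → r ∈ Q → proj₁ r < Y × proj₂ r < N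
        batch-< Q∈ r∈ = ys-< (subst (_ ∈_) (batches-sources ys Q∈) (∈-map⁺ proj₁ r∈)) , batches-targets ys Q∈ r∈

        batch-length : ∀ {Q} → Q ∈ batches ys → length Q ≡ Y
        batch-length {Q} Q∈ = trans (sym (length-map proj₁ Q)) (trans (cong length (batches-sources ys Q∈)) length-ys)

        changes-mem : ∀ {x} → x ∈ Xs → changes (mem x) m₀ ≤ edges * t
        changes-mem {x} x∈ = begin
          -- `query 0 0` is a stand-in: a cheap run that ends in some query contains a cheap run of
          -- the marks.
          changes (mem x) m₀                   ≤⟨ changes-after D t (s₀ , t₀) m₀ m₀ (marks x)
              (proj₁ (cheap-last D t (s₀ , t₀) m₀ (marks x) (query 0 0) (cheap x∈ (m^n>0 b G) (m^n>0 b (suc G))))) ⟩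
          changes m₀ m₀ + length (marks x) * t ≤⟨ +-mono-≤ (changes-self m₀) (*-monoˡ-≤ t (length-marks x)) ⟩
          edges * t ∎
          where open ≤-Reasoning

        few-reads : ∀ {x y p} → x ∈ Xs → y < Y → p < N → length (reads (prog y p) (mem x)) ≤ t
        few-reads {x} {y} {p} x∈ y< p< = ≤-trans (length-reads≤cost (prog y p) (mem x))
          (proj₂ (cheap-last D t (s₀ , t₀) m₀ (marks x) (query y p) (cheap x∈ y< p<)))

        value-unmarked : ∀ {x y p} → y < Y → p < N → (∀ i → i < G → x (edge i y p) ≡ true) →
          value (prog y p) (mem x) ≤ G + 2
        value-unmarked {x} {y} {p} y< p< path = lcs-unmarked y< p< x path
          (correct-last D (s₀ , t₀) m₀ (marks x) (query y p) (correct s₀ t₀ (marks x ++ query y p ∷ [])))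

        value-marked : ∀ {x y p i} → y < Y → p < N → i < G → x (edge i y p) ≡ false →
          G + 3 ≤ value (prog y p) (mem x)
        value-marked {x} {y} {p} y< p< i<G xe = lcs-marked y< p< x i<G xe
          (correct-last D (s₀ , t₀) m₀ (marks x) (query y p) (correct s₀ t₀ (marks x ++ query y p ∷ [])))

        pathEdges : ℕ → ℕ → List ℕ
        pathEdges y p = map (λ i → edge i y p) (upTo G)

        pathReads : Mem S w → ℕ → ℕ → List ℕ
        pathReads m y p = map toℕ (reads (prog y p) m)

        good : Batch → (ℕ → Bool) → Bool
        good Q x = disjoint Q ∧ subset edges (elem (concatQ pathEdges Q)) x

        -- The first test makes the queries of Q answerable from the sample, the second makes the
        -- message an element of `patches m₀ cells`, up to pointwise equality.
        surv : (ℕ → Bool) → Batch → (ℕ → Bool) → Bool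
        surv T Q x = subset S (elem (concatQ (pathReads (mem x)) Q)) T ∧
          ⌊ count S (differs (mem x) m₀ ∩ T) ≤? cells ⌋

        disjoints : ℕ
        disjoints = ∑ (batches ys) (λ Q → ⟦ disjoint Q ⟧)

        -- The paths of a batch have at most `Y * G` edges in all, and each edge is unmarked with
        -- probability 1/2.
        good-many : disjoints * 2 ^ edges ≤ 2 ^ (Y * G) * ∑ (batches ys) (λ Q → ∑ Xs (λ x → ⟦ good Q x ⟧))
        good-many = begin
          disjoints * 2 ^ edges  ≡⟨ sym (∑-*ʳ (batches ys) (2 ^ edges) _) ⟩
          ∑ (batches ys) (λ Q → ⟦ disjoint Q ⟧ * 2 ^ edges)  ≤⟨ ∑-mono (batches ys) per-batch ⟩
          ∑ (batches ys) (λ Q → 2 ^ (Y * G) * ∑ Xs (λ x → ⟦ good Q x ⟧)) ≡⟨ ∑-*ˡ (batches ys) (2 ^ (Y * G)) _ ⟩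
          _ ∎
          where
          open ≤-Reasoning
          per-batch : ∀ {Q} → Q ∈ batches ys → ⟦ disjoint Q ⟧ * 2 ^ edges ≤ 2 ^ (Y * G) * ∑ Xs (λ x → ⟦ good Q x ⟧)
          per-batch {Q} Q∈ = begin
            ⟦ disjoint Q ⟧ * 2 ^ edges ≡⟨ cong (⟦ disjoint Q ⟧ *_) (sym (supersets-count 1 edges E)) ⟩
            ⟦ disjoint Q ⟧ * (2 ^ count edges E * supersets 1 edges E)
              ≤⟨ *-monoʳ-≤ ⟦ disjoint Q ⟧ (*-monoˡ-≤ (supersets 1 edges E) (^-monoʳ-≤ 2 size)) ⟩
            ⟦ disjoint Q ⟧ * (2 ^ (Y * G) * supersets 1 edges E)
              ≡⟨ solve 3 (λ x y z → x :* (y :* z) := y :* (x :* z)) refl ⟦ disjoint Q ⟧ (2 ^ (Y * G)) (supersets 1 edges E) ⟩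
            2 ^ (Y * G) * (⟦ disjoint Q ⟧ * supersets 1 edges E)
              ≡⟨ cong (2 ^ (Y * G) *_) (trans (sym (∑-*ˡ Xs ⟦ disjoint Q ⟧ _)) (∑-cong Xs (λ x → sym (⟦∧⟧ (disjoint Q) _)))) ⟩
            2 ^ (Y * G) * ∑ Xs (λ x → ⟦ good Q x ⟧) ∎
            where
            E : ℕ → Bool
            E = elem (concatQ pathEdges Q)
            size : count edges E ≤ Y * G
            size = ≤-trans (count-elem edges (concatQ pathEdges Q))
              (≤-trans (length-concatQ pathEdges G Q (λ {y} {p} _ → ≤-reflexive (trans (length-map (λ i → edge i y p) (upTo G)) (length-upTo G))))
                (≤-reflexive (cong (_* G) (batch-length Q∈))))

        module A = Averaging (batches ys) Xs Ts good surv

        Best : Set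
        Best = ∃ λ T → ∑ (batches ys) (λ Q → ∑ Xs (λ x → ⟦ good Q x ⟧)) ≤ 2 * suc r ^ (Y * t) * A.survivors T

        best : Best
        best = A.best (2 * suc r ^ (Y * t)) (subst (0 <_) (sym (length-subsets r S)) (m^n>0 (suc r) S))
          λ {Q} {x} Q∈ x∈ → ≤-trans (≤-reflexive (length-subsets r S))
            (≤-trans (sampling r S _ (differs (mem x) m₀) (Y * t) ω (size Q∈ x∈) (≤-trans (changes-mem x∈) fewWrites))
              (≤-reflexive (sym (*-assoc 2 (suc r ^ (Y * t)) _))))
          where
          size : ∀ {Q x} → Q ∈ batches ys → x ∈ Xs → count S (elem (concatQ (pathReads (mem x)) Q)) ≤ Y * t
          size {Q} {x} Q∈ x∈ = ≤-trans (count-elem S (concatQ (pathReads (mem x)) Q))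
            (≤-trans (length-concatQ (pathReads (mem x)) t Q (λ {y} {p} r∈ →
                ≤-trans (≤-reflexive (length-map toℕ (reads (prog y p) (mem x))))
                  (few-reads x∈ (proj₁ (batch-< Q∈ r∈)) (proj₂ (batch-< Q∈ r∈)))))
              (≤-reflexive (cong (_* t) (batch-length Q∈))))

      module Bounded (T : ℕ → Bool) where

        private
          -- Depends on the message m and the sample only, not on the data x; so does everything
          -- derived from it, such as `covered` and the heavy vertices.
          ok : Mem S w → ℕ → ℕ → Bool
          ok m y p = subset S (elem (pathReads m y p)) T ∧ ⌊ value (prog y p) m ≤? G + 2 ⌋

          okEdges : Mem S w → ℕ → ℕ → List ℕ
          okEdges m y p = guard (ok m y p) (pathEdges y p)

          allPaths : Batch
          allPaths = pairs ys (upTo N)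

          covered : Mem S w → ℕ → Bool
          covered m = elem (concatQ (okEdges m) allPaths)

          module C m = Covered K 1≤K (covered m)

          within : ∀ m y p → subset S (elem (pathReads m y p)) T ≡ true → Within T (reads (prog y p) m)
          within m y p h {a} a∈ = subset-elim S _ T h (toℕ a) (toℕ<n a) (elem-∈ (∈-map⁺ toℕ a∈))

          -- A message makes no false claims: an accepted run reads only cells where m and the true
          -- memory agree, so the data structure itself answers at most `G + 2`, whereas a marked
          -- edge on the path would force `G + 3`.
          covered-⊆ : ∀ {m x} → Agree T m (mem x) → subset edges (covered m) x ≡ true
          covered-⊆ {m} {x} agree = subset-intro edges (covered m) x λ e _ c → on (x e) refl (find e c)
            where
            Found : ℕ → Set
            Found e = ∃ λ y → ∃ λ p → ∃ λ i → y < Y × p < N × i < G × ok m y p ≡ true × e ≡ edge i y p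
            find : ∀ e → covered m e ≡ true → Found e
            find e c =
              let y , p , yp∈ , e∈ = concatQ-∈ (okEdges m) allPaths (∈-elem (concatQ (okEdges m) allPaths) c)
                  o , e∈' = guard-∈ (ok m y p) e∈
                  i , i∈ , q = ∈-map⁻ (λ i → edge i y p) e∈'
                  y∈ , p∈ = pairs-∈ ys (upTo N) yp∈
              in y , p , i , ys-< y∈ , ∈-upTo⁻ p∈ , ∈-upTo⁻ i∈ , o , q
            on : ∀ {e} c → x e ≡ c → Found e → x e ≡ true
            on true q _ = q
            on false q (y , p , i , y< , p< , i<G , o , refl) = ⊥-elim (<⇒≱ small (value-marked {x} y< p< i<G q))
              where
              o' : subset S (elem (pathReads m y p)) T ≡ true × ⌊ value (prog y p) m ≤? G + 2 ⌋ ≡ true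
              o' = ∧-elim (subset S (elem (pathReads m y p)) T) o
              small : value (prog y p) (mem x) < G + 3
              small = subst₂ _<_ (proj₁ (run-agree T (prog y p) m (mem x) agree (within m y p (proj₁ o'))))
                (sym (+-suc G 2)) (s≤s (≤?-elim (proj₂ o')))

          inside-covered : ∀ {m y p} → y < Y → p < N → ok m y p ≡ true → C.inside m y p ≡ true
          inside-covered {m} {y} {p} y< p< o = every-intro G _ λ i i<G → elem-∈
            (∈-concatQ (∈-pairs (∈-upTo⁺ y<) (∈-upTo⁺ p<)) (∈-guard o (∈-map⁺ (λ i → edge i y p) (∈-upTo⁺ i<G))))

          -- The true run on an unmarked path stays in the sample, and `run-agree` transfers its
          -- value and its reads to m; so the message accepts all paths of a surviving batch.
          ok-survives : ∀ {m x Q} → Agree T (mem x) m → Q ∈ batches ys → good Q x ≡ true →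
            subset S (elem (concatQ (pathReads (mem x)) Q)) T ≡ true →
            ∀ {y p} → (y , p) ∈ Q → ok m y p ≡ true
          ok-survives {m} {x} {Q} agree Q∈ g s {y} {p} yp∈ = ∧-intro
            (subst (λ l → subset S (elem (map toℕ l)) T ≡ true) (proj₂ same) reads⊆T)
            (≤?-true (subst (_≤ G + 2) (proj₁ same) (value-unmarked {x} y< p< path)))
            where
            y< : y < Y
            y< = proj₁ (batch-< Q∈ yp∈)
            p< : p < N
            p< = proj₂ (batch-< Q∈ yp∈)
            reads⊆T : subset S (elem (pathReads (mem x) y p)) T ≡ true
            reads⊆T = subset-intro S _ T λ i i< c → subset-elim S _ T s i i<
              (elem-∈ (∈-concatQ yp∈ (∈-elem (pathReads (mem x) y p) c)))
            path : ∀ i → i < G → x (edge i y p) ≡ true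
            path i i<G = subset-elim edges _ x (proj₂ (∧-elim (disjoint Q) g)) (edge i y p) (edge-< i<G y< p<)
              (elem-∈ (∈-concatQ yp∈ (∈-map⁺ (λ i → edge i y p) (∈-upTo⁺ i<G))))
            same : value (prog y p) (mem x) ≡ value (prog y p) m × reads (prog y p) (mem x) ≡ reads (prog y p) m
            same = run-agree T (prog y p) (mem x) m agree (within (mem x) y p reads⊆T)

          insideQ-intro : ∀ {m} Q → (∀ {y p} → (y , p) ∈ Q → C.inside m y p ≡ true) → C.insideQ m Q ≡ true
          insideQ-intro [] h = refl
          insideQ-intro ((y , p) ∷ Q) h = ∧-intro (h (here refl)) (insideQ-intro Q (h ∘ there))

          -- The exceptional event: m claims at least K unmarked out-edges at each of more than h
          -- vertices, and x is consistent with all claims of m.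
          large : Mem S w → (ℕ → Bool) → Bool
          large m x = ⌊ suc h ≤? C.heavies m ⌋ ∧ subset edges (covered m) x

          few : ∀ m → C.heavies m ≤ h → ∑ (batches ys) (λ Q → ⟦ disjoint Q ∧ C.insideQ m Q ⟧) ≤ U
          few m hv = *-cancelʳ-≤ _ U (b ^ (Y * G ∸ h)) {{m^n≢0 b (Y * G ∸ h)}} (≤-trans
            (subst (λ l → ∑ (batches ys) (λ Q → ⟦ disjoint Q ∧ C.insideQ m Q ⟧) * b ^ (l * G ∸ h) ≤ (b * (K * b) ^ G) ^ l)
              length-ys (C.few-inside m ys h ys-< hv)) fewInside)

          -- If too many changed cells are kept, nothing survives. Otherwise x has a message m among
          -- the patches. If m has at most h heavy vertices, the surviving batches lie inside its
          -- covered part, and `few` counts them; if not, m is `large` for x, and its term in the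
          -- sum pays for all disjoint batches.
          per-input : ∀ x → ∑ (batches ys) (λ Q → ⟦ good Q x ⟧ * ⟦ surv T Q x ⟧) ≤
            U + disjoints * ∑ (patches m₀ cells) (λ m → ⟦ large m x ⟧)
          per-input x = cases (count S (differs (mem x) m₀ ∩ T) ≤? cells)
            where
            open ≤-Reasoning
            L R : ℕ
            L = ∑ (batches ys) (λ Q → ⟦ good Q x ⟧ * ⟦ surv T Q x ⟧)
            R = U + disjoints * ∑ (patches m₀ cells) (λ m → ⟦ large m x ⟧)
            surv-cells : ∀ Q → surv T Q x ≡ true → count S (differs (mem x) m₀ ∩ T) ≤ cells
            surv-cells Q s = ≤?-elim (proj₂ (∧-elim (subset S (elem (concatQ (pathReads (mem x)) Q)) T) s))
            cases : Dec (count S (differs (mem x) m₀ ∩ T) ≤ cells) → L ≤ R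
            cases (no ¬q) = ≤-trans (∑-mono (batches ys) {g = λ _ → 0} (λ {Q} _ → ≤-trans (*-monoʳ-≤ ⟦ good Q x ⟧
                (⟦⟧-imp {surv T Q x} {false} (λ s → ⊥-elim (¬q (surv-cells Q s))))) (≤-reflexive (*-zeroʳ ⟦ good Q x ⟧))))
              (≤-trans (≤-reflexive (trans (∑-const (batches ys) 0) (*-zeroʳ (length (batches ys))))) z≤n)
            cases (yes q) = patched (patches-complete m₀ cells (mix T (mem x) m₀) (≤-trans (changes-mix T (mem x) m₀) q))
              where
              patched : (∃ λ m → m ∈ patches m₀ cells × (∀ a → m a ≡ mix T (mem x) m₀ a)) → L ≤ R
              patched (m , m∈ , eq) = split (C.heavies m ≤? h)
                where
                agree : Agree T (mem x) m
                agree a Ta = trans (mix-agree T (mem x) m₀ a Ta) (sym (eq a))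
                term : ∀ {Q} → Q ∈ batches ys → ⟦ good Q x ⟧ * ⟦ surv T Q x ⟧ ≤ ⟦ disjoint Q ∧ C.insideQ m Q ⟧
                term {Q} Q∈ = ≤-trans (≤-reflexive (sym (⟦∧⟧ (good Q x) (surv T Q x)))) (⟦⟧-imp λ gs →
                  let g , s = ∧-elim (good Q x) gs in
                  ∧-intro (proj₁ (∧-elim (disjoint Q) g)) (insideQ-intro {m} Q λ yp∈ →
                    inside-covered {m} (proj₁ (batch-< Q∈ yp∈)) (proj₂ (batch-< Q∈ yp∈))
                      (ok-survives {m} {x} {Q} agree Q∈ g
                        (proj₁ (∧-elim (subset S (elem (concatQ (pathReads (mem x)) Q)) T) s)) yp∈)))
                split : Dec (C.heavies m ≤ h) → L ≤ R
                split (yes hv) = ≤-trans (∑-mono (batches ys) term) (≤-trans (few m hv) (m≤m+n U _))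
                split (no ¬hv) = begin
                  L ≤⟨ ∑-mono (batches ys) term ⟩
                  ∑ (batches ys) (λ Q → ⟦ disjoint Q ∧ C.insideQ m Q ⟧)
                    ≤⟨ ∑-mono (batches ys) (λ {Q} _ → ⟦⟧-imp (λ d → proj₁ (∧-elim (disjoint Q) d))) ⟩
                  disjoints       ≡⟨ sym (*-identityʳ disjoints) ⟩
                  disjoints * 1   ≡⟨ cong (λ c → disjoints * ⟦ c ⟧) (sym (∧-intro (≤?-true (≰⇒> ¬hv))
                                       (covered-⊆ {m} {x} (λ a Ta → sym (agree a Ta))))) ⟩
                  disjoints * ⟦ large m x ⟧ ≤⟨ *-monoʳ-≤ disjoints (∑-member (λ m → ⟦ large m x ⟧) m∈) ⟩
                  disjoints * ∑ (patches m₀ cells) (λ m → ⟦ large m x ⟧) ≤⟨ m≤n+m _ U ⟩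
                  R ∎

          -- More than h heavy vertices force at least `K * h` covered edges, each of which is
          -- unmarked in a random x with probability 1/2, independently.
          large-rare : ∀ m → 2 ^ (K * h) * ∑ Xs (λ x → ⟦ large m x ⟧) ≤ 2 ^ edges
          large-rare m = cases (suc h ≤? C.heavies m)
            where
            open ≤-Reasoning
            cases : Dec (suc h ≤ C.heavies m) → 2 ^ (K * h) * ∑ Xs (λ x → ⟦ large m x ⟧) ≤ 2 ^ edges
            cases (yes hv) = begin
              2 ^ (K * h) * ∑ Xs (λ x → ⟦ large m x ⟧)
                ≤⟨ *-mono-≤ (^-monoʳ-≤ 2 (≤-trans (*-monoʳ-≤ K (<⇒≤ hv)) (C.heavies≤cov m)))
                     (∑-mono Xs (λ {x} _ → ⟦⟧-imp (λ l → proj₂ (∧-elim ⌊ suc h ≤? C.heavies m ⌋ l)))) ⟩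
              2 ^ count edges (covered m) * supersets 1 edges (covered m) ≡⟨ supersets-count 1 edges (covered m) ⟩
              2 ^ edges ∎
            cases (no ¬hv) = ≤-trans (*-monoʳ-≤ (2 ^ (K * h)) (∑-mono Xs {g = λ _ → 0} (λ {x} _ →
                ⟦⟧-imp {large m x} {false} (λ l → ⊥-elim (¬hv (≤?-elim (proj₁ (∧-elim ⌊ suc h ≤? C.heavies m ⌋ l))))))))
              (≤-trans (≤-reflexive (trans (cong (2 ^ (K * h) *_) (trans (∑-const Xs 0) (*-zeroʳ (length Xs)))) (*-zeroʳ (2 ^ (K * h))))) z≤n)

        survivors-few : 2 ^ (K * h) * A.survivors T ≤
          2 ^ edges * (2 ^ (K * h) * U + disjoints * (1 + S * 2 ^ w) ^ cells)
        survivors-few = begin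
          Z * A.survivors T  ≡⟨ cong (Z *_) (∑-swap (batches ys) Xs _) ⟩
          Z * ∑ Xs (λ x → ∑ (batches ys) (λ Q → ⟦ good Q x ⟧ * ⟦ surv T Q x ⟧))
            ≤⟨ *-monoʳ-≤ Z (∑-mono Xs (λ {x} _ → per-input x)) ⟩
          Z * ∑ Xs (λ x → U + disjoints * ∑ ms (λ m → ⟦ large m x ⟧))
            ≡⟨ cong (Z *_) (trans (∑-+ Xs (λ _ → U) _) (cong₂ _+_
                 (trans (∑-const Xs U) (cong (_* U) (length-subsets 1 edges)))
                 (trans (∑-*ˡ Xs disjoints _) (cong (disjoints *_) (∑-swap Xs ms _))))) ⟩
          Z * (2 ^ edges * U + disjoints * ∑ ms (λ m → ∑ Xs (λ x → ⟦ large m x ⟧)))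
            ≡⟨ solve 5 (λ z e u d s → z :* (e :* u :+ d :* s) := e :* (z :* u) :+ d :* (z :* s)) refl
                 Z (2 ^ edges) U disjoints (∑ ms (λ m → ∑ Xs (λ x → ⟦ large m x ⟧))) ⟩
          2 ^ edges * (Z * U) + disjoints * (Z * ∑ ms (λ m → ∑ Xs (λ x → ⟦ large m x ⟧)))
            ≡⟨ cong (λ s → 2 ^ edges * (Z * U) + disjoints * s) (sym (∑-*ˡ ms Z _)) ⟩
          2 ^ edges * (Z * U) + disjoints * ∑ ms (λ m → Z * ∑ Xs (λ x → ⟦ large m x ⟧))
            ≤⟨ +-monoʳ-≤ (2 ^ edges * (Z * U)) (*-monoʳ-≤ disjoints (∑-bound ms (λ {m} _ → large-rare m))) ⟩
          2 ^ edges * (Z * U) + disjoints * (length ms * 2 ^ edges)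
            ≡⟨ cong (λ l → 2 ^ edges * (Z * U) + disjoints * (l * 2 ^ edges)) (length-patches m₀ cells) ⟩
          2 ^ edges * (Z * U) + disjoints * ((1 + S * 2 ^ w) ^ cells * 2 ^ edges)
            ≡⟨ solve 4 (λ e z d l → e :* z :+ d :* (l :* e) := e :* (z :+ d :* l)) refl
                 (2 ^ edges) (Z * U) disjoints ((1 + S * 2 ^ w) ^ cells) ⟩
          2 ^ edges * (Z * U + disjoints * (1 + S * 2 ^ w) ^ cells) ∎
          where
          open ≤-Reasoning
          Z : ℕ
          Z = 2 ^ (K * h)
          ms : List (Mem S w)
          ms = patches m₀ cells

      N^Y≤disjoints : N ^ Y ≤ 2 ^ Y * disjoints
      N^Y≤disjoints = subst (λ l → N ^ l ≤ 2 ^ l * disjoints) length-ys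
        (disjoint-many 2G≤b ys ys-< spread-all)

      -- Let c be the product in parentheses in both hypotheses. At least `disjoints * 2 ^ edges` /
      -- (2c) good pairs survive. The terms for U and for `large` messages each allow at most half
      -- of this, the first strictly less; hence both factors 4. A stands for `disjoints`, of which
      -- only the lower bound is known.
      contradiction :
        (∀ A → N ^ Y ≤ 2 ^ Y * A → 4 * (2 ^ (Y * G) * suc r ^ (Y * t)) * U < A) →
        4 * (2 ^ (Y * G) * suc r ^ (Y * t)) * (1 + S * 2 ^ w) ^ (Y * t + 2 * ω) ≤ 2 ^ (K * h) → ⊥
      contradiction small messages = conclude best
        where
        open ≤-Reasoning
        Z c # : ℕ
        Z = 2 ^ (K * h)
        c = 2 ^ (Y * G) * suc r ^ (Y * t)
        # = (1 + S * 2 ^ w) ^ cells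
        U-small : 4 * c * U < disjoints
        U-small = small disjoints N^Y≤disjoints
        conclude : Best → ⊥
        conclude (T , bst) = <-irrefl refl (begin-strict
          2 * (Z * disjoints)                   ≤⟨ *-monoʳ-≤ 2 (*-cancelʳ-≤ (Z * disjoints) (2 * c * (Z * U + disjoints * #)) (2 ^ edges) {{m^n≢0 2 edges}} bound) ⟩
          2 * (2 * c * (Z * U + disjoints * #)) ≡⟨ solve 5 (λ c z u d l → con 2 :* (con 2 :* c :* (z :* u :+ d :* l)) := con 4 :* c :* u :* z :+ con 4 :* c :* l :* d) refl c Z U disjoints # ⟩
          4 * c * U * Z + 4 * c * # * disjoints <⟨ +-mono-<-≤ (*-monoˡ-< Z {{m^n≢0 2 (K * h)}} U-small) (*-monoˡ-≤ disjoints messages) ⟩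
          disjoints * Z + Z * disjoints         ≡⟨ solve 2 (λ d z → d :* z :+ z :* d := con 2 :* (z :* d)) refl disjoints Z ⟩
          2 * (Z * disjoints) ∎)
          where
          bound : Z * disjoints * 2 ^ edges ≤ 2 * c * (Z * U + disjoints * #) * 2 ^ edges
          bound = begin
            Z * disjoints * 2 ^ edges ≡⟨ *-assoc Z disjoints (2 ^ edges) ⟩
            Z * (disjoints * 2 ^ edges) ≤⟨ *-monoʳ-≤ Z good-many ⟩
            Z * (2 ^ (Y * G) * ∑ (batches ys) (λ Q → ∑ Xs (λ x → ⟦ good Q x ⟧)))
              ≤⟨ *-monoʳ-≤ Z (*-monoʳ-≤ (2 ^ (Y * G)) bst) ⟩
            Z * (2 ^ (Y * G) * (2 * suc r ^ (Y * t) * A.survivors T))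
              ≡⟨ solve 4 (λ z a b s → z :* (a :* (con 2 :* b :* s)) := con 2 :* (a :* b) :* (z :* s)) refl
                   Z (2 ^ (Y * G)) (suc r ^ (Y * t)) (A.survivors T) ⟩
            2 * c * (Z * A.survivors T) ≤⟨ *-monoʳ-≤ (2 * c) (Bounded.survivors-few T) ⟩
            2 * c * (2 ^ edges * (Z * U + disjoints * #))
              ≡⟨ solve 3 (λ c e s → c :* (e :* s) := c :* s :* e) refl (2 * c) (2 ^ edges) (Z * U + disjoints * #) ⟩
            2 * c * (Z * U + disjoints * #) * 2 ^ edges ∎

-- Parameters

2^log≤ : ∀ n → 1 ≤ n → 2 ^ ⌊log₂ n ⌋ ≤ n
2^log≤ n = go n (<-wellFounded n)
  where
  open ≤-Reasoning
  go : ∀ n → Acc _<_ n → 1 ≤ n → 2 ^ ⌊log₂ n ⌋ ≤ n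
  go (suc zero) _ _ = ≤-refl
  go n@(suc (suc m)) (acc rs) _ = begin
    2 ^ ⌊log₂ n ⌋             ≤⟨ ^-monoʳ-≤ 2 (m≤n+m∸n ⌊log₂ n ⌋ 1) ⟩
    2 ^ suc (⌊log₂ n ⌋ ∸ 1)   ≡⟨ cong (λ l → 2 ^ suc l) (sym (⌊log₂⌊n/2⌋⌋≡⌊log₂n⌋∸1 n)) ⟩
    2 * 2 ^ ⌊log₂ ⌊ n /2⌋ ⌋   ≤⟨ *-monoʳ-≤ 2 (go ⌊ n /2⌋ (rs (⌊n/2⌋<n (suc m))) (s≤s z≤n)) ⟩
    2 * ⌊ n /2⌋               ≡⟨ cong (⌊ n /2⌋ +_) (+-identityʳ ⌊ n /2⌋) ⟩
    ⌊ n /2⌋ + ⌊ n /2⌋         ≤⟨ +-monoʳ-≤ ⌊ n /2⌋ (⌊n/2⌋≤⌈n/2⌉ n) ⟩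
    ⌊ n /2⌋ + ⌈ n /2⌉         ≡⟨ ⌊n/2⌋+⌈n/2⌉≡n n ⟩
    n ∎

<2^log : ∀ n → n < 2 ^ suc ⌊log₂ n ⌋
<2^log n = ≰⇒> λ le → 1+n≰n (subst (_≤ ⌊log₂ n ⌋) (⌊log₂[2^n]⌋≡n (suc ⌊log₂ n ⌋)) (⌊log₂⌋-mono-≤ le))

n≤2^n : ∀ n → n ≤ 2 ^ n
n≤2^n zero = z≤n
n≤2^n (suc n) = ≤-trans (+-mono-≤ (m^n>0 2 n) (n≤2^n n)) (≤-reflexive (cong (2 ^ n +_) (sym (+-identityʳ (2 ^ n)))))

-- The start is 512 * 13 = 6656 against 2^13 = 8192. With g = log log n at least 13 this makes log n
-- / (512 g) at least 1.
512n≤2^n : ∀ j → 512 * (13 + j) ≤ 2 ^ (13 + j)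
512n≤2^n zero = toWitness {a? = 512 * 13 ≤? 2 ^ 13} _
512n≤2^n (suc j) = begin
  512 * (13 + suc j)        ≡⟨ solve 1 (λ j → con 512 :* (con 13 :+ (con 1 :+ j)) := con 512 :* (con 13 :+ j) :+ con 512) refl j ⟩
  512 * (13 + j) + 512      ≤⟨ +-mono-≤ (512n≤2^n j) (≤-trans (*-monoʳ-≤ 512 {1} {13 + j} (s≤s z≤n)) (512n≤2^n j)) ⟩
  2 ^ (13 + j) + 2 ^ (13 + j) ≡⟨ cong (2 ^ (13 + j) +_) (sym (+-identityʳ (2 ^ (13 + j)))) ⟩
  2 * 2 ^ (13 + j)          ≡⟨ cong (2 ^_) (sym (+-suc 13 j)) ⟩
  2 ^ (13 + suc j) ∎
  where open ≤-Reasoning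

pow-pow : ∀ a m → (2 ^ a) ^ m ≡ 2 ^ (a * m)
pow-pow = ^-*-assoc 2

pow-* : ∀ a c → 2 ^ a * 2 ^ c ≡ 2 ^ (a + c)
pow-* a c = sym (^-distribˡ-+-* 2 a c)

-- In the application lg is log n and g is log log n, so `2 ^ g` equals log n up to a factor 2, and
-- b is about its eighth power. K is the square root of b, and P = b² is the inverse sampling rate.
-- G is a multiple of 8 so that h can be `Y * G'`, an eighth of the `Y * G` visits of a batch to
-- vertices.
module Parameters (g G' t κ lg b K P : ℕ)
  (eb : b ≡ 2 ^ (8 * g)) (eK : K ≡ 2 ^ (4 * g)) (eP : P ≡ 2 ^ (16 * g))
  (1≤g : 1 ≤ g) (1≤G' : 1 ≤ G') (2t≤G' : 2 * t ≤ G') (G'≤lg : 512 * g * G' ≤ lg)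
  (g≤lg : g ≤ lg) (t≤lg : t ≤ lg) (lg≤ : lg ≤ 2 * 2 ^ g) (κ≤ : 4 * (26 + 17 * κ) ≤ 2 ^ g) where

  open ≤-Reasoning

  G : ℕ
  G = 8 * G'

  b^ : ∀ m → b ^ m ≡ 2 ^ (8 * g * m)
  b^ m = trans (cong (_^ m) eb) (pow-pow (8 * g) m)

  -- Exponents of b per path: the base on the left has 1 + 12 G', since `K * b` is b^(3/2) and G is
  -- 8 G'. On average at least 7 G' visits are light, so 1 + 5 G' remains.
  few-inside-bound : ∀ Y → (b * (K * b) ^ G) ^ Y ≤ 2 ^ (Y * (8 * g + 40 * g * G')) * b ^ (Y * G ∸ Y * G')
  few-inside-bound Y = ≤-reflexive (trans lhs (trans (cong (2 ^_) expo) (sym rhs)))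
    where
    lhs : (b * (K * b) ^ G) ^ Y ≡ 2 ^ ((8 * g + (4 * g + 8 * g) * G) * Y)
    lhs = trans (cong (_^ Y) (trans (cong₂ _*_ eb (trans (cong (_^ G) (trans (cong₂ _*_ eK eb) (pow-* (4 * g) (8 * g))))
        (pow-pow (4 * g + 8 * g) G))) (pow-* (8 * g) ((4 * g + 8 * g) * G)))) (pow-pow (8 * g + (4 * g + 8 * g) * G) Y)
    diff : Y * G ∸ Y * G' ≡ 7 * (Y * G')
    diff = trans (cong (_∸ Y * G') (solve 2 (λ y g → y :* (con 8 :* g) := con 7 :* (y :* g) :+ y :* g) refl Y G'))
      (m+n∸n≡m (7 * (Y * G')) (Y * G'))
    rhs : 2 ^ (Y * (8 * g + 40 * g * G')) * b ^ (Y * G ∸ Y * G') ≡ 2 ^ (Y * (8 * g + 40 * g * G') + 8 * g * (7 * (Y * G')))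
    rhs = trans (cong (2 ^ (Y * (8 * g + 40 * g * G')) *_) (trans (cong (b ^_) diff) (b^ (7 * (Y * G'))))) (pow-* (Y * (8 * g + 40 * g * G')) (8 * g * (7 * (Y * G'))))
    expo : (8 * g + (4 * g + 8 * g) * G) * Y ≡ Y * (8 * g + 40 * g * G') + 8 * g * (7 * (Y * G'))
    expo = solve 3 (λ g g' y → (con 8 :* g :+ (con 4 :* g :+ con 8 :* g) :* (con 8 :* g')) :* y :=
      y :* (con 8 :* g :+ con 40 :* g :* g') :+ con 8 :* g :* (con 7 :* (y :* g'))) refl g G' Y

  -- The number of edges is `G * Y` times b², and b² is the inverse sampling rate, so at most
  -- `G * Y * t` changed cells are kept on average.
  few-writes-bound : ∀ {Y} → Y ≡ b ^ G → G * b ^ suc G * b * t ≤ P * (G * Y * t)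
  few-writes-bound refl = ≤-reflexive (trans
    (solve 4 (λ g b y t → g :* (b :* y) :* b :* t := (b :* b) :* (g :* y :* t)) refl G b (b ^ G) t)
    (cong (_* (G * b ^ G * t)) (trans (cong₂ _*_ eb eb) (trans (pow-* (8 * g) (8 * g))
      (trans (cong (2 ^_) (solve 1 (λ g → con 8 :* g :+ con 8 :* g := con 16 :* g) refl g)) (sym eP))))))

  module _ (Y : ℕ) (1≤Y : 1 ≤ Y) where

    private
      v : ℕ
      v = Y * G'
      Y≤v : Y ≤ v
      Y≤v = ≤-trans (≤-reflexive (sym (*-identityʳ Y))) (*-monoʳ-≤ Y 1≤G')
      1≤v : 1 ≤ v
      1≤v = ≤-trans 1≤Y Y≤v

    probes-exponent : 2 ^ (Y * G) * P ^ (Y * t) ≡ 2 ^ (Y * G + 16 * g * (Y * t))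
    probes-exponent = trans (cong (2 ^ (Y * G) *_) (trans (cong (_^ (Y * t)) eP) (pow-pow (16 * g) (Y * t))))
      (pow-* (Y * G) (16 * g * (Y * t)))

    -- Exponents of b per path: all choices make 1 + 8 G', those inside 1 + 5 G', and survival costs
    -- 2 t, at most G'. The remaining gap of 2 G' is a factor 2^(16 g G'), enough for the powers of
    -- two that come from disjointness, from unmarked edges and from the factor 4.
    inside-rare : ∀ A → (b ^ suc G) ^ Y ≤ 2 ^ Y * A →
      4 * (2 ^ (Y * G) * P ^ (Y * t)) * 2 ^ (Y * (8 * g + 40 * g * G')) < A
    inside-rare A A≥ = *-cancelˡ-< (2 ^ Y) _ _ (<-≤-trans (begin-strict
      2 ^ Y * (4 * (2 ^ (Y * G) * P ^ (Y * t)) * 2 ^ u)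
        ≡⟨ cong (λ z → 2 ^ Y * (4 * z * 2 ^ u)) probes-exponent ⟩
      2 ^ Y * (2 ^ 2 * 2 ^ z * 2 ^ u) ≡⟨ cong (2 ^ Y *_) (trans (cong (_* 2 ^ u) (pow-* 2 z)) (pow-* (2 + z) u)) ⟩
      2 ^ Y * 2 ^ (2 + z + u)         ≡⟨ pow-* Y (2 + z + u) ⟩
      2 ^ (Y + (2 + z + u))           <⟨ ^-monoʳ-< 2 (s≤s (s≤s z≤n)) expo ⟩
      2 ^ (8 * g * suc G * Y)         ≡⟨ sym (trans (cong (_^ Y) (b^ (suc G))) (pow-pow (8 * g * suc G) Y)) ⟩
      (b ^ suc G) ^ Y ∎) A≥)
      where
      u z : ℕ
      u = Y * (8 * g + 40 * g * G')
      z = Y * G + 16 * g * (Y * t)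
      expo : Y + (2 + z + u) < 8 * g * suc G * Y
      expo = begin
        suc (Y + (2 + z + u))
          ≡⟨ solve 4 (λ g g' y t → con 1 :+ (y :+ (con 2 :+ (y :* (con 8 :* g') :+ con 16 :* g :* (y :* t)) :+ y :* (con 8 :* g :+ con 40 :* g :* g')))
               := (y :+ con 3 :+ con 8 :* (y :* g')) :+ (con 8 :* (g :* y) :* (con 2 :* t) :+ (con 8 :* (g :* y) :+ con 40 :* (g :* (y :* g'))))) refl g G' Y t ⟩
        (Y + 3 + 8 * v) + (8 * (g * Y) * (2 * t) + (8 * (g * Y) + 40 * (g * v)))
          ≤⟨ +-mono-≤ (+-monoˡ-≤ (8 * v) (+-mono-≤ Y≤v (*-monoʳ-≤ 3 1≤v)))
               (+-monoˡ-≤ _ (*-monoʳ-≤ (8 * (g * Y)) 2t≤G')) ⟩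
        (v + 3 * v + 8 * v) + (8 * (g * Y) * G' + (8 * (g * Y) + 40 * (g * v)))
          ≡⟨ solve 3 (λ g g' y → (y :* g' :+ con 3 :* (y :* g') :+ con 8 :* (y :* g')) :+ (con 8 :* (g :* y) :* g' :+ (con 8 :* (g :* y) :+ con 40 :* (g :* (y :* g'))))
               := con 12 :* (y :* g') :+ (con 48 :* (g :* (y :* g')) :+ con 8 :* (g :* y))) refl g G' Y ⟩
        12 * v + (48 * (g * v) + 8 * (g * Y))
          ≤⟨ +-monoˡ-≤ _ (*-mono-≤ (m≤m+n 12 4) (≤-trans (≤-reflexive (sym (*-identityˡ v))) (*-monoˡ-≤ v 1≤g))) ⟩
        16 * (g * v) + (48 * (g * v) + 8 * (g * Y))
          ≡⟨ solve 3 (λ g g' y → con 16 :* (g :* (y :* g')) :+ (con 48 :* (g :* (y :* g')) :+ con 8 :* (g :* y)) := con 8 :* g :* (con 1 :+ con 8 :* g') :* y) refl g G' Y ⟩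
        8 * g * suc G * Y ∎

    -- A message consists of at most `17 * v * lg` changes of `κ * lg` bits each, against `K * v`
    -- known edges. K is the fourth power of `2 ^ g`: two factors absorb `lg * lg`, a third the
    -- constants. The 26 is 2 + 8 + 16, from the factor 4, the unmarked edges and the sampling rate.
    messages-few : ∀ M → M ≤ 2 ^ (κ * lg) →
      4 * (2 ^ (Y * G) * P ^ (Y * t)) * M ^ (Y * t + 2 * (G * Y * t)) ≤ 2 ^ (K * (Y * G'))
    messages-few M M≤ = begin
      4 * (2 ^ (Y * G) * P ^ (Y * t)) * M ^ c ≤⟨ *-mono-≤ (≤-reflexive (cong (4 *_) probes-exponent)) (^-monoˡ-≤ c M≤) ⟩
      2 ^ 2 * 2 ^ z * (2 ^ (κ * lg)) ^ c     ≡⟨ cong₂ _*_ (pow-* 2 z) (pow-pow (κ * lg) c) ⟩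
      2 ^ (2 + z) * 2 ^ (κ * lg * c)         ≡⟨ pow-* (2 + z) (κ * lg * c) ⟩
      2 ^ (2 + z + κ * lg * c)               ≤⟨ ^-monoʳ-≤ 2 expo ⟩
      2 ^ (K * v) ∎
      where
      c z : ℕ
      c = Y * t + 2 * (G * Y * t)
      z = Y * G + 16 * g * (Y * t)
      1≤lg : 1 ≤ lg
      1≤lg = ≤-trans 1≤g g≤lg
      v≤vll : v ≤ v * (lg * lg)
      v≤vll = ≤-trans (≤-reflexive (sym (*-identityʳ v))) (*-monoʳ-≤ v (*-mono-≤ 1≤lg 1≤lg))
      gYt : g * (Y * t) ≤ v * (lg * lg)
      gYt = ≤-trans (*-mono-≤ g≤lg (*-mono-≤ Y≤v t≤lg))
        (≤-reflexive (solve 2 (λ l v → l :* (v :* l) := v :* (l :* l)) refl lg v))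
      lgc : lg * c ≤ 17 * (v * (lg * lg))
      lgc = begin
        lg * (Y * t + 2 * (G * Y * t))
          ≡⟨ solve 4 (λ l y t g' → l :* (y :* t :+ con 2 :* (con 8 :* g' :* y :* t)) := l :* ((y :+ con 16 :* (y :* g')) :* t)) refl lg Y t G' ⟩
        lg * ((Y + 16 * v) * t) ≤⟨ *-monoʳ-≤ lg (*-mono-≤ (+-monoˡ-≤ (16 * v) Y≤v) t≤lg) ⟩
        lg * ((v + 16 * v) * lg) ≡⟨ solve 2 (λ l v → l :* ((v :+ con 16 :* v) :* l) := con 17 :* (v :* (l :* l))) refl lg v ⟩
        17 * (v * (lg * lg)) ∎
      q : ℕ
      q = 2 ^ g
      K-eq : q * (q * (q * q)) ≡ K
      K-eq = trans (trans (cong (q *_) (trans (cong (q *_) (pow-* g g)) (pow-* g (g + g)))) (pow-* g (g + (g + g))))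
        (trans (cong (2 ^_) (solve 1 (λ g → g :+ (g :+ (g :+ g)) := con 4 :* g) refl g)) (sym eK))
      expo : 2 + z + κ * lg * c ≤ K * v
      expo = begin
        2 + z + κ * lg * c
          ≡⟨ solve 7 (λ g g' y t κ l c → con 2 :+ (y :* (con 8 :* g') :+ con 16 :* g :* (y :* t)) :+ κ :* l :* c
               := con 2 :+ con 8 :* (y :* g') :+ con 16 :* (g :* (y :* t)) :+ κ :* (l :* c)) refl g G' Y t κ lg c ⟩
        2 + 8 * v + 16 * (g * (Y * t)) + κ * (lg * c)
          ≤⟨ +-mono-≤ (+-mono-≤ (+-mono-≤ (*-monoʳ-≤ 2 (≤-trans 1≤v v≤vll)) (*-monoʳ-≤ 8 v≤vll)) (*-monoʳ-≤ 16 gYt)) (*-monoʳ-≤ κ lgc) ⟩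
        2 * V + 8 * V + 16 * V + κ * (17 * V)
          ≡⟨ solve 2 (λ V κ → con 2 :* V :+ con 8 :* V :+ con 16 :* V :+ κ :* (con 17 :* V) := (con 26 :+ con 17 :* κ) :* V) refl V κ ⟩
        (26 + 17 * κ) * (v * (lg * lg)) ≤⟨ *-monoʳ-≤ (26 + 17 * κ) (*-monoʳ-≤ v (*-mono-≤ lg≤ lg≤)) ⟩
        (26 + 17 * κ) * (v * (2 * q * (2 * q)))
          ≡⟨ solve 3 (λ κ v q → κ :* (v :* (con 2 :* q :* (con 2 :* q))) := con 4 :* κ :* (v :* (q :* q))) refl (26 + 17 * κ) v q ⟩
        4 * (26 + 17 * κ) * (v * (q * q)) ≤⟨ *-monoˡ-≤ (v * (q * q)) κ≤ ⟩
        q * (v * (q * q))   ≤⟨ *-monoˡ-≤ (v * (q * q)) (≤-trans (≤-reflexive (sym (*-identityʳ q))) (*-monoʳ-≤ q (m^n>0 2 g))) ⟩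
        q * q * (v * (q * q)) ≡⟨ solve 2 (λ q v → q :* q :* (v :* (q :* q)) := q :* (q :* (q :* q)) :* v) refl q v ⟩
        q * (q * (q * q)) * v ≡⟨ cong (_* v) K-eq ⟩
        K * v ∎
        where
        V : ℕ
        V = v * (lg * lg)

  q≤b : 2 * 2 ^ g ≤ b
  q≤b = ≤-trans (^-monoʳ-≤ 2 (≤-trans (≤-trans (+-monoˡ-≤ g 1≤g) (+-monoʳ-≤ g (m≤m+n g (5 * g + g))))
    (≤-reflexive (solve 1 (λ g → g :+ (g :+ (con 5 :* g :+ g)) := con 8 :* g) refl g)))) (≤-reflexive (sym eb))

  G≤lg : 2 * G ≤ lg
  G≤lg = begin
    2 * (8 * G')   ≡⟨ solve 1 (λ x → con 2 :* (con 8 :* x) := con 16 :* x) refl G' ⟩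
    16 * G'        ≤⟨ *-monoˡ-≤ G' (≤-trans (m≤m+n 16 496) (≤-trans (≤-reflexive (sym (*-identityʳ 512))) (*-monoʳ-≤ 512 1≤g))) ⟩
    512 * g * G'   ≤⟨ G'≤lg ⟩
    lg ∎

  2G≤b : 2 * G ≤ b
  2G≤b = ≤-trans G≤lg (≤-trans lg≤ q≤b)

  4≤b : 4 ≤ b
  4≤b = ≤-trans (*-monoʳ-≤ 2 (^-monoʳ-≤ 2 1≤g)) q≤b

  module _ {n : ℕ} (lg-le : 2 ^ lg ≤ n) where

    -- One size condition for the three bounds below, which need the powers 2G + 3, G + 5 and G + 4
    -- of b. The 168 is 8 * (16 + 5).
    b-fits : b ^ (2 * G + 5) ≤ n
    b-fits = ≤-trans (≤-reflexive (b^ (2 * G + 5))) (≤-trans (^-monoʳ-≤ 2 (begin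
      8 * g * (2 * (8 * G') + 5)  ≤⟨ *-monoʳ-≤ (8 * g) (+-monoʳ-≤ (2 * (8 * G')) (*-monoʳ-≤ 5 1≤G')) ⟩
      8 * g * (2 * (8 * G') + 5 * G') ≡⟨ solve 2 (λ g x → con 8 :* g :* (con 2 :* (con 8 :* x) :+ con 5 :* x) := con 168 :* (g :* x)) refl g G' ⟩
      168 * (g * G')              ≤⟨ *-monoˡ-≤ (g * G') (m≤m+n 168 344) ⟩
      512 * (g * G')              ≡⟨ sym (*-assoc 512 g G') ⟩
      512 * g * G'                ≤⟨ G'≤lg ⟩
      lg ∎)) lg-le)

    private
      1≤b : 1 ≤ b
      1≤b = ≤-trans (s≤s z≤n) 4≤b
      bb : 4 * b ≤ b * b
      bb = *-monoˡ-≤ b 4≤b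
      pow-le : ∀ m → m ≤ 2 * G + 5 → b ^ m ≤ n
      pow-le m m≤ = ≤-trans (^-monoʳ-≤ b {{>-nonZero 1≤b}} m≤) b-fits
      Ws≤ : 2 * G + 3 ≤ b * b
      Ws≤ = ≤-trans (≤-trans (+-mono-≤ 2G≤b (≤-trans (n≤1+n 3) 4≤b))
        (≤-trans (≤-reflexive (cong (b +_) (sym (+-identityʳ b)))) (*-monoˡ-≤ b (m≤m+n 2 2)))) bb
      G≤b : G ≤ b
      G≤b = ≤-trans (m≤m+n G (G + 0)) 2G≤b

    s-fits : b ^ suc G * b ^ G * (2 * G + 3) ≤ n
    s-fits = begin
      b ^ suc G * b ^ G * (2 * G + 3) ≤⟨ *-monoʳ-≤ (b ^ suc G * b ^ G) Ws≤ ⟩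
      b ^ suc G * b ^ G * (b * b)     ≡⟨ cong₂ _*_ (sym (^-distribˡ-+-* b (suc G) G)) (cong (b *_) (sym (*-identityʳ b))) ⟩
      b ^ (suc G + G) * b ^ 2         ≡⟨ sym (^-distribˡ-+-* b (suc G + G) 2) ⟩
      b ^ (suc G + G + 2)             ≤⟨ pow-le _ (≤-trans (≤-reflexive (solve 1 (λ g → con 1 :+ g :+ g :+ con 2 := con 2 :* g :+ con 3) refl G)) (+-monoʳ-≤ (2 * G) (m≤m+n 3 2))) ⟩
      n ∎

    t-fits : G * b ^ suc G * b * (G + 4) ≤ n
    t-fits = begin
      G * b ^ suc G * b * (G + 4) ≤⟨ *-mono-≤ (*-monoˡ-≤ b (*-monoˡ-≤ (b ^ suc G) G≤b)) (≤-trans (+-mono-≤ G≤b 4≤b)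
          (≤-trans (≤-reflexive (cong (b +_) (sym (+-identityʳ b)))) (≤-trans (*-monoˡ-≤ b (m≤m+n 2 2)) bb))) ⟩
      b * b ^ suc G * b * (b * b) ≡⟨ solve 2 (λ b y → b :* (b :* y) :* b :* (b :* b) := y :* (b :* (b :* (b :* (b :* (b :* con 1)))))) refl b (b ^ G) ⟩
      b ^ G * b ^ 5               ≡⟨ sym (^-distribˡ-+-* b G 5) ⟩
      b ^ (G + 5)                 ≤⟨ pow-le _ (+-monoˡ-≤ 5 (m≤m+n G (G + 0))) ⟩
      n ∎

    letters-fit : 3 + (2 * G + 3) * b ^ suc G ≤ n
    letters-fit = begin
      3 + (2 * G + 3) * b ^ suc G ≤⟨ +-mono-≤ (≤-trans (*-monoʳ-≤ 3 (m^n>0 b {{>-nonZero 1≤b}} (3 + G)))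
                                       (≤-refl)) (*-monoˡ-≤ (b ^ suc G) Ws≤) ⟩
      3 * b ^ (3 + G) + b * b * b ^ suc G ≡⟨ solve 2 (λ b y → con 3 :* (b :* (b :* (b :* y))) :+ b :* b :* (b :* y) := con 4 :* (b :* (b :* (b :* y)))) refl b (b ^ G) ⟩
      4 * b ^ (3 + G)             ≤⟨ *-monoˡ-≤ (b ^ (3 + G)) 4≤b ⟩
      b ^ (4 + G)                 ≤⟨ pow-le _ (≤-trans (≤-reflexive (+-comm 4 G)) (+-mono-≤ (m≤m+n G (G + 0)) (n≤1+n 4))) ⟩
      n ∎

-- The search for an expensive update

search : ∀ {A R : Set} {P : A → Set} (xs : List A) → (∀ x → P x ⊎ R) → (∀ {x} → x ∈ xs → P x) ⊎ R
search [] f = inj₁ λ ()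
search (x ∷ xs) f with f x
... | inj₂ r = inj₂ r
... | inj₁ p with search xs f
...   | inj₂ r = inj₂ r
...   | inj₁ ps = inj₁ λ { (here refl) → p ; (there m) → ps m }

module Expensive {n S w : ℕ} (D : DynLCS n S w) (correct : Correct D) .{{n≢0 : NonZero n}}
  (g G' t κ lg b' r K : ℕ)
  (eb : suc b' ≡ 2 ^ (8 * g)) (eK : K ≡ 2 ^ (4 * g)) (eP : suc r ≡ 2 ^ (16 * g))
  (1≤g : 1 ≤ g) (1≤G' : 1 ≤ G') (2t≤G' : 2 * t ≤ G') (G'≤lg : 512 * g * G' ≤ lg)
  (g≤lg : g ≤ lg) (t≤lg : t ≤ lg) (lg≤ : lg ≤ 2 * 2 ^ g) (κ≤ : 4 * (26 + 17 * κ) ≤ 2 ^ g)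
  (lg-le : 2 ^ lg ≤ n) (M≤ : 1 + S * 2 ^ w ≤ 2 ^ (κ * lg)) where

  module P = Parameters g G' t κ lg (suc b') K (suc r) eb eK eP 1≤g 1≤G' 2t≤G' G'≤lg g≤lg t≤lg lg≤ κ≤
  open Network b' P.G
  open Gadget n b' P.G
  open LCS.Instances n b' P.G (P.s-fits lg-le) (P.t-fits lg-le) (P.letters-fit lg-le)

  Witness : Set
  Witness = ∃ λ us → ∃ λ u → t < costAfter D s₀ t₀ us u

  AllCheap : Set
  AllCheap = ∀ {x} → x ∈ subsets 1 edges → ∀ {y} → y ∈ upTo Y → ∀ {p} → p ∈ upTo N →
    Cheap D t (initConfig D s₀ t₀) (marks x ++ query y p ∷ [])

  -- Three nested finite searches make the alternative constructive: if no run exceeds the budget,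
  -- the counting argument applies, and otherwise a witness is at hand.
  all-cheap-or-expensive : AllCheap ⊎ Witness
  all-cheap-or-expensive = search (subsets 1 edges) λ x → search (upTo Y) λ y → search (upTo N) λ p →
    cheap-or-expensive D t (initConfig D s₀ t₀) (marks x ++ query y p ∷ [])

  not-all-cheap : AllCheap → ⊥
  not-all-cheap cheap = contradiction (P.inside-rare Y (m^n>0 b P.G))
    (P.messages-few Y (m^n>0 b P.G) (1 + S * 2 ^ w) M≤)
    where
    each-cheap : ∀ {x y p} → x ∈ subsets 1 edges → y < Y → p < N →
      Cheap D t (initConfig D s₀ t₀) (marks x ++ query y p ∷ [])
    each-cheap x∈ y< p< = cheap x∈ (∈-upTo⁺ y<) (∈-upTo⁺ p<)
    1≤K : 1 ≤ K
    1≤K = subst (1 ≤_) (sym eK) (m^n>0 2 (4 * g))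
    open Contradiction.Fitting.Assuming D correct b' P.G K r t (P.G * Y * t) (Y * G')
      (2 ^ (Y * (8 * g + 40 * g * G')))
      (P.s-fits lg-le) (P.t-fits lg-le) (P.letters-fit lg-le) each-cheap 1≤K P.2G≤b
      (P.few-writes-bound refl) (P.few-inside-bound Y)
      using (contradiction)

  expensive-update : ∃ λ s → ∃ λ t' → ∃ λ us → ∃ λ u → t < costAfter D s t' us u
  expensive-update = from all-cheap-or-expensive
    where
    from : AllCheap ⊎ Witness → ∃ λ s → ∃ λ t' → ∃ λ us → ∃ λ u → t < costAfter D s t' us u
    from (inj₁ c) = ⊥-elim (not-all-cheap c)
    from (inj₂ e) = s₀ , t₀ , e

2^[2^k]-log : ∀ {k n} → 2 ^ (2 ^ k) ≤ n → 2 ^ k ≤ ⌊log₂ n ⌋ × k ≤ ⌊log₂ ⌊log₂ n ⌋ ⌋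
2^[2^k]-log {k} {n} le = lg≥ , subst (_≤ ⌊log₂ ⌊log₂ n ⌋ ⌋) (⌊log₂[2^n]⌋≡n k) (⌊log₂⌋-mono-≤ lg≥)
  where
  lg≥ : 2 ^ k ≤ ⌊log₂ n ⌋
  lg≥ = subst (_≤ ⌊log₂ n ⌋) (⌊log₂[2^n]⌋≡n (2 ^ k)) (⌊log₂⌋-mono-≤ le)

-- `suc lg` is at most `lg + lg`, whence `2 * k`; the words contribute a, and the 1 in front of the
-- product costs one more bit, at most lg.
cells-bound : ∀ k a lg {n S w} → 1 ≤ lg → n ≤ 2 ^ suc lg → S ≤ n ^ k → w ≤ a * lg →
  1 + S * 2 ^ w ≤ 2 ^ ((2 * k + a + 1) * lg)
cells-bound k a lg {n} {S} {w} 1≤lg n≤ S≤ w≤ = begin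
  1 + S * 2 ^ w                     ≤⟨ +-monoʳ-≤ 1 (*-mono-≤ (≤-trans S≤ (^-monoˡ-≤ k n≤)) (^-monoʳ-≤ 2 w≤)) ⟩
  1 + (2 ^ suc lg) ^ k * 2 ^ (a * lg) ≡⟨ cong (1 +_) (trans (cong (_* 2 ^ (a * lg)) (pow-pow (suc lg) k)) (pow-* (suc lg * k) (a * lg))) ⟩
  1 + 2 ^ e                         ≤⟨ +-monoˡ-≤ (2 ^ e) (m^n>0 2 e) ⟩
  2 ^ e + 2 ^ e                     ≡⟨ cong (2 ^ e +_) (sym (+-identityʳ (2 ^ e))) ⟩
  2 ^ suc e                         ≤⟨ ^-monoʳ-≤ 2 (begin
    suc (suc lg * k + a * lg)           ≤⟨ +-mono-≤ 1≤lg (+-monoˡ-≤ (a * lg) (*-monoˡ-≤ k (+-monoˡ-≤ lg 1≤lg))) ⟩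
    lg + ((lg + lg) * k + a * lg)       ≡⟨ solve 3 (λ l k a → l :+ ((l :+ l) :* k :+ a :* l) := (con 2 :* k :+ a :+ con 1) :* l) refl lg k a ⟩
    (2 * k + a + 1) * lg ∎) ⟩
  2 ^ ((2 * k + a + 1) * lg) ∎
  where
  open ≤-Reasoning
  e : ℕ
  e = suc lg * k + a * lg

<-suc-/ : ∀ m o .{{_ : NonZero o}} → m < suc (m / o) * o
<-suc-/ m o = subst (_< suc (m / o) * o) (sym (m≡m%n+[m/n]*n m o)) (+-monoˡ-< (m / o * o) (m%n<n m o))

*-≤⇒≤-/ : ∀ {q m} o .{{_ : NonZero o}} → q * o ≤ m → q ≤ m / o
*-≤⇒≤-/ {q} o le = subst (_≤ _) (m*n/n≡m q o) (/-monoˡ-≤ o le)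

module Threshold (k a ℓ₀ : ℕ) (13≤ℓ₀ : 13 ≤ ℓ₀) (κ≤ℓ₀ : 4 * (26 + 17 * (2 * k + a + 1)) ≤ ℓ₀) where

  private
    κ : ℕ
    κ = 2 * k + a + 1

  expensive : ∀ n S w → n ≥ 2 ^ (2 ^ ℓ₀) → S ≤ n ^ k → w ≤ a * ⌊log₂ n ⌋ → (D : DynLCS n S w) → Correct D →
    Σ (Str (Alph n) n) (λ s → Σ (Str (Alph n) n) (λ t → Σ (List (Upd n)) (λ us → Σ (Upd n) (λ u →
      ⌊log₂ n ⌋ ≤ 1024 * costAfter D s t us u * ⌊log₂ ⌊log₂ n ⌋ ⌋))))
  expensive n S w n≥ S≤ w≤ D correct =
    let s , t' , us , u , t<cost = expensive-update in s , t' , us , u , bound t<cost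
    where
    lg g : ℕ
    lg = ⌊log₂ n ⌋
    g = ⌊log₂ lg ⌋
    large : 2 ^ ℓ₀ ≤ lg × ℓ₀ ≤ g
    large = 2^[2^k]-log n≥
    1≤n : 1 ≤ n
    1≤n = ≤-trans (m^n>0 2 (2 ^ ℓ₀)) n≥
    1≤lg : 1 ≤ lg
    1≤lg = ≤-trans (m^n>0 2 ℓ₀) (proj₁ large)
    13≤g : 13 ≤ g
    13≤g = ≤-trans 13≤ℓ₀ (proj₂ large)
    1≤g : 1 ≤ g
    1≤g = ≤-trans (s≤s z≤n) 13≤g
    2^g≤lg : 2 ^ g ≤ lg
    2^g≤lg = 2^log≤ lg 1≤lg
    512g≤lg : 512 * g ≤ lg
    512g≤lg = ≤-trans (subst (λ z → 512 * z ≤ 2 ^ z) (m+[n∸m]≡n 13≤g) (512n≤2^n (g ∸ 13))) 2^g≤lg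
    instance
      512g≢0 : NonZero (512 * g)
      512g≢0 = >-nonZero (*-mono-≤ {1} {512} (s≤s z≤n) 1≤g)
      1024g≢0 : NonZero (1024 * g)
      1024g≢0 = >-nonZero (*-mono-≤ {1} {1024} (s≤s z≤n) 1≤g)
    -- With 512 the power b^(2G+5) fits into n, and 1024 is its double, so that `2 * t ≤ G'`.
    G' t : ℕ
    G' = lg / (512 * g)
    t = lg / (1024 * g)
    2t≤G' : 2 * t ≤ G'
    2t≤G' = *-≤⇒≤-/ (512 * g) (≤-trans (≤-reflexive
      (solve 2 (λ t g → con 2 :* t :* (con 512 :* g) := t :* (con 1024 :* g)) refl t g)) (m/n*n≤m lg (1024 * g)))

    open Expensive D correct {{>-nonZero 1≤n}} g G' t κ lg
      (pred (2 ^ (8 * g))) (pred (2 ^ (16 * g))) (2 ^ (4 * g))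
      (suc-pred (2 ^ (8 * g)) {{m^n≢0 2 (8 * g)}}) refl (suc-pred (2 ^ (16 * g)) {{m^n≢0 2 (16 * g)}})
      1≤g (m≥n⇒m/n>0 512g≤lg) 2t≤G' (≤-trans (≤-reflexive (*-comm (512 * g) G')) (m/n*n≤m lg (512 * g)))
      (≤-trans (n≤2^n g) 2^g≤lg) (m/n≤m lg (1024 * g)) (<⇒≤ (<2^log lg))
      (≤-trans (≤-trans κ≤ℓ₀ (proj₂ large)) (n≤2^n g))
      (2^log≤ n 1≤n) (cells-bound k a lg 1≤lg (<⇒≤ (<2^log n)) S≤ w≤)
      using (expensive-update)

    -- The cost strictly exceeds t, which makes up for the rounding in t.
    bound : ∀ {c} → t < c → lg ≤ 1024 * c * g
    bound {c} t<c = begin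
      lg                     ≤⟨ <⇒≤ (<-suc-/ lg (1024 * g)) ⟩
      suc t * (1024 * g)     ≤⟨ *-monoˡ-≤ (1024 * g) t<c ⟩
      c * (1024 * g)         ≡⟨ solve 2 (λ c g → c :* (con 1024 :* g) := con 1024 :* c :* g) refl c g ⟩
      1024 * c * g ∎
      where open ≤-Reasoning

theorem5p10 : ∀ (k a : ℕ)
    → Σ ℕ (λ d → Σ ℕ (λ n₀ → ∀ (n S w : ℕ) → n ≥ n₀ → S ≤ n ^ k → w ≤ a * ⌊log₂ n ⌋
    → (D : DynLCS n S w) → Correct D
    → Σ (Str (Alph n) n) (λ s → Σ (Str (Alph n) n) (λ t → Σ (List (Upd n)) (λ us → Σ (Upd n) (λ u →
    ⌊log₂ n ⌋ ≤ d * costAfter D s t us u * ⌊log₂ ⌊log₂ n ⌋ ⌋))))))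
theorem5p10 k a = 1024 , 2 ^ (2 ^ ℓ₀) , Threshold.expensive k a ℓ₀ (m≤m+n 13 c) (m≤n+m c 13)
  where
  c ℓ₀ : ℕ
  c = 4 * (26 + 17 * (2 * k + a + 1))
  -- A sum in place of a maximum: log log n has to be at least 13 and at least c.
  ℓ₀ = 13 + c
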